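{- Let $p>3$ be a prime and let $i>1$ be an integer not divisible by $p$. Define integers $a_n$ by \[ \frac{(q^i;q^i)_{\infty}}{(q^p;q^p)_{\infty}}=\sum_{n=0}^{\infty}a_n q^n . \] For $0\le r\le p-1$ define $\mathcal{L}(r)$ as follows. If $p\equiv 1\pmod 3$, \[ \mathcal{L}(r)=\begin{cases} 6r^2+r & \text{if } r\le \frac{4p-1}{12},\\ 6r^2+r-8pr+\frac{8p^2-2p}{3} & \text{if } \frac{4p-1}{12}<r\le\frac{10p-1}{12},\\ 6r^2+r-12pr+(6p^2-p) & \text{if } r>\frac{10p-1}{12},\end{cases} \] and if $p\equiv -1\pmod 3$, \[ \mathcal{L}(r)=\begin{cases} 6r^2+r & \text{if } r\le \frac{2p-1}{12},\\ 6r^2+r-4pr+\frac{2p^2-p}{3} & \text{if } \frac{2p-1}{12}<r\le\frac{8p-1}{12},\\ 6r^2+r-12pr+(6p^2-p) & \text{if } r>\frac{8p-1}{12}.\end{cases} \] Define \[ N=N(p,i)=\max\Big(\bigcup_{s=0}^{p-1}\min\{\,i\mathcal{L}(r):\ i\mathcal{L}(r)\equiv s \pmod p,\ 0\le r\le p-1\,\}\Big)-p, \] where the union is over those residues $s$ for which the set is nonempty. Then for all $n>N$: (1) if $p\equiv 1\pmod 3$, then $a_n>0$ if $n\equiv i(6r^2+r)\pmod p$ for some $0\le r\le p-1$ with $r\le \frac{4p-1}{12}$ or $r>\frac{10p-1}{12}$; $a_n<0$ if $n\equiv i(6r^2+r)\pmod p$ for some $0\le r\le p-1$ with $\frac{4p-1}{12}<r\le\frac{10p-1}{12}$;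 and $a_n=0$ if $n\not\equiv i(6r^2+r)\pmod p$ for every $r$; (2) if $p\equiv -1\pmod 3$, then $a_n>0$ if $n\equiv i(6r^2+r)\pmod p$ for some $0\le r\le p-1$ with $r\le \frac{2p-1}{12}$ or $r>\frac{8p-1}{12}$; $a_n<0$ if $n\equiv i(6r^2+r)\pmod p$ for some $0\le r\le p-1$ with $\frac{2p-1}{12}<r\le\frac{8p-1}{12}$; and $a_n=0$ if $n\not\equiv i(6r^2+r)\pmod p$ for every $r$.
   Context: For $|q|<1$ and integer $k\ge1$, $(q^k;q^k)_\infty=\prod_{m\ge1}(1-q^{km})$. The expansion is a formal power series in $q$ with integer coefficients. -}

module Defs where

open import Data.Bool using (Bool; true; false; if_then_else_)
open import Data.Nat as ℕ using (ℕ; zero; suc; _∸_; _≤ᵇ_; _≡ᵇ_)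
open import Data.Nat.DivMod using (_/_; _%_)
import Data.Nat.Divisibility as ℕD
open import Data.Integer as ℤ using (ℤ; +_; _+_; _-_; _*_; _⊓_; _⊔_)
open import Data.Integer.Divisibility using (_∣_)
open import Data.List using (List; []; _∷_; map; foldr; upTo; applyUpTo; filter; catMaybes)
open import Data.Maybe using (Maybe; just; nothing)
open import Relation.Nullary using (Dec)

Series : Set
Series = ℕ → ℤ

one : Series
one zero    = + 1
one (suc _) = + 0

sumℤ : List ℤ → ℤ
sumℤ = foldr _+_ (+ 0)

mulOneMinus : ℕ → Series → Series
mulOneMinus k f n = f n - (if k ≤ᵇ n then f (n ∸ k) else + 0)

-- multiplication by 1/(1 - q^k) = Σ_j q^{jk}   (used for k ≥ 1)
divOneMinus : ℕ → Series → Series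
divOneMinus k f n =
  sumℤ (map (λ j → if j ℕ.* k ≤ᵇ n then f (n ∸ j ℕ.* k) else + 0) (upTo (suc n)))

partialProd : ℕ → ℕ → ℕ → Series
partialProd p i M =
  foldr (λ m g → mulOneMinus (i ℕ.* m) (divOneMinus (p ℕ.* m) g)) one (applyUpTo suc M)

-- a_n = coefficient of q^n in (q^i;q^i)_∞ / (q^p;q^p)_∞ .
-- For p, i ≥ 1 the factors with m > n do not affect the coefficient of q^n,
-- so it equals the coefficient of q^n in the partial product up to m = n.
coeff : ℕ → ℕ → ℕ → ℤ
coeff p i n = partialProd p i n n

L : ℕ → ℕ → ℤ
L p r =
  if p % 3 ≡ᵇ 1
  then (if 12 ℕ.* r ℕ.+ 1 ≤ᵇ 4 ℕ.* p then base
        else if 12 ℕ.* r ℕ.+ 1 ≤ᵇ 10 ℕ.* p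
             then base - + (8 ℕ.* p ℕ.* r) + + ((8 ℕ.* p ℕ.* p ∸ 2 ℕ.* p) / 3)
             else base - + (12 ℕ.* p ℕ.* r) + + (6 ℕ.* p ℕ.* p ∸ p))
  else (if 12 ℕ.* r ℕ.+ 1 ≤ᵇ 2 ℕ.* p then base
        else if 12 ℕ.* r ℕ.+ 1 ≤ᵇ 8 ℕ.* p
             then base - + (4 ℕ.* p ℕ.* r) + + ((2 ℕ.* p ℕ.* p ∸ p) / 3)
             else base - + (12 ℕ.* p ℕ.* r) + + (6 ℕ.* p ℕ.* p ∸ p))
  where
  base : ℤ
  base = + (6 ℕ.* r ℕ.* r ℕ.+ r)

_≡?_[mod_] : (x y : ℤ) (m : ℕ) → Dec ((+ m) ∣ (x - y))
x ≡? y [mod m ] = m ℕD.∣? ℤ.∣ x - y ∣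

minimumℤ : List ℤ → Maybe ℤ
minimumℤ []       = nothing
minimumℤ (x ∷ xs) = just (foldr _⊓_ x xs)

maximumℤ : List ℤ → Maybe ℤ
maximumℤ []       = nothing
maximumℤ (x ∷ xs) = just (foldr _⊔_ x xs)

iLvals : ℕ → ℕ → List ℤ
iLvals p i = map (λ r → + i * L p r) (upTo p)

minsByResidue : ℕ → ℕ → List ℤ
minsByResidue p i =
  catMaybes (map (λ s → minimumℤ (filter (λ v → v ≡? + s [mod p ]) (iLvals p i))) (upTo p))

-- N = max(union of minima) - p   (the union is nonempty for p ≥ 1;
-- the default 0 for the empty case is never used)
N : ℕ → ℕ → ℤ
N p i with maximumℤ (minsByResidue p i)
... | just m  = m - + p
... | nothing = + 0 - + p

{-# OPTIONS --safe #-}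

-- By the pentagonal number theorem a_n = Σ_k ± P(n - e_k), where e_k = i k(3k ± 1)/2 and P generates
-- 1/(x^p; x^p)_∞, so that only the k with e_k ≡ n (mod p) contribute. Centring k at ±(p ± 1)/6 makes
-- them the integers x ≡ ±b (mod p) with 0 ≤ 2b < p, and e at x is e at b plus p times a nonnegative number.
-- Hence, up to the sign (-1)^j read off from the position of r, the a_n in a class are the coefficients of
-- T/(x; x)_∞, where T is the theta series of the class: a pentagonal series for b = 0, and for b > 0 a quintuple
-- sum, equal to (Q, x^(2B), x^(P-2B); Q)_∞ / (x^B, x^(P-B); Q)_∞ with P = ip, B = ib, Q = x^P.
-- The numerator cancels against distinct factors of (x; x)_∞; since i > 1 the factor 1 - x survives
-- in the denominator, and all coefficients are positive.

module Submission where

open import Defs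
open import Data.Bool as Bool using (Bool; true; false; if_then_else_; _∨_)
open import Data.Empty using (⊥; ⊥-elim)
open import Data.Integer as ℤ using (ℤ; +_)
open import Data.Integer using (-[1+_]; _⊖_; 0ℤ; 1ℤ; ∣_∣; _⊔_)
import Data.Integer.DivMod as ℤDM
open import Data.Integer.Divisibility as ℤD using ()
import Data.Integer.Divisibility.Signed as Signed
import Data.Integer.Properties as ℤₚ
open import Data.Integer.Tactic.RingSolver using (solve-∀)
open import Data.List as List using (List; []; _∷_; foldr; filter; map; upTo; catMaybes)
open import Data.List.Membership.Propositional using (_∈_)
open import Data.List.Membership.Propositional.Properties using (∈-map⁺; ∈-map⁻; ∈-upTo⁺; ∈-filter⁺; ∈-filter⁻; foldr-selective)
import Data.List.Properties as Listₚ
open import Data.List.Relation.Unary.Any using (here; there)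
open import Data.Maybe using (Maybe; just; nothing)
import Data.Nat as ℕ
open import Data.Nat using (ℕ; zero; suc; _∸_; _≤ᵇ_; _≡ᵇ_)
import Data.Nat.DivMod as ℕDM
import Data.Nat.Divisibility as ℕD
import Data.Nat.Properties as ℕₚ
import Data.Nat.Tactic.RingSolver as ℕSolver
open import Data.Nat.Primality using (Prime; euclidsLemma; prime⇒irreducible)
open import Data.Product using (_,_; _×_; Σ; proj₁; proj₂)
open import Data.Sum as Sum using (_⊎_; inj₁; inj₂)
open import Data.Unit using (tt)
open import Relation.Nullary using (¬_; yes; no)
open import Relation.Binary.PropositionalEquality using (_≡_; _≢_; refl; sym; trans; cong; cong₂; subst; module ≡-Reasoning)
open import Algebra.Bundles using (CommutativeRing)
import Algebra.Properties.AbelianGroup ℤₚ.+-0-abelianGroup as ℤ+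
import Algebra.Solver.Ring as RingSolver
import Algebra.Solver.Ring.AlmostCommutativeRing as ACR
open import Level using (0ℓ)
import Relation.Binary.Reasoning.Setoid as SetoidReasoning

-- Nothing infinite is formed. A product is represented by its partial products, compared modulo a
-- power of `x`; a bilateral sum carries a window outside which its terms vanish; division is
-- multiplication by a series of constant term 1 followed by cancellation. Hence the quintuple
-- identity is proved with its denominator cleared, as an equality of two products of theta series,
-- by grouping double sums by powers of `z = x^B`. The sign pattern arises because `i(6r² + r)` is
-- the exponent at the even index `k = ±2r`, while a step of `p` in the index flips the sign, `p`
-- being odd. Oddness also rules out `2b = p` and `4b = p`: the residues `b` and `-b` are distinct,
-- and so are the numerator factors. The bound `N` enters as follows. Every `i · L(r)` is an
-- exponent of its class, hence at least the exponent at `b`. If `n > N`, some `i · L(r)` in the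
-- class of `n` is at most `n`, so `n` is the exponent at `b` plus a nonnegative multiple of `p`.
-- That `r` may differ from the given one; the class alone determines `b`.

-- Formal power series over the integers and congruences modulo powers of `x`.

module PowerSeries where
  open import Data.Integer using (_+_; _-_; _*_; -_)

  infix 4 _≈_
  infixl 6 _+ˢ_
  infixl 7 _*ˢ_
  infix 8 -ˢ_

  +-congˡ : ∀ a {b c} → b ≡ c → a + b ≡ a + c
  +-congˡ a = cong (λ z → a + z)

  _≈_ : Series → Series → Set
  f ≈ g = ∀ n → f n ≡ g n

  tail : Series → Series
  tail f n = f (suc n)

  zeroˢ : Series
  zeroˢ _ = 0ℤ

  _+ˢ_ : Series → Series → Series
  (f +ˢ g) n = f n + g n

  -ˢ_ : Series → Series
  (-ˢ f) n = - f n

  -- Convolution read off from `f = f 0 + x · tail f`. With this recursion the ring laws follow by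
  -- induction on the coefficient, without any finite sums.
  _*ˢ_ : Series → Series → Series
  (f *ˢ g) zero    = f 0 * g 0
  (f *ˢ g) (suc n) = f 0 * g (suc n) + (tail f *ˢ g) n

  *ˢ-cong-≤ : ∀ n {f f′ g g′} → (∀ m → m ℕ.≤ n → f m ≡ f′ m) → (∀ m → m ℕ.≤ n → g m ≡ g′ m) →
              (f *ˢ g) n ≡ (f′ *ˢ g′) n
  *ˢ-cong-≤ zero    p q = cong₂ _*_ (p 0 ℕ.z≤n) (q 0 ℕ.z≤n)
  *ˢ-cong-≤ (suc n) p q = cong₂ _+_ (cong₂ _*_ (p 0 ℕ.z≤n) (q (suc n) ℕₚ.≤-refl))
    (*ˢ-cong-≤ n (λ m m≤n → p (suc m) (ℕ.s≤s m≤n)) (λ m m≤n → q m (ℕₚ.m≤n⇒m≤1+n m≤n)))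

  *ˢ-cong : ∀ {f f′ g g′} → f ≈ f′ → g ≈ g′ → f *ˢ g ≈ f′ *ˢ g′
  *ˢ-cong p q n = *ˢ-cong-≤ n (λ m _ → p m) (λ m _ → q m)

  *ˢ-zeroˡ : ∀ g → zeroˢ *ˢ g ≈ zeroˢ
  *ˢ-zeroˡ g zero    = refl
  *ˢ-zeroˡ g (suc n) = trans (ℤₚ.+-identityˡ _) (*ˢ-zeroˡ g n)

  *ˢ-distribʳ : ∀ h f g → (f +ˢ g) *ˢ h ≈ f *ˢ h +ˢ g *ˢ h
  *ˢ-distribʳ h f g zero    = ℤₚ.*-distribʳ-+ (h 0) (f 0) (g 0)
  *ˢ-distribʳ h f g (suc n) =
    trans (+-congˡ ((f 0 + g 0) * h (suc n)) (*ˢ-distribʳ h (tail f) (tail g) n))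
          (lem (f 0) (g 0) (h (suc n)) ((tail f *ˢ h) n) ((tail g *ˢ h) n))
    where
    lem : ∀ a b c d e → (a + b) * c + (d + e) ≡ a * c + d + (b * c + e)
    lem = solve-∀

  *ˢ-scaleˡ : ∀ c f g n → ((λ m → c * f m) *ˢ g) n ≡ c * (f *ˢ g) n
  *ˢ-scaleˡ c f g zero    = ℤₚ.*-assoc c (f 0) (g 0)
  *ˢ-scaleˡ c f g (suc n) =
    trans (+-congˡ (c * f 0 * g (suc n)) (*ˢ-scaleˡ c (tail f) g n))
          (lem c (f 0) (g (suc n)) ((tail f *ˢ g) n))
    where
    lem : ∀ a b c d → a * b * c + a * d ≡ a * (b * c + d)
    lem = solve-∀

  -- The mirror image of the defining recursion, peeling the constant term off the right factor;
  -- commutativity is the comparison of the two.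
  *ˢ-tailʳ : ∀ f g n → (f *ˢ g) (suc n) ≡ f (suc n) * g 0 + (f *ˢ tail g) n
  *ˢ-tailʳ f g zero    = ℤₚ.+-comm (f 0 * g 1) (f 1 * g 0)
  *ˢ-tailʳ f g (suc n) =
    trans (+-congˡ (f 0 * g (suc (suc n))) (*ˢ-tailʳ (tail f) g n))
          (lem (f 0 * g (suc (suc n))) (f (suc (suc n)) * g 0) ((tail f *ˢ tail g) n))
    where
    lem : ∀ a b c → a + (b + c) ≡ b + (a + c)
    lem = solve-∀

  *ˢ-comm : ∀ f g → f *ˢ g ≈ g *ˢ f
  *ˢ-comm f g zero    = ℤₚ.*-comm (f 0) (g 0)
  *ˢ-comm f g (suc n) = trans (cong₂ _+_ (ℤₚ.*-comm (f 0) (g (suc n))) (*ˢ-comm (tail f) g n))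
                              (sym (*ˢ-tailʳ g f n))

  *ˢ-assoc : ∀ f g h → (f *ˢ g) *ˢ h ≈ f *ˢ (g *ˢ h)
  *ˢ-assoc f g h zero    = ℤₚ.*-assoc (f 0) (g 0) (h 0)
  *ˢ-assoc f g h (suc n) = begin
    f 0 * g 0 * h (suc n) + (tail (f *ˢ g) *ˢ h) n
      ≡⟨ +-congˡ (f 0 * g 0 * h (suc n)) (*ˢ-distribʳ h (λ m → f 0 * tail g m) (tail f *ˢ g) n) ⟩
    f 0 * g 0 * h (suc n) + (((λ m → f 0 * tail g m) *ˢ h) n + ((tail f *ˢ g) *ˢ h) n)
      ≡⟨ +-congˡ (f 0 * g 0 * h (suc n)) (cong₂ _+_ (*ˢ-scaleˡ (f 0) (tail g) h n) (*ˢ-assoc (tail f) g h n)) ⟩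
    f 0 * g 0 * h (suc n) + (f 0 * (tail g *ˢ h) n + (tail f *ˢ (g *ˢ h)) n)
      ≡⟨ lem (f 0) (g 0) (h (suc n)) ((tail g *ˢ h) n) _ ⟩
    f 0 * (g 0 * h (suc n) + (tail g *ˢ h) n) + (tail f *ˢ (g *ˢ h)) n ∎
    where
    open ≡-Reasoning
    lem : ∀ a b c d e → a * b * c + (a * d + e) ≡ a * (b * c + d) + e
    lem = solve-∀

  *ˢ-identityˡ : ∀ g → one *ˢ g ≈ g
  *ˢ-identityˡ g zero    = ℤₚ.*-identityˡ (g 0)
  *ˢ-identityˡ g (suc n) =
    trans (cong₂ _+_ (ℤₚ.*-identityˡ (g (suc n))) (*ˢ-zeroˡ g n)) (ℤₚ.+-identityʳ _)

  *ˢ-identityʳ : ∀ g → g *ˢ one ≈ g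
  *ˢ-identityʳ g n = trans (*ˢ-comm g one n) (*ˢ-identityˡ g n)

  *ˢ-distribˡ : ∀ h f g → h *ˢ (f +ˢ g) ≈ h *ˢ f +ˢ h *ˢ g
  *ˢ-distribˡ h f g n = trans (*ˢ-comm h (f +ˢ g) n)
    (trans (*ˢ-distribʳ h f g n) (cong₂ _+_ (*ˢ-comm f h n) (*ˢ-comm g h n)))

  seriesRing : CommutativeRing 0ℓ 0ℓ
  seriesRing = record
    { Carrier = Series ; _≈_ = _≈_ ; _+_ = _+ˢ_ ; _*_ = _*ˢ_ ; -_ = -ˢ_ ; 0# = zeroˢ ; 1# = one
    ; isCommutativeRing = record
      { isRing = record
        { +-isAbelianGroup = record
          { isGroup = record
            { isMonoid = record
              { isSemigroup = record
                { isMagma = record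
                  { isEquivalence = record
                    { refl = λ _ → refl ; sym = λ p n → sym (p n) ; trans = λ p q n → trans (p n) (q n) }
                  ; ∙-cong = λ p q n → cong₂ _+_ (p n) (q n) }
                ; assoc = λ f g h n → ℤₚ.+-assoc (f n) (g n) (h n) }
              ; identity = (λ f n → ℤₚ.+-identityˡ (f n)) , λ f n → ℤₚ.+-identityʳ (f n) }
            ; inverse = (λ f n → ℤₚ.+-inverseˡ (f n)) , λ f n → ℤₚ.+-inverseʳ (f n)
            ; ⁻¹-cong = λ p n → cong -_ (p n) }
          ; comm = λ f g n → ℤₚ.+-comm (f n) (g n) }
        ; *-cong = *ˢ-cong
        ; *-assoc = *ˢ-assoc
        ; *-identity = *ˢ-identityˡ , *ˢ-identityʳ
        ; distrib = *ˢ-distribˡ , *ˢ-distribʳ }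
      ; *-comm = *ˢ-comm } }

  open CommutativeRing seriesRing public using ()
    renaming (setoid to seriesSetoid; refl to ≈-refl; sym to ≈-sym; trans to ≈-trans; +-cong to +ˢ-cong; -‿cong to -ˢ-cong)

  const : ℤ → Series
  const c zero    = c
  const c (suc n) = 0ℤ

  private
    seriesACR : ACR.AlmostCommutativeRing 0ℓ 0ℓ
    seriesACR = ACR.fromCommutativeRing seriesRing

    const-morphism : CommutativeRing.rawRing ℤₚ.+-*-commutativeRing ACR.-Raw-AlmostCommutative⟶ seriesACR
    const-morphism = record
      { ⟦_⟧    = const
      ; +-homo = λ { a b zero → refl ; a b (suc n) → refl }
      ; *-homo = λ { a b zero → refl ; a b (suc n) → sym (const-*ˢ a b n) }
      ; -‿homo = λ { a zero → refl ; a (suc n) → refl }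
      ; 0-homo = λ { zero → refl ; (suc n) → refl }
      ; 1-homo = λ { zero → refl ; (suc n) → refl } }
      where
      const-*ˢ : ∀ a b n → a * 0ℤ + (tail (const a) *ˢ const b) n ≡ 0ℤ
      const-*ˢ a b n = cong₂ _+_ (ℤₚ.*-zeroʳ a) (*ˢ-zeroˡ (const b) n)

    const≟ : ∀ a b → Maybe (const a ≈ const b)
    const≟ a b with a ℤ.≟ b
    ... | yes refl = just (λ _ → refl)
    ... | no  _    = nothing

  module SeriesSolver = RingSolver (CommutativeRing.rawRing ℤₚ.+-*-commutativeRing) seriesACR const-morphism const≟

  shift : ℕ → Series → Series
  shift zero    g n       = g n
  shift (suc e) g zero    = 0ℤ
  shift (suc e) g (suc n) = shift e g n

  x^_ : ℕ → Series
  x^ e = shift e one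

  infix 9 x^_

  shift-cong : ∀ e {f g} → f ≈ g → shift e f ≈ shift e g
  shift-cong zero    p n       = p n
  shift-cong (suc e) p zero    = refl
  shift-cong (suc e) p (suc n) = shift-cong e p n

  shift-*ˢ : ∀ e f g → shift e f *ˢ g ≈ shift e (f *ˢ g)
  shift-*ˢ zero    f g n       = refl
  shift-*ˢ (suc e) f g zero    = refl
  shift-*ˢ (suc e) f g (suc n) = trans (ℤₚ.+-identityˡ _) (shift-*ˢ e f g n)

  x^-*ˢ : ∀ e g → x^ e *ˢ g ≈ shift e g
  x^-*ˢ e g n = trans (shift-*ˢ e one g n) (shift-cong e (*ˢ-identityˡ g) n)

  shift-+ : ∀ a b g → shift (a ℕ.+ b) g ≈ shift a (shift b g)
  shift-+ zero    b g n       = refl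
  shift-+ (suc a) b g zero    = refl
  shift-+ (suc a) b g (suc n) = shift-+ a b g n

  x^-+ : ∀ a b → x^ (a ℕ.+ b) ≈ x^ a *ˢ x^ b
  x^-+ a b n = trans (shift-+ a b one n) (sym (x^-*ˢ a (x^ b) n))

  shift-< : ∀ e g n → n ℕ.< e → shift e g n ≡ 0ℤ
  shift-< (suc e) g zero    _         = refl
  shift-< (suc e) g (suc n) (ℕ.s≤s l) = shift-< e g n l

  shift-≥ : ∀ e g n → shift e g (e ℕ.+ n) ≡ g n
  shift-≥ zero    g n = refl
  shift-≥ (suc e) g n = shift-≥ e g n

  1-x^_ : ℕ → Series
  1-x^ e = one +ˢ -ˢ x^ e

  infix 9 1-x^_

  infix 4 _≈[_]_
  -- Congruence modulo `x^D`, the form in which identities between infinite products are stated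
  -- below.
  _≈[_]_ : Series → ℕ → Series → Set
  f ≈[ D ] g = ∀ m → m ℕ.< D → f m ≡ g m

  *ˢ-cong-mod : ∀ {D f f′ g g′} → f ≈[ D ] f′ → g ≈[ D ] g′ → f *ˢ g ≈[ D ] f′ *ˢ g′
  *ˢ-cong-mod p q m m<D = *ˢ-cong-≤ m (λ k k≤m → p k (ℕₚ.≤-<-trans k≤m m<D)) (λ k k≤m → q k (ℕₚ.≤-<-trans k≤m m<D))

  -- In degree `m` the equation reads `u 0 · f m` plus terms involving only lower coefficients of
  -- `f`, and `u 0` is 1, so the coefficients are determined one after the other. This replaces
  -- division by a product.
  *ˢ-cancelˡ-mod : ∀ {D} u f g → u 0 ≡ 1ℤ → u *ˢ f ≈[ D ] u *ˢ g → f ≈[ D ] g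
  *ˢ-cancelˡ-mod {D} u f g u₀ p m m<D = upto m m<D m ℕₚ.≤-refl
    where
    upto : ∀ m → m ℕ.< D → ∀ k → k ℕ.≤ m → f k ≡ g k
    upto zero m<D zero k≤m = begin
      f 0        ≡⟨ sym (ℤₚ.*-identityˡ _) ⟩
      1ℤ * f 0   ≡⟨ cong (_* f 0) (sym u₀) ⟩
      u 0 * f 0  ≡⟨ p 0 m<D ⟩
      u 0 * g 0  ≡⟨ cong (_* g 0) u₀ ⟩
      1ℤ * g 0   ≡⟨ ℤₚ.*-identityˡ _ ⟩
      g 0        ∎
      where open ≡-Reasoning
    upto (suc m) m<D k k≤m with ℕₚ.m≤n⇒m<n∨m≡n k≤m
    ... | inj₁ (ℕ.s≤s k≤m′) = upto m (ℕₚ.<-trans (ℕₚ.n<1+n m) m<D) k k≤m′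
    ... | inj₂ refl = begin
      f k         ≡⟨ sym (ℤₚ.*-identityˡ _) ⟩
      1ℤ * f k    ≡⟨ cong (_* f k) (sym u₀) ⟩
      u 0 * f k   ≡⟨ ℤ+.∙-cancelʳ ((tail u *ˢ f) m) _ _ (trans (p k m<D) (+-congˡ (u 0 * g k) (sym eq))) ⟩
      u 0 * g k   ≡⟨ cong (_* g k) u₀ ⟩
      1ℤ * g k    ≡⟨ ℤₚ.*-identityˡ _ ⟩
      g k         ∎
      where
      open ≡-Reasoning
      eq : (tail u *ˢ f) m ≡ (tail u *ˢ g) m
      eq = *ˢ-cong-≤ m (λ _ _ → refl) (upto m (ℕₚ.<-trans (ℕₚ.n<1+n m) m<D))

  1-x^-*ˢ : ∀ e g n → (1-x^ e *ˢ g) n ≡ g n - shift e g n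
  1-x^-*ˢ e g n = trans (*ˢ-distribʳ g one (-ˢ x^ e) n)
    (cong₂ _+_ (*ˢ-identityˡ g n) (trans (negˡ n) (cong -_ (x^-*ˢ e g n))))
    where
    negˡ : -ˢ x^ e *ˢ g ≈ -ˢ (x^ e *ˢ g)
    negˡ = ≈-trans (λ m → *ˢ-cong {g = g} (λ k → sym (ℤₚ.-1*i≡-i ((x^ e) k))) (λ _ → refl) m)
      (λ m → trans (*ˢ-scaleˡ ℤ.-1ℤ (x^ e) g m) (ℤₚ.-1*i≡-i _))

-- Finite sums of integers.

module FiniteSums where
  open PowerSeries
  open import Data.Integer using (_+_; _-_; _*_; -_)

  ∑ : ℕ → (ℕ → ℤ) → ℤ
  ∑ zero    f = 0ℤ
  ∑ (suc n) f = ∑ n f + f n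

  ∑-cong-< : ∀ n {f g} → (∀ k → k ℕ.< n → f k ≡ g k) → ∑ n f ≡ ∑ n g
  ∑-cong-< zero    p = refl
  ∑-cong-< (suc n) p = cong₂ _+_ (∑-cong-< n (λ k l → p k (ℕₚ.m≤n⇒m≤1+n l))) (p n ℕₚ.≤-refl)

  ∑-head : ∀ n f → ∑ (suc n) f ≡ f 0 + ∑ n (λ k → f (suc k))
  ∑-head zero    f = ℤₚ.+-comm 0ℤ (f 0)
  ∑-head (suc n) f = trans (cong (λ z → z + f (suc n)) (∑-head n f)) (ℤₚ.+-assoc (f 0) _ _)

  ∑-distrib-+ : ∀ n f g → ∑ n (λ k → f k + g k) ≡ ∑ n f + ∑ n g
  ∑-distrib-+ zero    f g = refl
  ∑-distrib-+ (suc n) f g = trans (cong (λ z → z + (f n + g n)) (∑-distrib-+ n f g)) (lem (∑ n f) (∑ n g) (f n) (g n))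
    where
    lem : ∀ a b c d → a + b + (c + d) ≡ a + c + (b + d)
    lem = solve-∀

  ∑-zero : ∀ n {f} → (∀ k → k ℕ.< n → f k ≡ 0ℤ) → ∑ n f ≡ 0ℤ
  ∑-zero zero    p = refl
  ∑-zero (suc n) p = cong₂ _+_ (∑-zero n (λ k l → p k (ℕₚ.m≤n⇒m≤1+n l))) (p n ℕₚ.≤-refl)

  ∑-reverse : ∀ n f → ∑ (suc n) f ≡ ∑ (suc n) (λ k → f (n ∸ k))
  ∑-reverse zero    f = refl
  ∑-reverse (suc n) f = begin
    ∑ (suc n) f + f (suc n)                        ≡⟨ ℤₚ.+-comm _ (f (suc n)) ⟩
    f (suc n) + ∑ (suc n) f                        ≡⟨ +-congˡ (f (suc n)) (∑-reverse n f) ⟩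
    f (suc n) + ∑ (suc n) (λ k → f (n ∸ k))        ≡⟨ sym (∑-head (suc n) (λ k → f (suc n ∸ k))) ⟩
    ∑ (suc (suc n)) (λ k → f (suc n ∸ k))          ∎
    where open ≡-Reasoning

  ∑-split : ∀ m n f → ∑ (m ℕ.+ n) f ≡ ∑ m f + ∑ n (λ k → f (m ℕ.+ k))
  ∑-split m zero    f = trans (cong (λ z → ∑ z f) (ℕₚ.+-identityʳ m)) (sym (ℤₚ.+-identityʳ _))
  ∑-split m (suc n) f rewrite ℕₚ.+-suc m n =
    trans (cong (λ z → z + f (m ℕ.+ n)) (∑-split m n f)) (ℤₚ.+-assoc (∑ m f) _ _)

  ∑-*ˢ : ∀ n (c : ℕ → ℤ) (G : ℕ → Series) h m →
         ((λ t → ∑ n (λ k → c k * G k t)) *ˢ h) m ≡ ∑ n (λ k → c k * (G k *ˢ h) m)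
  ∑-*ˢ zero    c G h m = *ˢ-zeroˡ h m
  ∑-*ˢ (suc n) c G h m = trans (*ˢ-distribʳ h (λ t → ∑ n (λ k → c k * G k t)) (λ t → c n * G n t) m)
    (cong₂ _+_ (∑-*ˢ n c G h m) (*ˢ-scaleˡ (c n) (G n) h m))

-- q-Pochhammer products, Gaussian binomials and the q-binomial theorem.

module GaussianBinomials where
  open PowerSeries
  open FiniteSums
  open import Data.Integer using (_+_; _-_; _*_; -_)

  open SeriesSolver using (solve; _:=_; _:+_; _:*_)

  ∏ : ℕ → (ℕ → Series) → Series
  ∏ zero    F = one
  ∏ (suc n) F = ∏ n F *ˢ F n

  ∏-cong : ∀ n {F G} → (∀ k → F k ≈ G k) → ∏ n F ≈ ∏ n G
  ∏-cong zero    p = ≈-refl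
  ∏-cong (suc n) p = *ˢ-cong (∏-cong n p) (p n)

  ∏-split : ∀ m n F → ∏ (m ℕ.+ n) F ≈ ∏ m F *ˢ ∏ n (λ k → F (m ℕ.+ k))
  ∏-split m zero    F rewrite ℕₚ.+-identityʳ m = ≈-sym (*ˢ-identityʳ (∏ m F))
  ∏-split m (suc n) F rewrite ℕₚ.+-suc m n =
    ≈-trans (*ˢ-cong (∏-split m n F) ≈-refl) (*ˢ-assoc (∏ m F) (∏ n _) (F (m ℕ.+ n)))

  ∏-head : ∀ n F → ∏ (suc n) F ≈ F 0 *ˢ ∏ n (λ k → F (suc k))
  ∏-head n F = ≈-trans (∏-split 1 n F) (*ˢ-cong (*ˢ-identityˡ (F 0)) ≈-refl)

  x^-cong : ∀ {a b} → a ≡ b → x^ a ≈ x^ b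
  x^-cong refl = ≈-refl

  1-x^-cong : ∀ {a b} → a ≡ b → 1-x^ a ≈ 1-x^ b
  1-x^-cong refl = ≈-refl

  1-x^-mod : ∀ {e D} → D ℕ.≤ e → 1-x^ e ≈[ D ] one
  1-x^-mod {e} D≤e m m<D = trans (+-congˡ (one m) (cong -_ (shift-< e one m (ℕₚ.<-≤-trans m<D D≤e)))) (ℤₚ.+-identityʳ (one m))

  -- (x^s; x^P)_n
  poch : ℕ → ℕ → ℕ → Series
  poch P s n = ∏ n (λ j → 1-x^ (P ℕ.* j ℕ.+ s))

  poch-mod : ∀ P {s D} n → D ℕ.≤ s → poch P s n ≈[ D ] one
  poch-mod P zero    D≤s m _   = refl
  poch-mod P {s} (suc n) D≤s m m<D =
    trans (*ˢ-cong-mod (poch-mod P n D≤s) (1-x^-mod (ℕₚ.≤-trans D≤s (ℕₚ.m≤n+m s (P ℕ.* n)))) m m<D) (*ˢ-identityˡ one m)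

  poch-0 : ∀ P s n → 0 ℕ.< s → poch P s n 0 ≡ 1ℤ
  poch-0 P s n 0<s = poch-mod P n 0<s 0 ℕₚ.≤-refl

  poch-split : ∀ P s m n → poch P s (m ℕ.+ n) ≈ poch P s m *ˢ poch P (P ℕ.* m ℕ.+ s) n
  poch-split P s m n = ≈-trans (∏-split m n _) (*ˢ-cong ≈-refl (∏-cong n (λ k → 1-x^-cong (lem P s m k))))
    where
    lem : ∀ P s m k → P ℕ.* (m ℕ.+ k) ℕ.+ s ≡ P ℕ.* k ℕ.+ (P ℕ.* m ℕ.+ s)
    lem = ℕSolver.solve-∀

  poch-head : ∀ P s n → poch P s (suc n) ≈ 1-x^ s *ˢ poch P (P ℕ.+ s) n
  poch-head P s n = ≈-trans (∏-head n _)
    (*ˢ-cong (1-x^-cong (cong (ℕ._+ s) (ℕₚ.*-zeroʳ P))) (∏-cong n (λ k → 1-x^-cong (lem P s k))))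
    where
    lem : ∀ P s k → P ℕ.* suc k ℕ.+ s ≡ P ℕ.* k ℕ.+ (P ℕ.+ s)
    lem = ℕSolver.solve-∀

  poch-mod-≤ : ∀ P k {n} → k ℕ.≤ n → poch P P n ≈[ P ℕ.* k ℕ.+ P ] poch P P k
  poch-mod-≤ P k {n} k≤n m m<D with ℕₚ.m≤n⇒∃[o]m+o≡n k≤n
  ... | o , refl = trans (poch-split P P k o m)
    (trans (*ˢ-cong-mod {f = poch P P k} (λ _ _ → refl) (poch-mod P o ℕₚ.≤-refl) m m<D) (*ˢ-identityʳ (poch P P k) m))

  -- The Gaussian binomial coefficient in base `x^P`, by the q-Pascal rule. The truncation in
  -- `n ∸ k` does no harm: for `k > n` the factor `gauss P n k` beside it is zero.
  gauss : ℕ → ℕ → ℕ → Series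
  gauss P n       zero    = one
  gauss P zero    (suc k) = zeroˢ
  gauss P (suc n) (suc k) = gauss P n (suc k) +ˢ x^ (P ℕ.* (n ∸ k)) *ˢ gauss P n k

  gauss-< : ∀ P n k → n ℕ.< k → gauss P n k ≈ zeroˢ
  gauss-< P zero    (suc k) _ m = refl
  gauss-< P (suc n) (suc k) (ℕ.s≤s l) m = cong₂ _+_ (gauss-< P n (suc k) (ℕₚ.m≤n⇒m≤1+n l) m)
    (trans (*ˢ-cong {f = x^ (P ℕ.* (n ∸ k))} (λ _ → refl) (gauss-< P n k l) m)
           (trans (*ˢ-comm (x^ (P ℕ.* (n ∸ k))) zeroˢ m) (*ˢ-zeroˡ (x^ (P ℕ.* (n ∸ k))) m)))

  gauss-n-n : ∀ P n → gauss P n n ≈ one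
  gauss-n-n P zero    m = refl
  gauss-n-n P (suc n) m rewrite ℕₚ.n∸n≡0 n | ℕₚ.*-zeroʳ P =
    trans (cong₂ _+_ (gauss-< P n (suc n) ℕₚ.≤-refl m) (trans (*ˢ-identityˡ (gauss P n n) m) (gauss-n-n P n m)))
          (ℤₚ.+-identityˡ (one m))

  [1-a]c+ac[1-b] : ∀ s t c → 1-x^ s *ˢ c +ˢ x^ s *ˢ (c *ˢ 1-x^ t) ≈ c *ˢ 1-x^ (t ℕ.+ s)
  [1-a]c+ac[1-b] s t c m = begin
    (1-x^ s *ˢ c) m + (x^ s *ˢ (c *ˢ 1-x^ t)) m
      ≡⟨ cong₂ _+_ (1-x^-*ˢ s c m) (trans (x^-*ˢ s _ m) (shift-cong s (*ˢ-comm c _) m)) ⟩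
    c m - shift s c m + shift s (1-x^ t *ˢ c) m
      ≡⟨ +-congˡ (c m - shift s c m) (trans (shift-cong s (1-x^-*ˢ t c) m) (shift-- s m)) ⟩
    c m - shift s c m + (shift s c m - shift s (shift t c) m)
      ≡⟨ lem (c m) (shift s c m) _ ⟩
    c m - shift s (shift t c) m
      ≡⟨ cong (λ z → c m - z) (trans (sym (shift-+ s t c m)) (cong (λ e → shift e c m) (ℕₚ.+-comm s t))) ⟩
    c m - shift (t ℕ.+ s) c m
      ≡⟨ sym (1-x^-*ˢ (t ℕ.+ s) c m) ⟩
    (1-x^ (t ℕ.+ s) *ˢ c) m
      ≡⟨ *ˢ-comm (1-x^ (t ℕ.+ s)) c m ⟩
    (c *ˢ 1-x^ (t ℕ.+ s)) m ∎
    where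
    open ≡-Reasoning
    lem : ∀ a b d → a - b + (b - d) ≡ a - d
    lem = solve-∀
    shift-- : ∀ e {f g} m → shift e (λ n → f n - g n) m ≡ shift e f m - shift e g m
    shift-- zero    m       = refl
    shift-- (suc e) zero    = refl
    shift-- (suc e) (suc m) = shift-- e m

  -- The quotient formula for Gaussian binomials with the denominator cleared. In the Pascal step
  -- the two inductive values combine by `(1 - a)c + ac(1 - b) = c(1 - ab)`.
  gauss-*-poch : ∀ P k d → gauss P (k ℕ.+ d) k *ˢ poch P P k ≈ poch P (P ℕ.* d ℕ.+ P) k
  gauss-*-poch P zero    d = *ˢ-identityˡ one
  gauss-*-poch P (suc k) zero rewrite ℕₚ.+-identityʳ k | ℕₚ.*-zeroʳ P =
    ≈-trans (*ˢ-cong (gauss-n-n P (suc k)) ≈-refl) (*ˢ-identityˡ (poch P P (suc k)))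
  gauss-*-poch P (suc k) (suc d) = begin
    (gauss P (k ℕ.+ suc d) (suc k) +ˢ x^ (P ℕ.* ((k ℕ.+ suc d) ∸ k)) *ˢ g) *ˢ (A₀ *ˢ b)
      ≈⟨ *ˢ-cong (+ˢ-cong g′≈ (*ˢ-cong (x^-cong (cong (P ℕ.*_) (ℕₚ.m+n∸m≡n k (suc d)))) ≈-refl)) ≈-refl ⟩
    (g′ *ˢ b′ +ˢ x^ s *ˢ g) *ˢ (A₀ *ˢ b)
      ≈⟨ solver g′ b′ (x^ s) g A₀ b ⟩
    g′ *ˢ (A₀ *ˢ b) *ˢ b′ +ˢ x^ s *ˢ ((g *ˢ A₀) *ˢ b)
      ≈⟨ +ˢ-cong (≈-trans (*ˢ-identityʳ _) (gauss-*-poch P (suc k) d)) (*ˢ-cong (≈-refl {x^ s}) (*ˢ-cong (gauss-*-poch P k (suc d)) (≈-refl {b}))) ⟩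
    poch P (P ℕ.* d ℕ.+ P) (suc k) +ˢ x^ s *ˢ (A *ˢ b)
      ≈⟨ +ˢ-cong (≈-trans (poch-head P _ k) (*ˢ-cong (1-x^-cong (lem₁ P d)) (∏-cong k (λ j → 1-x^-cong (lem₂ P d j))))) ≈-refl ⟩
    1-x^ s *ˢ A +ˢ x^ s *ˢ (A *ˢ b)
      ≈⟨ [1-a]c+ac[1-b] s (P ℕ.* k ℕ.+ P) A ⟩
    A *ˢ 1-x^ (P ℕ.* k ℕ.+ P ℕ.+ s)
      ≈⟨ *ˢ-cong ≈-refl (1-x^-cong (lem₃ P k d)) ⟩
    A *ˢ 1-x^ (P ℕ.* k ℕ.+ (P ℕ.* suc d ℕ.+ P)) ∎
    where
    open SetoidReasoning seriesSetoid
    s = P ℕ.* suc d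
    g = gauss P (k ℕ.+ suc d) k
    g′ = gauss P (suc k ℕ.+ d) (suc k)
    b′ = one
    A₀ = poch P P k
    A = poch P (P ℕ.* suc d ℕ.+ P) k
    b = 1-x^ (P ℕ.* k ℕ.+ P)
    g′≈ : gauss P (k ℕ.+ suc d) (suc k) ≈ g′ *ˢ b′
    g′≈ rewrite ℕₚ.+-suc k d = ≈-sym (*ˢ-identityʳ _)
    solver : ∀ g′ b′ s g A b → (g′ *ˢ b′ +ˢ s *ˢ g) *ˢ (A *ˢ b) ≈ g′ *ˢ (A *ˢ b) *ˢ b′ +ˢ s *ˢ ((g *ˢ A) *ˢ b)
    solver = solve 6 (λ g′ b′ s g A b → (g′ :* b′ :+ s :* g) :* (A :* b) := g′ :* (A :* b) :* b′ :+ s :* ((g :* A) :* b)) (λ _ → refl)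
    lem₁ : ∀ P d → P ℕ.* d ℕ.+ P ≡ P ℕ.* suc d
    lem₁ = ℕSolver.solve-∀
    lem₂ : ∀ P d j → P ℕ.* j ℕ.+ (P ℕ.+ (P ℕ.* d ℕ.+ P)) ≡ P ℕ.* j ℕ.+ (P ℕ.* suc d ℕ.+ P)
    lem₂ = ℕSolver.solve-∀
    lem₃ : ∀ P k d → P ℕ.* k ℕ.+ P ℕ.+ P ℕ.* suc d ≡ P ℕ.* k ℕ.+ (P ℕ.* suc d ℕ.+ P)
    lem₃ = ℕSolver.solve-∀

  -- Multiplied by `(Q;Q)_k (Q;Q)_d` with `Q = x^P`, both sides become `(Q;Q)_(k+d)`; the multiplier
  -- has constant term 1 and cancels.
  gauss-sym : ∀ P k d → 0 ℕ.< P → gauss P (k ℕ.+ d) k ≈ gauss P (k ℕ.+ d) d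
  gauss-sym P k d 0<P m = *ˢ-cancelˡ-mod {suc m} (poch P P k *ˢ poch P P d) _ _ u₀ (λ m′ _ → eq m′) m ℕₚ.≤-refl
    where
    open SetoidReasoning seriesSetoid
    u₀ : (poch P P k *ˢ poch P P d) 0 ≡ 1ℤ
    u₀ = cong₂ _*_ (poch-0 P P k 0<P) (poch-0 P P d 0<P)
    solver : ∀ a b g → (a *ˢ b) *ˢ g ≈ b *ˢ (g *ˢ a)
    solver = solve 3 (λ a b g → (a :* b) :* g := b :* (g :* a)) (λ _ → refl)
    solver′ : ∀ a b g → (a *ˢ b) *ˢ g ≈ a *ˢ (g *ˢ b)
    solver′ = solve 3 (λ a b g → (a :* b) :* g := a :* (g :* b)) (λ _ → refl)
    full : ∀ k d → poch P P d *ˢ (gauss P (k ℕ.+ d) k *ˢ poch P P k) ≈ poch P P (k ℕ.+ d)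
    full k d = begin
      poch P P d *ˢ (gauss P (k ℕ.+ d) k *ˢ poch P P k) ≈⟨ *ˢ-cong (≈-refl {poch P P d}) (gauss-*-poch P k d) ⟩
      poch P P d *ˢ poch P (P ℕ.* d ℕ.+ P) k            ≈⟨ ≈-sym (poch-split P P d k) ⟩
      poch P P (d ℕ.+ k)                                ≡⟨ cong (poch P P) (ℕₚ.+-comm d k) ⟩
      poch P P (k ℕ.+ d)                                ∎
    eq : (poch P P k *ˢ poch P P d) *ˢ gauss P (k ℕ.+ d) k ≈ (poch P P k *ˢ poch P P d) *ˢ gauss P (k ℕ.+ d) d
    eq = begin
      (poch P P k *ˢ poch P P d) *ˢ gauss P (k ℕ.+ d) k ≈⟨ solver (poch P P k) (poch P P d) _ ⟩
      poch P P d *ˢ (gauss P (k ℕ.+ d) k *ˢ poch P P k) ≈⟨ full k d ⟩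
      poch P P (k ℕ.+ d)                                ≡⟨ cong (poch P P) (ℕₚ.+-comm k d) ⟩
      poch P P (d ℕ.+ k)                                ≈⟨ ≈-sym (full d k) ⟩
      poch P P k *ˢ (gauss P (d ℕ.+ k) d *ˢ poch P P d) ≡⟨ cong (λ n → poch P P k *ˢ (gauss P n d *ˢ poch P P d)) (ℕₚ.+-comm d k) ⟩
      poch P P k *ˢ (gauss P (k ℕ.+ d) d *ˢ poch P P d) ≈⟨ ≈-sym (solver′ (poch P P k) (poch P P d) _) ⟩
      (poch P P k *ˢ poch P P d) *ˢ gauss P (k ℕ.+ d) d ∎

  -- The limit of the Gaussian binomial with an explicit error. With `Q = x^P`, the product
  -- `(Q;Q)_J` agrees with `(Q;Q)_k` below degree `P(k+1)`, and the remaining `(Q^(d+1);Q)_k` is 1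
  -- below degree `P(d+1)`.
  poch-*-gauss-mod : ∀ P J k d {D} → k ℕ.≤ J → D ℕ.≤ P ℕ.* k ℕ.+ P → D ℕ.≤ P ℕ.* d ℕ.+ P →
                     poch P P J *ˢ gauss P (k ℕ.+ d) k ≈[ D ] one
  poch-*-gauss-mod P J k d k≤J D≤k D≤d m m<D = begin
    (poch P P J *ˢ g) m             ≡⟨ *ˢ-cong-mod (poch-mod-≤ P k k≤J) (λ _ _ → refl) m (ℕₚ.<-≤-trans m<D D≤k) ⟩
    (poch P P k *ˢ g) m             ≡⟨ *ˢ-comm (poch P P k) g m ⟩
    (g *ˢ poch P P k) m             ≡⟨ gauss-*-poch P k d m ⟩
    poch P (P ℕ.* d ℕ.+ P) k m      ≡⟨ poch-mod P k D≤d m m<D ⟩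
    one m                           ∎
    where
    open ≡-Reasoning
    g = gauss P (k ℕ.+ d) k

  -- Induction on `a`, started from an arbitrary series `F` that is already a Gaussian binomial sum
  -- of length `c`: the triple product multiplies an expanded product by a second one. The
  -- recurrence for `E` says exactly that `x^(Pa+b)` times term `k` is the extra term of Pascal's
  -- rule at `k + 1`; it is stated additively because exponents are natural numbers.
  q-binomial : ∀ P c b (s : ℕ → ℤ) (E : ℕ → ℕ) (F : Series) →
    (∀ k → s (suc k) ≡ - s k) → (∀ k → E (suc k) ℕ.+ P ℕ.* c ≡ E k ℕ.+ P ℕ.* k ℕ.+ b) →
    F ≈ (λ m → ∑ (suc c) (λ k → s k * (gauss P c k *ˢ x^ E k) m)) →
    ∀ a → F *ˢ poch P b a ≈ (λ m → ∑ (suc (c ℕ.+ a)) (λ k → s k * (gauss P (c ℕ.+ a) k *ˢ x^ E k) m))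
  q-binomial P c b s E F s-suc E-suc base zero m rewrite ℕₚ.+-identityʳ c = trans (*ˢ-identityʳ F m) (base m)
  q-binomial P c b s E F s-suc E-suc base (suc a) m rewrite ℕₚ.+-suc c a = begin
    (F *ˢ (poch P b a *ˢ 1-x^ t)) m
      ≡⟨ sym (*ˢ-assoc F (poch P b a) (1-x^ t) m) ⟩
    ((F *ˢ poch P b a) *ˢ 1-x^ t) m
      ≡⟨ *ˢ-cong (q-binomial P c b s E F s-suc E-suc base a) (≈-refl {1-x^ t}) m ⟩
    ((λ m → ∑ (suc n) (λ k → s k * T n k m)) *ˢ 1-x^ t) m
      ≡⟨ ∑-*ˢ (suc n) s (T n) (1-x^ t) m ⟩
    ∑ (suc n) (λ k → s k * (T n k *ˢ 1-x^ t) m)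
      ≡⟨ ∑-cong-< (suc n) (λ k _ → trans (cong (s k *_) (trans (*ˢ-comm (T n k) (1-x^ t) m) (1-x^-*ˢ t (T n k) m)))
                                          (lem₁ (s k) (T n k m) (shift t (T n k) m))) ⟩
    ∑ (suc n) (λ k → s k * T n k m + - (s k * shift t (T n k) m))
      ≡⟨ ∑-distrib-+ (suc n) _ _ ⟩
    ∑ (suc n) (λ k → s k * T n k m) + ∑ (suc n) (λ k → - (s k * shift t (T n k) m))
      ≡⟨ cong₂ _+_ first (∑-cong-< (suc n) second) ⟩
    s 0 * T n 0 m + ∑ (suc n) (λ k → s (suc k) * T n (suc k) m)
      + ∑ (suc n) (λ k → s (suc k) * (x^ (P ℕ.* (n ∸ k)) *ˢ gauss P n k *ˢ x^ E (suc k)) m)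
      ≡⟨ ℤₚ.+-assoc (s 0 * T n 0 m) _ _ ⟩
    s 0 * T n 0 m + (∑ (suc n) (λ k → s (suc k) * T n (suc k) m)
      + ∑ (suc n) (λ k → s (suc k) * (x^ (P ℕ.* (n ∸ k)) *ˢ gauss P n k *ˢ x^ E (suc k)) m))
      ≡⟨ +-congˡ (s 0 * T n 0 m) (sym (∑-distrib-+ (suc n) _ _)) ⟩
    s 0 * T n 0 m + ∑ (suc n) (λ k → s (suc k) * T n (suc k) m
      + s (suc k) * (x^ (P ℕ.* (n ∸ k)) *ˢ gauss P n k *ˢ x^ E (suc k)) m)
      ≡⟨ +-congˡ (s 0 * T n 0 m) (∑-cong-< (suc n) (λ k _ → trans (sym (ℤₚ.*-distribˡ-+ (s (suc k)) _ _))
           (cong (s (suc k) *_) (sym (*ˢ-distribʳ (x^ E (suc k)) (gauss P n (suc k)) _ m))))) ⟩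
    s 0 * T (suc n) 0 m + ∑ (suc n) (λ k → s (suc k) * T (suc n) (suc k) m)
      ≡⟨ sym (∑-head (suc n) (λ k → s k * T (suc n) k m)) ⟩
    ∑ (suc (suc n)) (λ k → s k * T (suc n) k m) ∎
    where
    open ≡-Reasoning
    n = c ℕ.+ a
    t = P ℕ.* a ℕ.+ b
    T : ℕ → ℕ → Series
    T n k = gauss P n k *ˢ x^ E k
    lem₁ : ∀ a b c → a * (b - c) ≡ a * b + - (a * c)
    lem₁ = solve-∀
    top : T n (suc n) m ≡ 0ℤ
    top = trans (*ˢ-cong (gauss-< P n (suc n) ℕₚ.≤-refl) (≈-refl {x^ E (suc n)}) m) (*ˢ-zeroˡ (x^ E (suc n)) m)
    first : ∑ (suc n) (λ k → s k * T n k m) ≡ s 0 * T n 0 m + ∑ (suc n) (λ k → s (suc k) * T n (suc k) m)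
    first = trans (sym (trans (+-congˡ (∑ (suc n) (λ k → s k * T n k m)) (trans (cong (s (suc n) *_) top) (ℤₚ.*-zeroʳ (s (suc n)))))
                              (ℤₚ.+-identityʳ _)))
                  (∑-head (suc n) (λ k → s k * T n k m))
    exps : ∀ k → k ℕ.≤ n → t ℕ.+ E k ≡ P ℕ.* (n ∸ k) ℕ.+ E (suc k)
    exps k k≤n = ℕₚ.+-cancelʳ-≡ (P ℕ.* c) _ _ (begin
      P ℕ.* a ℕ.+ b ℕ.+ E k ℕ.+ P ℕ.* c              ≡⟨ l₁ P a b (E k) c ⟩
      P ℕ.* (c ℕ.+ a) ℕ.+ (E k ℕ.+ b)                ≡⟨ cong (λ z → P ℕ.* z ℕ.+ (E k ℕ.+ b)) (sym (ℕₚ.m∸n+n≡m k≤n)) ⟩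
      P ℕ.* (n ∸ k ℕ.+ k) ℕ.+ (E k ℕ.+ b)            ≡⟨ l₂ P (n ∸ k) k (E k) b ⟩
      P ℕ.* (n ∸ k) ℕ.+ (E k ℕ.+ P ℕ.* k ℕ.+ b)      ≡⟨ cong (P ℕ.* (n ∸ k) ℕ.+_) (sym (E-suc k)) ⟩
      P ℕ.* (n ∸ k) ℕ.+ (E (suc k) ℕ.+ P ℕ.* c)      ≡⟨ sym (ℕₚ.+-assoc (P ℕ.* (n ∸ k)) _ _) ⟩
      P ℕ.* (n ∸ k) ℕ.+ E (suc k) ℕ.+ P ℕ.* c        ∎)
      where
      l₁ : ∀ P a b e c → P ℕ.* a ℕ.+ b ℕ.+ e ℕ.+ P ℕ.* c ≡ P ℕ.* (c ℕ.+ a) ℕ.+ (e ℕ.+ b)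
      l₁ = ℕSolver.solve-∀
      l₂ : ∀ P d k e b → P ℕ.* (d ℕ.+ k) ℕ.+ (e ℕ.+ b) ≡ P ℕ.* d ℕ.+ (e ℕ.+ P ℕ.* k ℕ.+ b)
      l₂ = ℕSolver.solve-∀
    solver : ∀ a g b → a *ˢ (g *ˢ b) ≈ (a *ˢ b) *ˢ g
    solver = solve 3 (λ a g b → a :* (g :* b) := (a :* b) :* g) (λ _ → refl)
    solver′ : ∀ a b g → (a *ˢ b) *ˢ g ≈ a *ˢ g *ˢ b
    solver′ = solve 3 (λ a b g → (a :* b) :* g := a :* g :* b) (λ _ → refl)
    moved : ∀ k → k ℕ.≤ n → shift t (T n k) ≈ x^ (P ℕ.* (n ∸ k)) *ˢ gauss P n k *ˢ x^ E (suc k)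
    moved k k≤n = ≈-trans (≈-sym (x^-*ˢ t (T n k))) (≈-trans (solver (x^ t) (gauss P n k) (x^ E k))
      (≈-trans (*ˢ-cong (≈-trans (≈-sym (x^-+ t (E k))) (≈-trans (x^-cong (exps k k≤n)) (x^-+ (P ℕ.* (n ∸ k)) (E (suc k))))) (≈-refl {gauss P n k}))
        (solver′ (x^ (P ℕ.* (n ∸ k))) (x^ E (suc k)) (gauss P n k))))
    second : ∀ k → k ℕ.< suc n → - (s k * shift t (T n k) m) ≡ s (suc k) * (x^ (P ℕ.* (n ∸ k)) *ˢ gauss P n k *ˢ x^ E (suc k)) m
    second k (ℕ.s≤s k≤n) = trans (ℤₚ.neg-distribˡ-* (s k) _) (cong₂ _*_ (sym (s-suc k)) (moved k k≤n m))

-- Finitely supported sums over the integers.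

module BilateralSums where
  open PowerSeries
  open FiniteSums
  open import Data.Integer using (_+_; _-_; _*_; -_)

  -- The sum over the window [-K, K).
  bil : ℕ → (ℤ → ℤ) → ℤ
  bil zero    g = 0ℤ
  bil (suc K) g = bil K g + (g -[1+ K ] + g (+ K))

  Supported : ℕ → (ℤ → ℤ) → Set
  Supported K g = ∀ k → K ℕ.≤ ∣ k ∣ → g k ≡ 0ℤ

  -- The window is part of the datum and any larger window gives the same value. Translation,
  -- splitting into residue classes and interchange of summation thus become exact finite
  -- identities.
  HasSum : (ℤ → ℤ) → ℤ → Set
  HasSum g v = Σ ℕ λ K → Supported K g × bil K g ≡ v

  bil-cong : ∀ K {g h} → (∀ k → g k ≡ h k) → bil K g ≡ bil K h
  bil-cong zero    p = refl
  bil-cong (suc K) p = cong₂ _+_ (bil-cong K p) (cong₂ _+_ (p _) (p _))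

  bil-+ : ∀ K g h → bil K (λ k → g k + h k) ≡ bil K g + bil K h
  bil-+ zero    g h = refl
  bil-+ (suc K) g h = trans (cong (λ z → z + (g -[1+ K ] + h -[1+ K ] + (g (+ K) + h (+ K)))) (bil-+ K g h)) (lem (bil K g) (bil K h) (g -[1+ K ]) (h -[1+ K ]) (g (+ K)) (h (+ K)))
    where
    lem : ∀ a b c d e f → a + b + (c + d + (e + f)) ≡ a + (c + e) + (b + (d + f))
    lem = solve-∀

  bil-scale : ∀ K c g → bil K (λ k → c * g k) ≡ c * bil K g
  bil-scale zero    c g = sym (ℤₚ.*-zeroʳ c)
  bil-scale (suc K) c g = trans (cong (λ z → z + (c * g -[1+ K ] + c * g (+ K))) (bil-scale K c g)) (lem c (bil K g) (g -[1+ K ]) (g (+ K)))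
    where
    lem : ∀ c a b d → c * a + (c * b + c * d) ≡ c * (a + (b + d))
    lem = solve-∀

  bil-zero : ∀ K {g} → (∀ k → g k ≡ 0ℤ) → bil K g ≡ 0ℤ
  bil-zero zero    p = refl
  bil-zero (suc K) p = cong₂ _+_ (bil-zero K p) (cong₂ _+_ (p _) (p _))

  bil-swap : ∀ K L (f : ℤ → ℤ → ℤ) → bil K (λ k → bil L (f k)) ≡ bil L (λ l → bil K (λ k → f k l))
  bil-swap zero    L f = sym (bil-zero L (λ _ → refl))
  bil-swap (suc K) L f = sym (trans (bil-+ L _ _) (cong₂ _+_ (sym (bil-swap K L f)) (bil-+ L _ _)))

  bil-*ˢ : ∀ K (c : ℤ → ℤ) (G : ℤ → Series) h m →
           ((λ t → bil K (λ k → c k * G k t)) *ˢ h) m ≡ bil K (λ k → c k * (G k *ˢ h) m)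
  bil-*ˢ zero    c G h m = *ˢ-zeroˡ h m
  bil-*ˢ (suc K) c G h m = trans (*ˢ-distribʳ h (λ t → bil K (λ k → c k * G k t)) (λ t → c -[1+ K ] * G -[1+ K ] t + c (+ K) * G (+ K) t) m)
    (cong₂ _+_ (bil-*ˢ K c G h m)
      (trans (*ˢ-distribʳ h (λ t → c -[1+ K ] * G -[1+ K ] t) _ m)
        (cong₂ _+_ (*ˢ-scaleˡ (c -[1+ K ]) (G -[1+ K ]) h m) (*ˢ-scaleˡ (c (+ K)) (G (+ K)) h m))))

  bil-stable : ∀ {K g} L → Supported K g → K ℕ.≤ L → bil L g ≡ bil K g
  bil-stable {K} {g} L s K≤L with ℕₚ.m≤n⇒∃[o]m+o≡n K≤L
  ... | o , refl = go o
    where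
    go : ∀ o → bil (K ℕ.+ o) g ≡ bil K g
    go zero    = cong (λ z → bil z g) (ℕₚ.+-identityʳ K)
    go (suc o) rewrite ℕₚ.+-suc K o =
      trans (cong₂ _+_ (go o) (cong₂ _+_ (s _ (ℕₚ.m≤n⇒m≤1+n (ℕₚ.m≤m+n K o))) (s _ (ℕₚ.m≤m+n K o)))) (ℤₚ.+-identityʳ _)

  supported-mono : ∀ {K L g} → K ℕ.≤ L → Supported K g → Supported L g
  supported-mono K≤L s k L≤k = s k (ℕₚ.≤-trans K≤L L≤k)

  supported⇒hasSum : ∀ {K g} → Supported K g → HasSum g (bil K g)
  supported⇒hasSum s = _ , s , refl

  hasSum-unique : ∀ {g v w} → HasSum g v → HasSum g w → v ≡ w
  hasSum-unique (K , s , refl) (L , t , refl) =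
    trans (sym (bil-stable (K ℕ.+ L) s (ℕₚ.m≤m+n K L))) (bil-stable (K ℕ.+ L) t (ℕₚ.m≤n+m L K))

  hasSum-cong : ∀ {g h v} → (∀ k → g k ≡ h k) → HasSum g v → HasSum h v
  hasSum-cong p (K , s , refl) = K , (λ k l → trans (sym (p k)) (s k l)) , sym (bil-cong K p)

  hasSum-+ : ∀ {g h v w} → HasSum g v → HasSum h w → HasSum (λ k → g k + h k) (v + w)
  hasSum-+ {g} {h} (K , s , refl) (L , t , refl) = K ℕ.+ L
    , (λ k l → cong₂ _+_ (s k (ℕₚ.≤-trans (ℕₚ.m≤m+n K L) l)) (t k (ℕₚ.≤-trans (ℕₚ.m≤n+m L K) l)))
    , trans (bil-+ (K ℕ.+ L) g h)
            (cong₂ _+_ (bil-stable (K ℕ.+ L) s (ℕₚ.m≤m+n K L)) (bil-stable (K ℕ.+ L) t (ℕₚ.m≤n+m L K)))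

  hasSum-scale : ∀ c {g v} → HasSum g v → HasSum (λ k → c * g k) (c * v)
  hasSum-scale c {g} (K , s , refl) = K , (λ k l → trans (cong (c *_) (s k l)) (ℤₚ.*-zeroʳ c)) , bil-scale K c g

  hasSum-zero : ∀ {g} → (∀ k → g k ≡ 0ℤ) → HasSum g 0ℤ
  hasSum-zero p = 0 , (λ k _ → p k) , refl

  private
    -- Shifting the window by one trades its left end `-K` for the new right end `K`; both values
    -- vanish for supported `g`.
    bil-suc : ∀ K g → bil K (λ k → g (ℤ.suc k)) + g (- (+ K)) ≡ bil K g + g (+ K)
    bil-suc zero    g = refl
    bil-suc (suc K) g = begin
      bil K (λ k → g (ℤ.suc k)) + (g (ℤ.suc -[1+ K ]) + g (+ suc K)) + g -[1+ K ]
        ≡⟨ cong (λ z → bil K (λ k → g (ℤ.suc k)) + (g z + g (+ suc K)) + g -[1+ K ]) (ℤₚ.1-[1+n]≡-n K) ⟩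
      bil K (λ k → g (ℤ.suc k)) + (g (- (+ K)) + g (+ suc K)) + g -[1+ K ]
        ≡⟨ lem₁ (bil K (λ k → g (ℤ.suc k))) (g (- (+ K))) (g (+ suc K)) (g -[1+ K ]) ⟩
      bil K (λ k → g (ℤ.suc k)) + g (- (+ K)) + (g -[1+ K ] + g (+ suc K))
        ≡⟨ cong (λ z → z + (g -[1+ K ] + g (+ suc K))) (bil-suc K g) ⟩
      bil K g + g (+ K) + (g -[1+ K ] + g (+ suc K))
        ≡⟨ lem₂ (bil K g) (g (+ K)) (g -[1+ K ]) (g (+ suc K)) ⟩
      bil K g + (g -[1+ K ] + g (+ K)) + g (+ suc K) ∎
      where
      open ≡-Reasoning
      lem₁ : ∀ a b c d → a + (b + c) + d ≡ a + b + (d + c)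
      lem₁ = solve-∀
      lem₂ : ∀ a b c d → a + b + (c + d) ≡ a + (c + b) + d
      lem₂ = solve-∀

    bil-suc-supported : ∀ {K g} → Supported K g → bil K (λ k → g (ℤ.suc k)) ≡ bil K g
    bil-suc-supported {K} {g} s = ℤ+.∙-cancelʳ (g (- (+ K))) _ _
      (trans (bil-suc K g) (+-congˡ (bil K g) (trans (s (+ K) ℕₚ.≤-refl) (sym (s (- (+ K)) (ℕₚ.≤-reflexive (sym (ℤₚ.∣-i∣≡∣i∣ (+ K)))))))))

    suc-≤ : ∀ k → ∣ k ∣ ℕ.≤ suc ∣ ℤ.suc k ∣
    suc-≤ k = ℕₚ.≤-trans (ℕₚ.≤-reflexive (cong ∣_∣ (lem k))) (ℤₚ.∣i+j∣≤∣i∣+∣j∣ ℤ.-1ℤ (ℤ.suc k))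
      where
      lem : ∀ k → k ≡ ℤ.-1ℤ + (1ℤ + k)
      lem = solve-∀

    pred-≤ : ∀ k → ∣ k ∣ ℕ.≤ suc ∣ ℤ.pred k ∣
    pred-≤ k = ℕₚ.≤-trans (ℕₚ.≤-reflexive (cong ∣_∣ (lem k))) (ℤₚ.∣i+j∣≤∣i∣+∣j∣ 1ℤ (ℤ.pred k))
      where
      lem : ∀ k → k ≡ 1ℤ + (ℤ.-1ℤ + k)
      lem = solve-∀

    hasSum-suc : ∀ {g v} → HasSum g v → HasSum (λ k → g (ℤ.suc k)) v
    hasSum-suc (K , s , refl) = suc K , (λ k l → s _ (ℕₚ.≤-pred (ℕₚ.≤-trans l (suc-≤ k))))
      , trans (bil-suc-supported (supported-mono (ℕₚ.n≤1+n K) s)) (bil-stable (suc K) s (ℕₚ.n≤1+n K))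

    hasSum-pred : ∀ {g v} → HasSum g v → HasSum (λ k → g (ℤ.pred k)) v
    hasSum-pred {g} (K , s , refl) = suc K , s′
      , trans (sym (bil-suc-supported s′)) (trans (bil-cong (suc K) (λ k → cong g (ℤₚ.pred-suc k))) (bil-stable (suc K) s (ℕₚ.n≤1+n K)))
      where
      s′ : Supported (suc K) (λ k → g (ℤ.pred k))
      s′ k l = s _ (ℕₚ.≤-pred (ℕₚ.≤-trans l (pred-≤ k)))

  hasSum-translate : ∀ c {g v} → HasSum g v → HasSum (λ k → g (k + c)) v
  hasSum-translate (+ zero) {g} h = hasSum-cong (λ k → cong g (sym (ℤₚ.+-identityʳ k))) h
  hasSum-translate (+ suc n) {g} h =
    hasSum-cong (λ k → cong g (lem k (+ n))) (hasSum-translate (+ n) (hasSum-suc h))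
    where
    lem : ∀ k n → 1ℤ + (k + n) ≡ k + (1ℤ + n)
    lem = solve-∀
  hasSum-translate -[1+ zero ] {g} h = hasSum-cong (λ k → cong g (ℤₚ.+-comm ℤ.-1ℤ k)) (hasSum-pred h)
  hasSum-translate -[1+ suc n ] {g} h =
    hasSum-cong (λ k → cong g (lem k -[1+ n ])) (hasSum-translate -[1+ n ] (hasSum-pred h))
    where
    lem : ∀ k n → ℤ.-1ℤ + (k + n) ≡ k + (ℤ.-1ℤ + n)
    lem = solve-∀

  bil-block : ∀ L m g → bil (L ℕ.+ m) g ≡ bil L g + (∑ m (λ r → g (r ⊖ (L ℕ.+ m))) + ∑ m (λ r → g (+ (L ℕ.+ r))))
  bil-block L zero    g = trans (cong (λ z → bil z g) (ℕₚ.+-identityʳ L)) (sym (ℤₚ.+-identityʳ _))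
  bil-block L (suc m) g rewrite ℕₚ.+-suc L m = begin
    bil (L ℕ.+ m) g + (g -[1+ L ℕ.+ m ] + g (+ (L ℕ.+ m)))
      ≡⟨ cong (λ z → z + (g -[1+ L ℕ.+ m ] + g (+ (L ℕ.+ m)))) (bil-block L m g) ⟩
    bil L g + (∑ m (λ r → g (r ⊖ (L ℕ.+ m))) + ∑ m (λ r → g (+ (L ℕ.+ r)))) + (g -[1+ L ℕ.+ m ] + g (+ (L ℕ.+ m)))
      ≡⟨ lem (bil L g) _ _ (g -[1+ L ℕ.+ m ]) (g (+ (L ℕ.+ m))) ⟩
    bil L g + ((g -[1+ L ℕ.+ m ] + ∑ m (λ r → g (r ⊖ (L ℕ.+ m)))) + (∑ m (λ r → g (+ (L ℕ.+ r))) + g (+ (L ℕ.+ m))))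
      ≡⟨ cong (λ z → bil L g + (z + (∑ m (λ r → g (+ (L ℕ.+ r))) + g (+ (L ℕ.+ m)))))
              (trans (+-congˡ (g -[1+ L ℕ.+ m ]) (∑-cong-< m (λ r _ → cong g (sym (ℤₚ.[1+m]⊖[1+n]≡m⊖n r (L ℕ.+ m))))))
                     (sym (∑-head m (λ r → g (r ⊖ suc (L ℕ.+ m)))))) ⟩
    bil L g + (∑ (suc m) (λ r → g (r ⊖ suc (L ℕ.+ m))) + (∑ m (λ r → g (+ (L ℕ.+ r))) + g (+ (L ℕ.+ m)))) ∎
    where
    open ≡-Reasoning
    lem : ∀ a b c d e → a + (b + c) + (d + e) ≡ a + ((d + b) + (c + e))
    lem = solve-∀

  -- The half-open window `[-pK, pK)` is the disjoint union of the images of `[-K, K)` under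
  -- `j ↦ r + pj` for `0 ≤ r < p`. This exact match is the reason for windows that are open on the
  -- right.
  bil-residues : ∀ p K g → bil (p ℕ.* K) g ≡ ∑ p (λ r → bil K (λ j → g (+ r + + p * j)))
  bil-residues p zero    g rewrite ℕₚ.*-zeroʳ p = sym (∑-zero p (λ _ _ → refl))
  bil-residues p (suc K) g = begin
    bil (p ℕ.* suc K) g
      ≡⟨ cong (λ z → bil z g) (trans (ℕₚ.*-suc p K) (ℕₚ.+-comm p _)) ⟩
    bil (p ℕ.* K ℕ.+ p) g
      ≡⟨ bil-block (p ℕ.* K) p g ⟩
    bil (p ℕ.* K) g + (∑ p (λ r → g (r ⊖ (p ℕ.* K ℕ.+ p))) + ∑ p (λ r → g (+ (p ℕ.* K ℕ.+ r))))
      ≡⟨ cong₂ _+_ (bil-residues p K g) (cong₂ _+_ (∑-cong-< p (λ r _ → cong g (neg r))) (∑-cong-< p (λ r _ → cong g (pos r)))) ⟩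
    ∑ p (λ r → bil K (λ j → g (+ r + + p * j))) + (∑ p (λ r → g (+ r + + p * -[1+ K ])) + ∑ p (λ r → g (+ r + + p * + K)))
      ≡⟨ +-congˡ (∑ p (λ r → bil K (λ j → g (+ r + + p * j)))) (sym (∑-distrib-+ p _ _)) ⟩
    ∑ p (λ r → bil K (λ j → g (+ r + + p * j))) + ∑ p (λ r → g (+ r + + p * -[1+ K ]) + g (+ r + + p * + K))
      ≡⟨ sym (∑-distrib-+ p _ _) ⟩
    ∑ p (λ r → bil (suc K) (λ j → g (+ r + + p * j))) ∎
    where
    open ≡-Reasoning
    lem₁ : ∀ r p k → r - (p * k + p) ≡ r + p * (- (1ℤ + k))
    lem₁ = solve-∀
    neg : ∀ r → r ⊖ (p ℕ.* K ℕ.+ p) ≡ + r + + p * -[1+ K ]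
    neg r = trans (sym (ℤₚ.m-n≡m⊖n r (p ℕ.* K ℕ.+ p)))
      (trans (cong (λ z → + r - z) (trans (ℤₚ.pos-+ (p ℕ.* K) p) (cong (λ z → z + + p) (ℤₚ.pos-* p K)))) (lem₁ (+ r) (+ p) (+ K)))
    pos : ∀ r → + (p ℕ.* K ℕ.+ r) ≡ + r + + p * + K
    pos r = trans (ℤₚ.pos-+ (p ℕ.* K) r) (trans (ℤₚ.+-comm (+ (p ℕ.* K)) (+ r)) (+-congˡ (+ r) (ℤₚ.pos-* p K)))

  residue-grows : ∀ {p r} → r ℕ.< p → ∀ j → ∣ j ∣ ℕ.≤ ∣ + r + + p * j ∣
  residue-grows {suc p} {r} _ (+ j) = ℕₚ.≤-trans (ℕₚ.m≤n+m j (r ℕ.+ p ℕ.* j))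
    (ℕₚ.≤-reflexive (trans (lem r p j) (cong ∣_∣ (trans (ℤₚ.pos-+ r (suc p ℕ.* j)) (+-congˡ (+ r) (ℤₚ.pos-* (suc p) j))))))
    where
    lem : ∀ r p j → r ℕ.+ p ℕ.* j ℕ.+ j ≡ r ℕ.+ suc p ℕ.* j
    lem = ℕSolver.solve-∀
  residue-grows {p} {r} r<p -[1+ j ] with ℕₚ.m≤n⇒∃[o]m+o≡n r<p
  ... | o , refl = ℕₚ.≤-trans (ℕₚ.m≤m+n (suc j) (r ℕ.* j ℕ.+ o ℕ.* suc j))
    (ℕₚ.≤-reflexive (sym (trans (cong ∣_∣ int) (ℤₚ.∣-i∣≡∣i∣ (+ (suc j ℕ.+ (r ℕ.* j ℕ.+ o ℕ.* suc j)))))))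
    where
    open ≡-Reasoning
    lem : ∀ r o j → r + (1ℤ + r + o) * (- (1ℤ + j)) ≡ - (1ℤ + j + (r * j + o * (1ℤ + j)))
    lem = solve-∀
    int : + r + + (suc r ℕ.+ o) * -[1+ j ] ≡ - (+ (suc j ℕ.+ (r ℕ.* j ℕ.+ o ℕ.* suc j)))
    int = begin
      + r + + (suc r ℕ.+ o) * (- (1ℤ + + j))          ≡⟨ cong (λ z → + r + z * (- (1ℤ + + j))) (ℤₚ.pos-+ (suc r) o) ⟩
      + r + (1ℤ + + r + + o) * (- (1ℤ + + j))         ≡⟨ lem (+ r) (+ o) (+ j) ⟩
      - (1ℤ + + j + (+ r * + j + + o * (1ℤ + + j)))   ≡⟨ cong (λ z → - (1ℤ + + j + z)) (cong₂ _+_ (sym (ℤₚ.pos-* r j)) (sym (ℤₚ.pos-* o (suc j)))) ⟩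
      - (+ suc j + (+ (r ℕ.* j) + + (o ℕ.* suc j)))   ∎

  hasSum-residues : ∀ p → 0 ℕ.< p → ∀ {g v} → HasSum g v →
    Σ (ℕ → ℤ) λ w → (∀ r → r ℕ.< p → HasSum (λ j → g (+ r + + p * j)) (w r)) × v ≡ ∑ p w
  hasSum-residues p@(suc _) _ {g} (K , s , refl) = (λ r → bil K (λ j → g (+ r + + p * j)))
    , (λ r r<p → supported⇒hasSum (λ j l → s _ (ℕₚ.≤-trans l (residue-grows r<p j))))
    , trans (sym (bil-stable (p ℕ.* K) s (ℕₚ.m≤n*m K p))) (bil-residues p K g)

  Supported₂ : (ℤ → ℤ → ℤ) → Set
  Supported₂ f = Σ ℕ λ K → ∀ k l → K ℕ.≤ ∣ k ∣ ⊎ K ℕ.≤ ∣ l ∣ → f k l ≡ 0ℤ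

  -- A single bound serves both indices, so the interchange happens inside one square window;
  -- `hasSum-unique` reconciles this with whatever windows the row sums came with.
  fubini : ∀ {f r v} → Supported₂ f → (∀ k → HasSum (f k) (r k)) → HasSum r v →
           Σ (ℤ → ℤ) λ c → (∀ l → HasSum (λ k → f k l) (c l)) × HasSum c v
  fubini {f} {r} {v} (K , s) rows total = (λ l → bil K (λ k → f k l))
    , (λ l → supported⇒hasSum (λ k K≤k → s k l (inj₁ K≤k)))
    , K , (λ l K≤l → bil-zero K (λ k → s k l (inj₂ K≤l)))
    , trans (sym (bil-swap K K f)) (trans (bil-cong K (λ k → sym (row k))) (hasSum-unique (supported⇒hasSum s′) total))
    where
    row : ∀ k → r k ≡ bil K (f k)
    row k = hasSum-unique (rows k) (supported⇒hasSum (λ l K≤l → s k l (inj₂ K≤l)))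
    s′ : Supported K r
    s′ k K≤k = trans (row k) (bil-zero K (λ l → s k l (inj₁ K≤k)))

  alternating : ℕ → ℤ
  alternating zero    = 1ℤ
  alternating (suc n) = - alternating n

  sgn : ℤ → ℤ
  sgn k = alternating ∣ k ∣

  sgn-suc : ∀ k → sgn (ℤ.suc k) ≡ - sgn k
  sgn-suc (+ n)    = refl
  sgn-suc -[1+ n ] = trans (cong sgn (ℤₚ.1-[1+n]≡-n n))
    (trans (cong alternating (ℤₚ.∣-i∣≡∣i∣ (+ n))) (sym (ℤₚ.neg-involutive (alternating n))))

  sgn-+ : ∀ k l → sgn (k + l) ≡ sgn k * sgn l
  sgn-+ k (+ zero)     = trans (cong sgn (ℤₚ.+-identityʳ k)) (sym (ℤₚ.*-identityʳ (sgn k)))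
  sgn-+ k (+ suc n)    = begin
    sgn (k + + suc n)         ≡⟨ cong sgn (lem k (+ n)) ⟩
    sgn (ℤ.suc (k + + n))     ≡⟨ sgn-suc (k + + n) ⟩
    - sgn (k + + n)           ≡⟨ cong -_ (sgn-+ k (+ n)) ⟩
    - (sgn k * sgn (+ n))     ≡⟨ ℤₚ.neg-distribʳ-* (sgn k) _ ⟩
    sgn k * - sgn (+ n)       ∎
    where
    open ≡-Reasoning
    lem : ∀ k n → k + (1ℤ + n) ≡ 1ℤ + (k + n)
    lem = solve-∀
  sgn-+ k -[1+ n ] = begin
    sgn (k + -[1+ n ])                ≡⟨ sym (ℤₚ.neg-involutive _) ⟩
    - - sgn (k + -[1+ n ])            ≡⟨ cong -_ (sym (sgn-suc (k + -[1+ n ]))) ⟩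
    - sgn (ℤ.suc (k + -[1+ n ]))      ≡⟨ cong (λ z → - sgn z) (lem k (+ n)) ⟩
    - sgn (k + - (+ n))               ≡⟨ cong -_ (rec n) ⟩
    - (sgn k * alternating n)         ≡⟨ ℤₚ.neg-distribʳ-* (sgn k) _ ⟩
    sgn k * - alternating n           ∎
    where
    open ≡-Reasoning
    lem : ∀ k n → 1ℤ + (k + - (1ℤ + n)) ≡ k + - n
    lem = solve-∀
    rec : ∀ n → sgn (k + - (+ n)) ≡ sgn k * alternating n
    rec zero    = sgn-+ k (+ zero)
    rec (suc n) = sgn-+ k -[1+ n ]

  alternating-sq : ∀ n → alternating n * alternating n ≡ 1ℤ
  alternating-sq zero    = refl
  alternating-sq (suc n) = trans (lem (alternating n)) (alternating-sq n)
    where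
    lem : ∀ a → (- a) * (- a) ≡ a * a
    lem = solve-∀

-- Theta series and the Jacobi triple product.

module ThetaSeries where
  open PowerSeries
  open FiniteSums
  open GaussianBinomials
  open BilateralSums
  open import Data.Integer using (_+_; _-_; _*_; -_)

  -- The signed theta series with exponent function `e`. The window depends on the degree `m`; it is
  -- wide enough when `e` is `Bounded`, since then `∣ k ∣ > m` forces `e k > m`.
  Θ : (ℤ → ℕ) → Series
  Θ e m = bil (suc m) (λ k → sgn k * (x^ e k) m)

  Bounded : (ℤ → ℕ) → Set
  Bounded e = ∀ k → ∣ k ∣ ℕ.≤ e k

  term-supported : ∀ {e} → Bounded e → ∀ g m → Supported (suc m) (λ k → sgn k * shift (e k) g m)
  term-supported {e} bd g m k m<k = trans (cong (sgn k *_) (shift-< (e k) g m (ℕₚ.<-≤-trans m<k (bd k)))) (ℤₚ.*-zeroʳ (sgn k))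

  Θ-*ˢ-hasSum : ∀ {e} → Bounded e → ∀ g m → HasSum (λ k → sgn k * shift (e k) g m) ((Θ e *ˢ g) m)
  Θ-*ˢ-hasSum {e} bd g m = suc m , term-supported bd g m , sym (begin
    (Θ e *ˢ g) m
      ≡⟨ *ˢ-cong-≤ m (λ t t≤m → sym (bil-stable (suc m) (term-supported bd one t) (ℕ.s≤s t≤m))) (λ _ _ → refl) ⟩
    ((λ t → bil (suc m) (λ k → sgn k * (x^ e k) t)) *ˢ g) m
      ≡⟨ bil-*ˢ (suc m) sgn (λ k → x^ e k) g m ⟩
    bil (suc m) (λ k → sgn k * (x^ e k *ˢ g) m)
      ≡⟨ bil-cong (suc m) (λ k → cong (sgn k *_) (x^-*ˢ (e k) g m)) ⟩
    bil (suc m) (λ k → sgn k * shift (e k) g m) ∎)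
    where open ≡-Reasoning

  triangle : ℕ → ℕ
  triangle zero    = 0
  triangle (suc n) = n ℕ.+ triangle n

  2*triangle : ∀ n → + 2 * + triangle n ≡ + n * + n - + n
  2*triangle zero    = refl
  2*triangle (suc n) = trans (cong (+ 2 *_) (ℤₚ.pos-+ n (triangle n))) (trans (ℤₚ.*-distribˡ-+ (+ 2) (+ n) (+ triangle n))
    (trans (+-congˡ (+ 2 * + n) (2*triangle n)) (lem (+ n))))
    where
    lem : ∀ n → + 2 * n + (n * n - n) ≡ (1ℤ + n) * (1ℤ + n) - (1ℤ + n)
    lem = solve-∀

  -- The exponent P k(k-1)/2 + B k with P = B + C.
  jacobi : ℕ → ℕ → ℤ → ℕ
  jacobi B C (+ n)    = (B ℕ.+ C) ℕ.* triangle n ℕ.+ B ℕ.* n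
  jacobi B C -[1+ n ] = (B ℕ.+ C) ℕ.* triangle (suc n) ℕ.+ C ℕ.* suc n

  jacobi-bounded : ∀ {B C} → 0 ℕ.< B → 0 ℕ.< C → Bounded (jacobi B C)
  jacobi-bounded {B@(suc _)} {C} _ _ (+ n)    = ℕₚ.≤-trans (ℕₚ.m≤n*m n B) (ℕₚ.m≤n+m (B ℕ.* n) ((B ℕ.+ C) ℕ.* triangle n))
  jacobi-bounded {B} {C@(suc _)} _ _ -[1+ n ] = ℕₚ.≤-trans (ℕₚ.m≤n*m (suc n) C) (ℕₚ.m≤n+m (C ℕ.* suc n) ((B ℕ.+ C) ℕ.* triangle (suc n)))

  pos-linear : ∀ a t b n → + (a ℕ.* t ℕ.+ b ℕ.* n) ≡ + a * + t + + b * + n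
  pos-linear a t b n = trans (ℤₚ.pos-+ (a ℕ.* t) (b ℕ.* n)) (cong₂ _+_ (ℤₚ.pos-* a t) (ℤₚ.pos-* b n))

  -- Doubling turns the triangular numbers into polynomials in `k`, uniformly in its sign. Later
  -- identities between exponents are likewise checked by the ring solver after doubling.
  jacobi-spec : ∀ B C k → + 2 * + jacobi B C k ≡ (+ B + + C) * (k * k - k) + + 2 * + B * k
  jacobi-spec B C (+ n) = begin
    + 2 * + jacobi B C (+ n)
      ≡⟨ cong (+ 2 *_) (pos-linear (B ℕ.+ C) (triangle n) B n) ⟩
    + 2 * ((+ B + + C) * + triangle n + + B * + n)
      ≡⟨ lem (+ B) (+ C) (+ triangle n) (+ n) ⟩
    (+ B + + C) * (+ 2 * + triangle n) + + 2 * + B * + n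
      ≡⟨ cong (λ z → (+ B + + C) * z + + 2 * + B * + n) (2*triangle n) ⟩
    (+ B + + C) * (+ n * + n - + n) + + 2 * + B * + n ∎
    where
    open ≡-Reasoning
    lem : ∀ b c t n → + 2 * ((b + c) * t + b * n) ≡ (b + c) * (+ 2 * t) + + 2 * b * n
    lem = solve-∀
  jacobi-spec B C -[1+ n ] = begin
    + 2 * + jacobi B C -[1+ n ]
      ≡⟨ cong (+ 2 *_) (pos-linear (B ℕ.+ C) (triangle (suc n)) C (suc n)) ⟩
    + 2 * ((+ B + + C) * + triangle (suc n) + + C * + suc n)
      ≡⟨ lem (+ B) (+ C) (+ triangle (suc n)) (+ suc n) ⟩
    (+ B + + C) * (+ 2 * + triangle (suc n)) + + 2 * + C * + suc n
      ≡⟨ cong (λ z → (+ B + + C) * z + + 2 * + C * + suc n) (2*triangle (suc n)) ⟩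
    (+ B + + C) * (+ suc n * + suc n - + suc n) + + 2 * + C * + suc n
      ≡⟨ lem₂ (+ B) (+ C) (+ suc n) ⟩
    (+ B + + C) * (-[1+ n ] * -[1+ n ] - -[1+ n ]) + + 2 * + B * -[1+ n ] ∎
    where
    open ≡-Reasoning
    lem : ∀ b c t n → + 2 * ((b + c) * t + c * n) ≡ (b + c) * (+ 2 * t) + + 2 * c * n
    lem = solve-∀
    lem₂ : ∀ b c n → (b + c) * (n * n - n) + + 2 * c * n ≡ (b + c) * ((- n) * (- n) - (- n)) + + 2 * b * (- n)
    lem₂ = solve-∀

  jacobi-suc : ∀ B C k → + jacobi B C (ℤ.suc k) ≡ + jacobi B C k + (+ B + + C) * k + + B
  jacobi-suc B C k = ℤₚ.*-cancelˡ-≡ (+ 2) _ _ (trans (jacobi-spec B C (ℤ.suc k))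
    (trans (lem (+ B) (+ C) k) (trans (cong (λ z → z + + 2 * ((+ B + + C) * k + + B)) (sym (jacobi-spec B C k))) (lem₂ (+ jacobi B C k) ((+ B + + C) * k) (+ B)))))
    where
    lem : ∀ b c k → (b + c) * ((1ℤ + k) * (1ℤ + k) - (1ℤ + k)) + + 2 * b * (1ℤ + k) ≡
                    (b + c) * (k * k - k) + + 2 * b * k + + 2 * ((b + c) * k + b)
    lem = solve-∀
    lem₂ : ∀ e l b → + 2 * e + + 2 * (l + b) ≡ + 2 * (e + l + b)
    lem₂ = solve-∀

  jacobi-neg : ∀ B C n → jacobi B C (- (+ n)) ≡ jacobi C B (+ n)
  jacobi-neg B C zero    = lem B C
    where
    lem : ∀ B C → (B ℕ.+ C) ℕ.* 0 ℕ.+ B ℕ.* 0 ≡ (C ℕ.+ B) ℕ.* 0 ℕ.+ C ℕ.* 0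
    lem = ℕSolver.solve-∀
  jacobi-neg B C (suc n) = cong (λ z → z ℕ.* triangle (suc n) ℕ.+ C ℕ.* suc n) (ℕₚ.+-comm B C)

  shift-mod : ∀ e {D f g} → f ≈[ D ] g → shift e f ≈[ e ℕ.+ D ] shift e g
  shift-mod zero    p m       l         = p m l
  shift-mod (suc e) p zero    l         = refl
  shift-mod (suc e) p (suc m) (ℕ.s≤s l) = shift-mod e p m l

  suc-⊖ : ∀ k c → suc k ⊖ c ≡ ℤ.suc (k ⊖ c)
  suc-⊖ k c = trans (sym (ℤₚ.m-n≡m⊖n (suc k) c)) (trans (ℤₚ.+-assoc 1ℤ (+ k) (- (+ c))) (+-congˡ 1ℤ (ℤₚ.m-n≡m⊖n k c)))

  module _ (B C : ℕ) where
    private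
      P = B ℕ.+ C

    -- Rothe's finite q-binomial theorem: `q-binomial` started from the empty product.
    poch-theta : ∀ c → poch P B c ≈ (λ m → ∑ (suc c) (λ k → alternating k * (gauss P c k *ˢ x^ jacobi B C (+ k)) m))
    poch-theta c m = trans (sym (*ˢ-identityˡ (poch P B c) m))
      (q-binomial P 0 B alternating (λ k → jacobi B C (+ k)) one (λ _ → refl) (step B C)
        (λ m → sym (trans (+-congˡ 0ℤ (trans (ℤₚ.*-identityˡ ((one *ˢ x^ jacobi B C (+ 0)) m)) (*ˢ-identityˡ (x^ jacobi B C (+ 0)) m)))
            (trans (ℤₚ.+-identityˡ ((x^ jacobi B C (+ 0)) m)) (x^-cong {jacobi B C (+ 0)} {0} (z B C) m)))) c m)
      where
      z : ∀ B C → (B ℕ.+ C) ℕ.* 0 ℕ.+ B ℕ.* 0 ≡ 0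
      z = ℕSolver.solve-∀
      step : ∀ B C k → jacobi B C (+ suc k) ℕ.+ (B ℕ.+ C) ℕ.* 0 ≡ jacobi B C (+ k) ℕ.+ (B ℕ.+ C) ℕ.* k ℕ.+ B
      step B C k = l B C k (triangle k)
        where
        l : ∀ B C k t → (B ℕ.+ C) ℕ.* (k ℕ.+ t) ℕ.+ B ℕ.* suc k ℕ.+ (B ℕ.+ C) ℕ.* 0 ≡ (B ℕ.+ C) ℕ.* t ℕ.+ B ℕ.* k ℕ.+ (B ℕ.+ C) ℕ.* k ℕ.+ B
        l = ℕSolver.solve-∀

  module JacobiTripleProduct (B C : ℕ) (0<B : 0 ℕ.< B) (0<C : 0 ℕ.< C) where
    private
      P = B ℕ.+ C
      0<P : 0 ℕ.< P
      0<P = ℕₚ.<-≤-trans 0<B (ℕₚ.m≤m+n B C)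
      e = jacobi B C

    -- Cauchy's finite form of the triple product. The expansion of `(x^C; x^P)_J`, read backwards,
    -- supplies the indices from `-J` to 0; multiplying by `(x^B; x^P)_J` through `q-binomial`
    -- extends the sum to `J`.
    finite : ∀ J → poch P C J *ˢ poch P B J ≈ (λ m → ∑ (suc (J ℕ.+ J)) (λ k → sgn (k ⊖ J) * (gauss P (J ℕ.+ J) k *ˢ x^ e (k ⊖ J)) m))
    finite J = q-binomial P J B (λ k → sgn (k ⊖ J)) (λ k → e (k ⊖ J)) (poch P C J)
      (λ k → trans (cong sgn (suc-⊖ k J)) (sgn-suc (k ⊖ J))) step base J
      where
      step : ∀ k → e (suc k ⊖ J) ℕ.+ P ℕ.* J ≡ e (k ⊖ J) ℕ.+ P ℕ.* k ℕ.+ B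
      step k = ℤₚ.+-injective (begin
        + (e (suc k ⊖ J) ℕ.+ P ℕ.* J)
          ≡⟨ trans (ℤₚ.pos-+ _ (P ℕ.* J)) (cong₂ _+_ (cong (λ z → + e z) (suc-⊖ k J)) (ℤₚ.pos-* P J)) ⟩
        + e (ℤ.suc (k ⊖ J)) + + P * + J
          ≡⟨ cong₂ (λ a b → a + b * + J) (jacobi-suc B C (k ⊖ J)) (ℤₚ.pos-+ B C) ⟩
        + e (k ⊖ J) + (+ B + + C) * (k ⊖ J) + + B + (+ B + + C) * + J
          ≡⟨ cong (λ z → + e (k ⊖ J) + (+ B + + C) * z + + B + (+ B + + C) * + J) (sym (ℤₚ.m-n≡m⊖n k J)) ⟩
        + e (k ⊖ J) + (+ B + + C) * (+ k - + J) + + B + (+ B + + C) * + J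
          ≡⟨ lem (+ e (k ⊖ J)) (+ B + + C) (+ k) (+ J) (+ B) ⟩
        + e (k ⊖ J) + (+ B + + C) * + k + + B
          ≡⟨ cong (λ z → + e (k ⊖ J) + z + + B) (trans (cong (λ z → z * + k) (sym (ℤₚ.pos-+ B C))) (sym (ℤₚ.pos-* P k))) ⟩
        + (e (k ⊖ J) ℕ.+ P ℕ.* k ℕ.+ B) ∎)
        where
        open ≡-Reasoning
        lem : ∀ x p k j b → x + p * (k - j) + b + p * j ≡ x + p * k + b
        lem = solve-∀
      base : poch P C J ≈ (λ m → ∑ (suc J) (λ k → sgn (k ⊖ J) * (gauss P J k *ˢ x^ e (k ⊖ J)) m))
      base m = begin
        poch P C J m
          ≡⟨ cong (λ Q → poch Q C J m) (ℕₚ.+-comm B C) ⟩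
        poch (C ℕ.+ B) C J m
          ≡⟨ poch-theta C B J m ⟩
        ∑ (suc J) (λ k → alternating k * (gauss (C ℕ.+ B) J k *ˢ x^ jacobi C B (+ k)) m)
          -- Replacing `k` by `J - k` costs nothing because Gaussian binomials are symmetric and
          -- negating the index of `jacobi` swaps `B` and `C`.
          ≡⟨ ∑-reverse J _ ⟩
        ∑ (suc J) (λ k → alternating (J ∸ k) * (gauss (C ℕ.+ B) J (J ∸ k) *ˢ x^ jacobi C B (+ (J ∸ k))) m)
          ≡⟨ ∑-cong-< (suc J) (λ { k (ℕ.s≤s k≤J) → term k k≤J }) ⟩
        ∑ (suc J) (λ k → sgn (k ⊖ J) * (gauss P J k *ˢ x^ e (k ⊖ J)) m) ∎
        where
        open ≡-Reasoning
        term : ∀ k → k ℕ.≤ J → alternating (J ∸ k) * (gauss (C ℕ.+ B) J (J ∸ k) *ˢ x^ jacobi C B (+ (J ∸ k))) m ≡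
                               sgn (k ⊖ J) * (gauss P J k *ˢ x^ e (k ⊖ J)) m
        term k k≤J = cong₂ _*_ (cong alternating (sym (ℤₚ.∣⊖∣-≤ k≤J)))
          (*ˢ-cong g≈ (x^-cong (trans (sym (jacobi-neg B C (J ∸ k))) (cong e (sym (ℤₚ.⊖-≤ k≤J))))) m)
          where
          g≈ : gauss (C ℕ.+ B) J (J ∸ k) ≈ gauss P J k
          g≈ n = trans (cong (λ Q → gauss Q J (J ∸ k) n) (ℕₚ.+-comm C B))
            (trans (cong (λ j → gauss P j (J ∸ k) n) (sym (ℕₚ.m+[n∸m]≡n k≤J)))
              (trans (sym (gauss-sym P k (J ∸ k) 0<P n)) (cong (λ j → gauss P j k n) (ℕₚ.m+[n∸m]≡n k≤J))))

    private
      -- Towards the ends of the range the Gaussian binomial is close to its limit only to low order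
      -- `D`. The loss is at most `∣ k ⊖ J ∣`, which the power `x^ e (k ⊖ J)` beside it makes up
      -- for, `e` being bounded below by the absolute value of its argument.
      gauss-mod : ∀ J k → k ℕ.≤ J ℕ.+ J → Σ ℕ λ D → (J ℕ.≤ D ℕ.+ ∣ k ⊖ J ∣) × poch P P J *ˢ gauss P (J ℕ.+ J) k ≈[ D ] one
      gauss-mod J k k≤2J with ℕₚ.≤-total k J
      ... | inj₁ k≤J = P ℕ.* k ℕ.+ P
        , ℕₚ.≤-trans (ℕₚ.≤-reflexive (sym (trans (cong (k ℕ.+_) (ℤₚ.∣⊖∣-≤ k≤J)) (ℕₚ.m+[n∸m]≡n k≤J))))
            (ℕₚ.+-monoˡ-≤ ∣ k ⊖ J ∣ (k≤Pk+P k))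
        , λ m m<D → trans (cong (λ n → (poch P P J *ˢ gauss P n k) m) (sym eq))
            (poch-*-gauss-mod P J k (J ℕ.+ (J ∸ k)) k≤J ℕₚ.≤-refl
              (ℕₚ.+-monoˡ-≤ P (ℕₚ.*-monoʳ-≤ P (ℕₚ.≤-trans k≤J (ℕₚ.m≤m+n J _)))) m m<D)
        where
        k≤Pk+P : ∀ k → k ℕ.≤ P ℕ.* k ℕ.+ P
        k≤Pk+P k = ℕₚ.≤-trans (ℕₚ.m≤n*m k P ⦃ ℕ.>-nonZero 0<P ⦄) (ℕₚ.m≤m+n _ P)
        eq : k ℕ.+ (J ℕ.+ (J ∸ k)) ≡ J ℕ.+ J
        eq = trans (lem k J (J ∸ k)) (cong (J ℕ.+_) (ℕₚ.m+[n∸m]≡n k≤J))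
          where
          lem : ∀ a b c → a ℕ.+ (b ℕ.+ c) ≡ b ℕ.+ (a ℕ.+ c)
          lem = ℕSolver.solve-∀
      ... | inj₂ J≤k = P ℕ.* d ℕ.+ P
        , ℕₚ.≤-trans (ℕₚ.≤-reflexive (sym J≡)) (ℕₚ.+-monoˡ-≤ ∣ k ⊖ J ∣ (ℕₚ.≤-trans (ℕₚ.m≤n*m d P ⦃ ℕ.>-nonZero 0<P ⦄) (ℕₚ.m≤m+n _ P)))
        , λ m m<D → trans (*ˢ-cong (≈-refl {poch P P J}) g≈ m)
            (poch-*-gauss-mod P J d k (ℕₚ.+-cancelˡ-≤ J d J (ℕₚ.≤-trans (ℕₚ.+-monoˡ-≤ d J≤k) (ℕₚ.≤-reflexive k+d≡2J)))
              ℕₚ.≤-refl (ℕₚ.+-monoˡ-≤ P (ℕₚ.*-monoʳ-≤ P (ℕₚ.≤-trans d≤J J≤k))) m m<D)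
        where
        d = J ℕ.+ J ∸ k
        k+d≡2J : k ℕ.+ d ≡ J ℕ.+ J
        k+d≡2J = ℕₚ.m+[n∸m]≡n k≤2J
        d≤J : d ℕ.≤ J
        d≤J = ℕₚ.+-cancelˡ-≤ J d J (ℕₚ.≤-trans (ℕₚ.+-monoˡ-≤ d J≤k) (ℕₚ.≤-reflexive k+d≡2J))
        J≡ : d ℕ.+ ∣ k ⊖ J ∣ ≡ J
        J≡ = ℕₚ.+-cancelˡ-≡ J _ _ (trans (cong (λ z → J ℕ.+ (d ℕ.+ z)) (cong ∣_∣ (ℤₚ.⊖-≥ J≤k)))
          (trans (lem J d (k ∸ J)) (trans (cong (ℕ._+ d) (ℕₚ.m+[n∸m]≡n J≤k)) k+d≡2J)))
          where
          lem : ∀ a b c → a ℕ.+ (b ℕ.+ c) ≡ a ℕ.+ c ℕ.+ b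
          lem = ℕSolver.solve-∀
        g≈ : gauss P (J ℕ.+ J) k ≈ gauss P (d ℕ.+ k) d
        g≈ m = trans (cong (λ n → gauss P n k m) (sym k+d≡2J)) (trans (gauss-sym P k d 0<P m) (cong (λ n → gauss P n d m) (ℕₚ.+-comm k d)))

      window : ∀ J g → ∑ (J ℕ.+ J) (λ k → g (k ⊖ J)) ≡ bil J g
      window J g = trans (∑-split J J (λ k → g (k ⊖ J))) (sym (trans (bil-block 0 J g)
        (trans (ℤₚ.+-identityˡ _) (+-congˡ (∑ J (λ r → g (r ⊖ J))) (∑-cong-< J (λ r _ → cong g (sym (trans (ℤₚ.⊖-≥ (ℕₚ.m≤m+n J r)) (cong +_ (ℕₚ.m+n∸m≡n J r))))))))))

    jacobi-triple-product : ∀ J → poch P P J *ˢ (poch P C J *ˢ poch P B J) ≈[ J ] Θ e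
    jacobi-triple-product J m m<J = begin
      (poch P P J *ˢ (poch P C J *ˢ poch P B J)) m
        ≡⟨ *ˢ-cong (≈-refl {poch P P J}) (finite J) m ⟩
      (poch P P J *ˢ (λ m → ∑ (suc (J ℕ.+ J)) (λ k → sgn (k ⊖ J) * (gauss P (J ℕ.+ J) k *ˢ x^ e (k ⊖ J)) m))) m
        ≡⟨ *ˢ-comm (poch P P J) _ m ⟩
      ((λ m → ∑ (suc (J ℕ.+ J)) (λ k → sgn (k ⊖ J) * (gauss P (J ℕ.+ J) k *ˢ x^ e (k ⊖ J)) m)) *ˢ poch P P J) m
        ≡⟨ ∑-*ˢ (suc (J ℕ.+ J)) (λ k → sgn (k ⊖ J)) (λ k → gauss P (J ℕ.+ J) k *ˢ x^ e (k ⊖ J)) (poch P P J) m ⟩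
      ∑ (suc (J ℕ.+ J)) (λ k → sgn (k ⊖ J) * ((gauss P (J ℕ.+ J) k *ˢ x^ e (k ⊖ J)) *ˢ poch P P J) m)
        ≡⟨ ∑-cong-< (suc (J ℕ.+ J)) (λ { k (ℕ.s≤s l) → cong (sgn (k ⊖ J) *_) (term k l) }) ⟩
      ∑ (suc (J ℕ.+ J)) (λ k → sgn (k ⊖ J) * (x^ e (k ⊖ J)) m)
        -- The index `k = 2J` lies just outside the half-open window; its exponent is at least `J`,
        -- above the degree `m`.
        ≡⟨ cong₂ _+_ (window J (λ k → sgn k * (x^ e k) m)) top ⟩
      bil J (λ k → sgn k * (x^ e k) m) + 0ℤ
        ≡⟨ ℤₚ.+-identityʳ _ ⟩
      bil J (λ k → sgn k * (x^ e k) m)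
        ≡⟨ bil-stable J (term-supported bd one m) m<J ⟩
      Θ e m ∎
      where
      open ≡-Reasoning
      bd = jacobi-bounded 0<B 0<C
      2J⊖J : (J ℕ.+ J) ⊖ J ≡ + J
      2J⊖J = trans (ℤₚ.⊖-≥ (ℕₚ.m≤m+n J J)) (cong +_ (ℕₚ.m+n∸m≡n J J))
      top : sgn ((J ℕ.+ J) ⊖ J) * (x^ e ((J ℕ.+ J) ⊖ J)) m ≡ 0ℤ
      top = trans (cong (λ z → sgn z * (x^ e z) m) 2J⊖J)
        (trans (cong (sgn (+ J) *_) (shift-< (e (+ J)) one m (ℕₚ.<-≤-trans m<J (bd (+ J))))) (ℤₚ.*-zeroʳ (sgn (+ J))))
      open SeriesSolver using (solve; _:=_; _:*_)
      solver : ∀ g x u → (g *ˢ x) *ˢ u ≈ x *ˢ (u *ˢ g)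
      solver = solve 3 (λ g x u → (g :* x) :* u := x :* (u :* g)) (λ _ → refl)
      term : ∀ k → k ℕ.≤ J ℕ.+ J → ((gauss P (J ℕ.+ J) k *ˢ x^ e (k ⊖ J)) *ˢ poch P P J) m ≡ (x^ e (k ⊖ J)) m
      term k l with gauss-mod J k l
      ... | D , J≤ , g≈ = trans (solver (gauss P (J ℕ.+ J) k) (x^ e (k ⊖ J)) (poch P P J) m)
        (trans (x^-*ˢ (e (k ⊖ J)) (poch P P J *ˢ gauss P (J ℕ.+ J) k) m)
          (shift-mod (e (k ⊖ J)) g≈ m (ℕₚ.<-≤-trans m<J (ℕₚ.≤-trans J≤
            (ℕₚ.≤-trans (ℕₚ.≤-reflexive (ℕₚ.+-comm D _)) (ℕₚ.+-monoˡ-≤ D (bd (k ⊖ J))))))))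

-- The quintuple product identity.

module QuintupleProduct where
  open PowerSeries
  open BilateralSums
  open ThetaSeries
  open import Data.Integer using (_+_; _-_; _*_; -_)

  sgn-even : ∀ k d → sgn (k + + 2 * d) ≡ sgn k
  sgn-even k d = begin
    sgn (k + + 2 * d)          ≡⟨ sgn-+ k (+ 2 * d) ⟩
    sgn k * sgn (+ 2 * d)      ≡⟨ cong (λ z → sgn k * sgn z) (double d) ⟩
    sgn k * sgn (d + d)        ≡⟨ cong (sgn k *_) (trans (sgn-+ d d) (alternating-sq ∣ d ∣)) ⟩
    sgn k * 1ℤ                 ≡⟨ ℤₚ.*-identityʳ (sgn k) ⟩
    sgn k                      ∎
    where
    open ≡-Reasoning
    double : ∀ d → + 2 * d ≡ d + d
    double = solve-∀

  term : (e θ : ℤ → ℕ) → ℕ → ℤ → ℤ → ℤ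
  term e θ m n i = sgn (n + i) * (x^ (e n ℕ.+ θ i)) m

  term-supported₂ : ∀ {e θ} → Bounded e → Bounded θ → ∀ m → Supported₂ (term e θ m)
  term-supported₂ {e} {θ} be bθ m = suc m , λ n i l →
    trans (cong (sgn (n + i) *_) (shift-< (e n ℕ.+ θ i) one m (large n i l))) (ℤₚ.*-zeroʳ (sgn (n + i)))
    where
    large : ∀ n i → m ℕ.< ∣ n ∣ ⊎ m ℕ.< ∣ i ∣ → m ℕ.< e n ℕ.+ θ i
    large n i (inj₁ l) = ℕₚ.<-≤-trans l (ℕₚ.≤-trans (be n) (ℕₚ.m≤m+n (e n) (θ i)))
    large n i (inj₂ l) = ℕₚ.<-≤-trans l (ℕₚ.≤-trans (bθ i) (ℕₚ.m≤n+m (θ i) (e n)))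

  ΘΘ-hasSum : ∀ {e θ} → Bounded e → Bounded θ → ∀ m →
    Σ (ℤ → ℤ) λ r → (∀ n → HasSum (term e θ m n) (r n)) × HasSum r ((Θ e *ˢ Θ θ) m)
  ΘΘ-hasSum {e} {θ} be bθ m = (λ n → sgn n * shift (e n) (Θ θ) m) , rows , Θ-*ˢ-hasSum be (Θ θ) m
    where
    entry : ∀ n i → sgn n * (sgn i * shift (θ i) (x^ e n) m) ≡ term e θ m n i
    entry n i = trans (sym (ℤₚ.*-assoc (sgn n) (sgn i) _)) (cong₂ _*_ (sym (sgn-+ n i))
      (trans (sym (shift-+ (θ i) (e n) one m)) (cong (λ z → (x^ z) m) (ℕₚ.+-comm (θ i) (e n)))))
    rows : ∀ n → HasSum (term e θ m n) (sgn n * shift (e n) (Θ θ) m)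
    rows n = hasSum-cong (entry n) (subst (λ v → HasSum (λ i → sgn n * (sgn i * shift (θ i) (x^ e n) m)) (sgn n * v))
      (trans (*ˢ-comm (Θ θ) (x^ e n) m) (x^-*ˢ (e n) (Θ θ) m)) (hasSum-scale (sgn n) (Θ-*ˢ-hasSum bθ (x^ e n) m)))

  -- Grouping by the power `N` of `z` replaces the second index by `N + c n`. Linear growth of `c`
  -- keeps the sheared support finite: where `∣ n ∣ < K` the displacement is at most `A · K`.
  supported₂-shear : ∀ {f} A (c : ℤ → ℤ) → (∀ n → ∣ c n ∣ ℕ.≤ A ℕ.* suc ∣ n ∣) → Supported₂ f → Supported₂ (λ n N → f n (N + c n))
  supported₂-shear {f} A c c≤ (K , s) = K ℕ.+ A ℕ.* K , go
    where
    lem : ∀ a c → a ≡ a + c - c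
    lem = solve-∀
    go : ∀ n N → K ℕ.+ A ℕ.* K ℕ.≤ ∣ n ∣ ⊎ K ℕ.+ A ℕ.* K ℕ.≤ ∣ N ∣ → f n (N + c n) ≡ 0ℤ
    go n N (inj₁ l) = s n (N + c n) (inj₁ (ℕₚ.≤-trans (ℕₚ.m≤m+n K (A ℕ.* K)) l))
    go n N (inj₂ l) with ℕₚ.≤-<-connex K ∣ n ∣
    ... | inj₁ K≤n = s n (N + c n) (inj₁ K≤n)
    ... | inj₂ n<K = s n (N + c n) (inj₂ (ℕₚ.+-cancelʳ-≤ (A ℕ.* K) K ∣ N + c n ∣
      (ℕₚ.≤-trans l (ℕₚ.≤-trans (ℕₚ.≤-trans (ℕₚ.≤-reflexive (cong ∣_∣ (lem N (c n)))) (ℤₚ.∣i-j∣≤∣i∣+∣j∣ (N + c n) (c n)))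
        (ℕₚ.+-monoʳ-≤ ∣ N + c n ∣ (ℕₚ.≤-trans (c≤ n) (ℕₚ.*-monoʳ-≤ A n<K)))))))

  halve : ∀ a b → + 2 * + a ≡ + 2 * + b → a ≡ b
  halve a b p = ℤₚ.+-injective (ℤₚ.*-cancelˡ-≡ (+ 2) _ _ p)

  -- Base P = 2B + D and z = x^B.
  module Identity (B D : ℕ) (0<B : 0 ℕ.< B) (0<D : 0 ℕ.< D) where

    P : ℕ
    P = B ℕ.+ B ℕ.+ D

    -- With `Q = x^P`, the series with exponents `e₁` and `e₂` are the sums of
    -- `(-1)^k Q^(k(3k-1)/2)` times `z^(3k)` and `z^(1-3k)`; `θ₁` and `θ₂` belong to the triple
    -- products in `z` and `z²`. The linear coefficient `P - 3B = D - B` of `e₂` may be negative, so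
    -- `e₂` is not given by `jacobi` and is tabulated by the sign of `k`.
    e₁ e₂ θ₁ θ₂ pent : ℤ → ℕ
    e₁   = jacobi (5 ℕ.* B ℕ.+ D) (B ℕ.+ 2 ℕ.* D)
    θ₁   = jacobi B (B ℕ.+ D)
    θ₂   = jacobi (B ℕ.+ B) D
    pent = jacobi (2 ℕ.* P) P
    e₂ (+ zero)  = B
    e₂ (+ suc j) = D ℕ.+ (3 ℕ.* P ℕ.* triangle j ℕ.+ (5 ℕ.* B ℕ.+ 4 ℕ.* D) ℕ.* j)
    e₂ -[1+ j ]  = B ℕ.+ (3 ℕ.* P ℕ.* triangle (suc j) ℕ.+ (7 ℕ.* B ℕ.+ 2 ℕ.* D) ℕ.* suc j)

    private
      b d p : ℤ
      b = + B
      d = + D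
      p = b + b + d

      +P : + P ≡ p
      +P = trans (ℤₚ.pos-+ (B ℕ.+ B) D) (cong (λ z → z + d) (ℤₚ.pos-+ B B))

      pos-lin : ∀ x y → + (x ℕ.* B ℕ.+ y ℕ.* D) ≡ + x * b + + y * d
      pos-lin x y = pos-linear x B y D

    e₁-spec : ∀ k → + 2 * + e₁ k ≡ p * (+ 3 * k * k - k) + + 6 * b * k
    e₁-spec k = trans (jacobi-spec (5 ℕ.* B ℕ.+ D) (B ℕ.+ 2 ℕ.* D) k)
      (trans (cong₂ (λ u v → (u + v) * (k * k - k) + + 2 * u * k)
        (trans (ℤₚ.pos-+ (5 ℕ.* B) D) (cong (λ z → z + d) (ℤₚ.pos-* 5 B)))
        (trans (ℤₚ.pos-+ B (2 ℕ.* D)) (+-congˡ b (ℤₚ.pos-* 2 D)))) (lem b d k))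
      where
      lem : ∀ b d k → (+ 5 * b + d + (b + + 2 * d)) * (k * k - k) + + 2 * (+ 5 * b + d) * k ≡
                      (b + b + d) * (+ 3 * k * k - k) + + 6 * b * k
      lem = solve-∀

    θ₁-spec : ∀ k → + 2 * + θ₁ k ≡ p * (k * k - k) + + 2 * b * k
    θ₁-spec k = trans (jacobi-spec B (B ℕ.+ D) k) (cong (λ z → z * (k * k - k) + + 2 * b * k)
      (trans (+-congˡ b (ℤₚ.pos-+ B D)) (sym (ℤₚ.+-assoc b b d))))

    θ₂-spec : ∀ k → + 2 * + θ₂ k ≡ p * (k * k - k) + + 4 * b * k
    θ₂-spec k = trans (jacobi-spec (B ℕ.+ B) D k) (trans (cong (λ u → (u + d) * (k * k - k) + + 2 * u * k) (ℤₚ.pos-+ B B)) (lem b d k))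
      where
      lem : ∀ b d k → (b + b + d) * (k * k - k) + + 2 * (b + b) * k ≡ (b + b + d) * (k * k - k) + + 4 * b * k
      lem = solve-∀

    pent-spec : ∀ k → + 2 * + pent k ≡ p * (+ 3 * k * k + k)
    pent-spec k = trans (jacobi-spec (2 ℕ.* P) P k)
      (trans (cong₂ (λ u v → (u + v) * (k * k - k) + + 2 * u * k) (trans (ℤₚ.pos-* 2 P) (cong (+ 2 *_) +P)) +P) (lem p k))
      where
      lem : ∀ p k → (+ 2 * p + p) * (k * k - k) + + 2 * (+ 2 * p) * k ≡ p * (+ 3 * k * k + k)
      lem = solve-∀

    e₂-spec : ∀ k → + 2 * + e₂ k ≡ p * (+ 3 * k * k - k) - + 6 * b * k + + 2 * b
    e₂-spec (+ zero) = lem b d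
      where
      lem : ∀ b d → + 2 * b ≡ (b + b + d) * (+ 3 * 0ℤ * 0ℤ - 0ℤ) - + 6 * b * 0ℤ + + 2 * b
      lem = solve-∀
    e₂-spec (+ suc j) = begin
      + 2 * + e₂ (+ suc j)
        ≡⟨ cong (+ 2 *_) (trans (ℤₚ.pos-+ D _) (+-congˡ d (trans (pos-linear (3 ℕ.* P) (triangle j) (5 ℕ.* B ℕ.+ 4 ℕ.* D) j)
             (cong₂ (λ u v → u * + triangle j + v * + j) (trans (ℤₚ.pos-* 3 P) (cong (+ 3 *_) +P)) (pos-lin 5 4))))) ⟩
      + 2 * (d + (+ 3 * p * + triangle j + (+ 5 * b + + 4 * d) * + j))
        ≡⟨ lem₁ b d (+ triangle j) (+ j) ⟩
      + 3 * p * (+ 2 * + triangle j) + + 2 * (d + (+ 5 * b + + 4 * d) * + j)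
        ≡⟨ cong (λ z → + 3 * p * z + + 2 * (d + (+ 5 * b + + 4 * d) * + j)) (2*triangle j) ⟩
      + 3 * p * (+ j * + j - + j) + + 2 * (d + (+ 5 * b + + 4 * d) * + j)
        ≡⟨ lem₂ b d (+ j) ⟩
      p * (+ 3 * + suc j * + suc j - + suc j) - + 6 * b * + suc j + + 2 * b ∎
      where
      open ≡-Reasoning
      lem₁ : ∀ b d t j → + 2 * (d + (+ 3 * (b + b + d) * t + (+ 5 * b + + 4 * d) * j)) ≡
                         + 3 * (b + b + d) * (+ 2 * t) + + 2 * (d + (+ 5 * b + + 4 * d) * j)
      lem₁ = solve-∀
      lem₂ : ∀ b d j → + 3 * (b + b + d) * (j * j - j) + + 2 * (d + (+ 5 * b + + 4 * d) * j) ≡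
                       (b + b + d) * (+ 3 * (1ℤ + j) * (1ℤ + j) - (1ℤ + j)) - + 6 * b * (1ℤ + j) + + 2 * b
      lem₂ = solve-∀
    e₂-spec -[1+ j ] = begin
      + 2 * + e₂ -[1+ j ]
        ≡⟨ cong (+ 2 *_) (trans (ℤₚ.pos-+ B _) (+-congˡ b (trans (pos-linear (3 ℕ.* P) (triangle (suc j)) (7 ℕ.* B ℕ.+ 2 ℕ.* D) (suc j))
             (cong₂ (λ u v → u * + triangle (suc j) + v * + suc j) (trans (ℤₚ.pos-* 3 P) (cong (+ 3 *_) +P)) (pos-lin 7 2))))) ⟩
      + 2 * (b + (+ 3 * p * + triangle (suc j) + (+ 7 * b + + 2 * d) * + suc j))
        ≡⟨ lem₁ b d (+ triangle (suc j)) (+ suc j) ⟩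
      + 3 * p * (+ 2 * + triangle (suc j)) + + 2 * (b + (+ 7 * b + + 2 * d) * + suc j)
        ≡⟨ cong (λ z → + 3 * p * z + + 2 * (b + (+ 7 * b + + 2 * d) * + suc j)) (2*triangle (suc j)) ⟩
      + 3 * p * (+ suc j * + suc j - + suc j) + + 2 * (b + (+ 7 * b + + 2 * d) * + suc j)
        ≡⟨ lem₂ b d (+ suc j) ⟩
      p * (+ 3 * -[1+ j ] * -[1+ j ] - -[1+ j ]) - + 6 * b * -[1+ j ] + + 2 * b ∎
      where
      open ≡-Reasoning
      lem₁ : ∀ b d t j → + 2 * (b + (+ 3 * (b + b + d) * t + (+ 7 * b + + 2 * d) * j)) ≡
                         + 3 * (b + b + d) * (+ 2 * t) + + 2 * (b + (+ 7 * b + + 2 * d) * j)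
      lem₁ = solve-∀
      lem₂ : ∀ b d j → + 3 * (b + b + d) * (j * j - j) + + 2 * (b + (+ 7 * b + + 2 * d) * j) ≡
                       (b + b + d) * (+ 3 * (- j) * (- j) - (- j)) - + 6 * b * (- j) + + 2 * b
      lem₂ = solve-∀

    private
      0<B+ : ∀ {n} → 0 ℕ.< B ℕ.+ n
      0<B+ {n} = ℕₚ.<-≤-trans 0<B (ℕₚ.m≤m+n B n)

      *-grows : ∀ c j → 0 ℕ.< c → j ℕ.≤ c ℕ.* j
      *-grows (suc c) j _ = ℕₚ.m≤n*m j (suc c)

    e₁-bounded : Bounded e₁
    e₁-bounded = jacobi-bounded (ℕₚ.<-≤-trans 0<B+ (ℕₚ.≤-reflexive (lem B D))) 0<B+
      where
      lem : ∀ B D → B ℕ.+ (4 ℕ.* B ℕ.+ D) ≡ 5 ℕ.* B ℕ.+ D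
      lem = ℕSolver.solve-∀

    θ₁-bounded : Bounded θ₁
    θ₁-bounded = jacobi-bounded 0<B 0<B+

    θ₂-bounded : Bounded θ₂
    θ₂-bounded = jacobi-bounded 0<B+ 0<D

    0<P : 0 ℕ.< P
    0<P = ℕₚ.<-≤-trans 0<D (ℕₚ.m≤n+m D (B ℕ.+ B))

    pent-bounded : Bounded pent
    pent-bounded = jacobi-bounded (ℕₚ.<-≤-trans 0<P (*-grows 2 P (ℕ.s≤s ℕ.z≤n))) 0<P

    e₂-bounded : Bounded e₂
    e₂-bounded (+ zero)  = ℕ.z≤n
    e₂-bounded (+ suc j) = ℕₚ.+-mono-≤ 0<D (ℕₚ.≤-trans (*-grows (5 ℕ.* B ℕ.+ 4 ℕ.* D) j
        (ℕₚ.<-≤-trans 0<B (ℕₚ.≤-trans (*-grows 5 B (ℕ.s≤s ℕ.z≤n)) (ℕₚ.m≤m+n (5 ℕ.* B) (4 ℕ.* D)))))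
      (ℕₚ.m≤n+m _ (3 ℕ.* P ℕ.* triangle j)))
    e₂-bounded -[1+ j ] = ℕₚ.≤-trans (*-grows (7 ℕ.* B ℕ.+ 2 ℕ.* D) (suc j)
        (ℕₚ.<-≤-trans 0<B (ℕₚ.≤-trans (*-grows 7 B (ℕ.s≤s ℕ.z≤n)) (ℕₚ.m≤m+n (7 ℕ.* B) (2 ℕ.* D)))))
      (ℕₚ.≤-trans (ℕₚ.m≤n+m _ (3 ℕ.* P ℕ.* triangle (suc j))) (ℕₚ.m≤n+m _ B))

    -- The coefficient of z^N on the left is summed over n; for N = 2M the two parts are the
    -- terms of the pentagonal series with k ≡ M and k ≢ M (mod 2), for odd N they cancel.
    quintuple : (Θ e₁ +ˢ Θ e₂) *ˢ Θ θ₁ ≈ Θ pent *ˢ Θ θ₂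
    quintuple m = begin
      ((Θ e₁ +ˢ Θ e₂) *ˢ Θ θ₁) m
        ≡⟨ *ˢ-distribʳ (Θ θ₁) (Θ e₁) (Θ e₂) m ⟩
      (Θ e₁ *ˢ Θ θ₁) m + (Θ e₂ *ˢ Θ θ₁) m
        ≡⟨ proj₂ (proj₂ parity) ⟩
      0ℤ + w 0 + w 1
        ≡⟨ cong₂ (λ u v → 0ℤ + u + v) (hasSum-unique (hasSum-cong even-part (proj₁ (proj₂ parity) 0 (ℕ.s≤s ℕ.z≤n))) (proj₂ (proj₂ cols)))
             (hasSum-unique (proj₁ (proj₂ parity) 1 ℕₚ.≤-refl) (hasSum-zero odd-part)) ⟩
      0ℤ + (Θ pent *ˢ Θ θ₂) m + 0ℤ
        ≡⟨ trans (ℤₚ.+-identityʳ _) (ℤₚ.+-identityˡ _) ⟩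
      (Θ pent *ˢ Θ θ₂) m ∎
      where
      open ≡-Reasoning
      f₁ = term e₁ θ₁ m
      f₂ = term e₂ θ₁ m
      g  = term pent θ₂ m
      c₁ c₂ : ℤ → ℤ
      -- The power of `z` is `3n + i` in the first product and `1 - 3n + i` in the second; equating
      -- it to `N` gives `i = N + c₁ n` and `i = N + c₂ n`.
      c₁ n = - (+ 3 * n)
      c₂ n = + 3 * n + - 1ℤ
      c₁≤ : ∀ n → ∣ c₁ n ∣ ℕ.≤ 3 ℕ.* suc ∣ n ∣
      c₁≤ n = ℕₚ.≤-trans (ℕₚ.≤-reflexive (trans (ℤₚ.∣-i∣≡∣i∣ (+ 3 * n)) (ℤₚ.abs-* (+ 3) n))) (ℕₚ.*-monoʳ-≤ 3 (ℕₚ.n≤1+n ∣ n ∣))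
      c₂≤ : ∀ n → ∣ c₂ n ∣ ℕ.≤ 3 ℕ.* suc ∣ n ∣
      c₂≤ n = ℕₚ.≤-trans (ℤₚ.∣i+j∣≤∣i∣+∣j∣ (+ 3 * n) (- 1ℤ))
        (ℕₚ.≤-trans (ℕₚ.≤-reflexive (cong (ℕ._+ 1) (ℤₚ.abs-* (+ 3) n)))
          (ℕₚ.≤-trans (ℕₚ.+-monoʳ-≤ (3 ℕ.* ∣ n ∣) (ℕ.s≤s (ℕ.z≤n {2}))) (ℕₚ.≤-reflexive (lem ∣ n ∣))))
        where
        lem : ∀ a → 3 ℕ.* a ℕ.+ 3 ≡ 3 ℕ.* suc a
        lem = ℕSolver.solve-∀
      rows₁ = ΘΘ-hasSum e₁-bounded θ₁-bounded m
      rows₂ = ΘΘ-hasSum e₂-bounded θ₁-bounded m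
      rowsᵍ = ΘΘ-hasSum pent-bounded θ₂-bounded m
      cols₁ = fubini (supported₂-shear {f₁} 3 c₁ c₁≤ (term-supported₂ e₁-bounded θ₁-bounded m))
                (λ n → hasSum-translate (c₁ n) (proj₁ (proj₂ rows₁) n)) (proj₂ (proj₂ rows₁))
      cols₂ = fubini (supported₂-shear {f₂} 3 c₂ c₂≤ (term-supported₂ e₂-bounded θ₁-bounded m))
                (λ n → hasSum-translate (c₂ n) (proj₁ (proj₂ rows₂) n)) (proj₂ (proj₂ rows₂))
      cols  = fubini (term-supported₂ pent-bounded θ₂-bounded m) (proj₁ (proj₂ rowsᵍ)) (proj₂ (proj₂ rowsᵍ))
      C₁ = proj₁ cols₁
      C₂ = proj₁ cols₂
      parity = hasSum-residues 2 (ℕ.s≤s ℕ.z≤n) (hasSum-+ (proj₂ (proj₂ cols₁)) (proj₂ (proj₂ cols₂)))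
      w = proj₁ parity

      even-part : ∀ M → C₁ (+ 0 + + 2 * M) + C₂ (+ 0 + + 2 * M) ≡ proj₁ cols M
      even-part M = trans (cong₂ _+_
          (hasSum-unique (proj₁ (proj₂ cols₁) (+ 0 + + 2 * M)) (hasSum-cong (λ n → sym (eq₁ n)) (hasR 0 (ℕ.s≤s ℕ.z≤n))))
          (hasSum-unique (proj₁ (proj₂ cols₂) (+ 0 + + 2 * M)) (hasSum-cong (λ n → sym (eq₂ n)) (hasSum-translate (M + - 1ℤ) (hasR 1 ℕₚ.≤-refl)))))
        (trans (cong (λ z → z + proj₁ R 1) (sym (ℤₚ.+-identityˡ (proj₁ R 0)))) (sym (proj₂ (proj₂ R))))
        where
        R = hasSum-residues 2 (ℕ.s≤s ℕ.z≤n) (hasSum-translate (- M) (proj₁ (proj₂ cols) M))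
        hasR = proj₁ (proj₂ R)
        -- The pentagonal index here is `k = 2n - M`, of the parity of `M`.
        eq₁ : ∀ n → f₁ n (+ 0 + + 2 * M + c₁ n) ≡ g (+ 0 + + 2 * n + - M) M
        eq₁ n = cong₂ _*_ sg (cong (λ z → (x^ z) m) (halve (e₁ n ℕ.+ θ₁ (+ 0 + + 2 * M + c₁ n)) (pent (+ 0 + + 2 * n + - M) ℕ.+ θ₂ M) ex))
          where
          sg : sgn (n + (+ 0 + + 2 * M + c₁ n)) ≡ sgn (+ 0 + + 2 * n + - M + M)
          sg = trans (cong sgn (lem M n)) (sgn-even (+ 0 + + 2 * n + - M + M) (M - + 2 * n))
            where
            lem : ∀ M n → n + (+ 0 + + 2 * M + - (+ 3 * n)) ≡ (+ 0 + + 2 * n + - M + M) + + 2 * (M - + 2 * n)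
            lem = solve-∀
          ex : + 2 * (+ e₁ n + + θ₁ (+ 0 + + 2 * M + c₁ n)) ≡ + 2 * (+ pent (+ 0 + + 2 * n + - M) + + θ₂ M)
          ex = trans (ℤₚ.*-distribˡ-+ (+ 2) (+ e₁ n) _) (trans (cong₂ _+_ (e₁-spec n) (θ₁-spec (+ 0 + + 2 * M + c₁ n)))
            (trans (lem b d n M) (trans (cong₂ _+_ (sym (pent-spec (+ 0 + + 2 * n + - M))) (sym (θ₂-spec M)))
              (sym (ℤₚ.*-distribˡ-+ (+ 2) (+ pent (+ 0 + + 2 * n + - M)) _)))))
            where
            lem : ∀ b d n M → let i = + 0 + + 2 * M + - (+ 3 * n) ; k = + 0 + + 2 * n + - M in
              (b + b + d) * (+ 3 * n * n - n) + + 6 * b * n + ((b + b + d) * (i * i - i) + + 2 * b * i) ≡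
              (b + b + d) * (+ 3 * k * k + k) + ((b + b + d) * (M * M - M) + + 4 * b * M)
            lem = solve-∀
        -- The pentagonal index is `k = 2n + M - 1`, of the other parity; the translation by `M - 1`
        -- puts it into the form that the splitting by residues modulo 2 produces.
        eq₂ : ∀ n → f₂ n (+ 0 + + 2 * M + c₂ n) ≡ g (+ 1 + + 2 * (n + (M + - 1ℤ)) + - M) M
        eq₂ n = cong₂ _*_ sg (cong (λ z → (x^ z) m) (halve (e₂ n ℕ.+ θ₁ (+ 0 + + 2 * M + c₂ n)) (pent (+ 1 + + 2 * (n + (M + - 1ℤ)) + - M) ℕ.+ θ₂ M) ex))
          where
          sg : sgn (n + (+ 0 + + 2 * M + c₂ n)) ≡ sgn (+ 1 + + 2 * (n + (M + - 1ℤ)) + - M + M)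
          sg = trans (cong sgn (lem M n)) (sgn-even (+ 1 + + 2 * (n + (M + - 1ℤ)) + - M + M) n)
            where
            lem : ∀ M n → n + (+ 0 + + 2 * M + (+ 3 * n + - 1ℤ)) ≡ (+ 1 + + 2 * (n + (M + - 1ℤ)) + - M + M) + + 2 * n
            lem = solve-∀
          ex : + 2 * (+ e₂ n + + θ₁ (+ 0 + + 2 * M + c₂ n)) ≡ + 2 * (+ pent (+ 1 + + 2 * (n + (M + - 1ℤ)) + - M) + + θ₂ M)
          ex = trans (ℤₚ.*-distribˡ-+ (+ 2) (+ e₂ n) _) (trans (cong₂ _+_ (e₂-spec n) (θ₁-spec (+ 0 + + 2 * M + c₂ n)))
            (trans (lem b d n M) (trans (cong₂ _+_ (sym (pent-spec (+ 1 + + 2 * (n + (M + - 1ℤ)) + - M))) (sym (θ₂-spec M)))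
              (sym (ℤₚ.*-distribˡ-+ (+ 2) (+ pent (+ 1 + + 2 * (n + (M + - 1ℤ)) + - M)) _)))))
            where
            lem : ∀ b d n M → let i = + 0 + + 2 * M + (+ 3 * n + - 1ℤ) ; k = + 1 + + 2 * (n + (M + - 1ℤ)) + - M in
              (b + b + d) * (+ 3 * n * n - n) - + 6 * b * n + + 2 * b + ((b + b + d) * (i * i - i) + + 2 * b * i) ≡
              (b + b + d) * (+ 3 * k * k + k) + ((b + b + d) * (M * M - M) + + 4 * b * M)
            lem = solve-∀

      odd-part : ∀ M → C₁ (+ 1 + + 2 * M) + C₂ (+ 1 + + 2 * M) ≡ 0ℤ
      odd-part M = hasSum-unique
        (hasSum-+ {h = λ n → f₂ n (+ 1 + + 2 * M + c₂ n)}
          (hasSum-translate M {g = λ n → f₁ n (+ 1 + + 2 * M + c₁ n)} (proj₁ (proj₂ cols₁) (+ 1 + + 2 * M))) (proj₁ (proj₂ cols₂) (+ 1 + + 2 * M)))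
        (hasSum-zero (λ n → trans (cong (λ z → z + f₂ n (+ 1 + + 2 * M + c₂ n)) (cancel n)) (ℤₚ.+-inverseˡ (f₂ n (+ 1 + + 2 * M + c₂ n)))))
        where
        -- For `N = 2M + 1`, moving `n` to `n + M` in the first sum gives the exponents of the
        -- second, with signs of opposite parity.
        cancel : ∀ n → f₁ (n + M) (+ 1 + + 2 * M + c₁ (n + M)) ≡ - f₂ n (+ 1 + + 2 * M + c₂ n)
        cancel n = trans (cong₂ _*_ sg (cong (λ z → (x^ z) m) (halve (e₁ (n + M) ℕ.+ θ₁ (+ 1 + + 2 * M + c₁ (n + M))) (e₂ n ℕ.+ θ₁ (+ 1 + + 2 * M + c₂ n)) ex))) (sym (ℤₚ.neg-distribˡ-* (sgn (n + (+ 1 + + 2 * M + c₂ n))) ((x^ (e₂ n ℕ.+ θ₁ (+ 1 + + 2 * M + c₂ n))) m)))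
          where
          sg : sgn (n + M + (+ 1 + + 2 * M + c₁ (n + M))) ≡ - sgn (n + (+ 1 + + 2 * M + c₂ n))
          sg = trans (cong sgn (lem M n)) (trans (sgn-even (1ℤ + (n + (+ 1 + + 2 * M + c₂ n))) (- (M + + 3 * n))) (sgn-suc (n + (+ 1 + + 2 * M + c₂ n))))
            where
            lem : ∀ M n → n + M + (+ 1 + + 2 * M + - (+ 3 * (n + M))) ≡ (1ℤ + (n + (+ 1 + + 2 * M + (+ 3 * n + - 1ℤ)))) + + 2 * (- (M + + 3 * n))
            lem = solve-∀
          ex : + 2 * (+ e₁ (n + M) + + θ₁ (+ 1 + + 2 * M + c₁ (n + M))) ≡ + 2 * (+ e₂ n + + θ₁ (+ 1 + + 2 * M + c₂ n))
          ex = trans (ℤₚ.*-distribˡ-+ (+ 2) (+ e₁ (n + M)) _) (trans (cong₂ _+_ (e₁-spec (n + M)) (θ₁-spec (+ 1 + + 2 * M + c₁ (n + M))))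
            (trans (lem b d n M) (trans (cong₂ _+_ (sym (e₂-spec n)) (sym (θ₁-spec (+ 1 + + 2 * M + c₂ n))))
              (sym (ℤₚ.*-distribˡ-+ (+ 2) (+ e₂ n) _)))))
            where
            lem : ∀ b d n M → let i = + 1 + + 2 * M + - (+ 3 * (n + M)) ; k = + 1 + + 2 * M + (+ 3 * n + - 1ℤ) in
              (b + b + d) * (+ 3 * (n + M) * (n + M) - (n + M)) + + 6 * b * (n + M) + ((b + b + d) * (i * i - i) + + 2 * b * i) ≡
              (b + b + d) * (+ 3 * n * n - n) - + 6 * b * n + + 2 * b + ((b + b + d) * (k * k - k) + + 2 * b * k)
            lem = solve-∀

-- The given coefficients as coefficients of a quotient of Pochhammer products.

module Quotients where
  open PowerSeries
  open FiniteSums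
  open GaussianBinomials
  open import Data.Integer using (_+_; _-_; _*_; -_)

  if-≤ᵇ-shift : ∀ e f n → (if e ≤ᵇ n then f (n ∸ e) else 0ℤ) ≡ shift e f n
  if-≤ᵇ-shift e f n with e ≤ᵇ n in eq
  ... | true  = sym (trans (cong (shift e f) (sym (ℕₚ.m+[n∸m]≡n e≤n))) (shift-≥ e f (n ∸ e)))
    where
    e≤n : e ℕ.≤ n
    e≤n = ℕₚ.≤ᵇ⇒≤ e n (subst Bool.T (sym eq) tt)
  ... | false = sym (shift-< e f n (ℕₚ.≰⇒> (λ e≤n → subst Bool.T eq (ℕₚ.≤⇒≤ᵇ e≤n))))

  mulOneMinus-*ˢ : ∀ k f → mulOneMinus k f ≈ 1-x^ k *ˢ f
  mulOneMinus-*ˢ k f n = trans (cong (λ z → f n - z) (if-≤ᵇ-shift k f n)) (sym (1-x^-*ˢ k f n))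

  sumℤ-upTo : ∀ n f → sumℤ (List.map f (List.upTo n)) ≡ ∑ n f
  sumℤ-upTo n f = trans (cong sumℤ (Listₚ.map-upTo f n)) (go n f)
    where
    go : ∀ n f → sumℤ (List.applyUpTo f n) ≡ ∑ n f
    go zero    f = refl
    go (suc n) f = trans (+-congˡ (f 0) (go n (λ k → f (suc k)))) (sym (∑-head n f))

  -- Terms beyond the built-in range vanish, so the length `L` is free. This lets the expansions at
  -- two different degrees be compared over a common range.
  divOneMinus-∑ : ∀ {k} → 0 ℕ.< k → ∀ f n {L} → n ℕ.< L → divOneMinus k f n ≡ ∑ L (λ j → shift (j ℕ.* k) f n)
  divOneMinus-∑ {k@(suc _)} _ f n {L} n<L with ℕₚ.m≤n⇒∃[o]m+o≡n n<L
  ... | o , refl = trans (sumℤ-upTo (suc n) _) (trans (∑-cong-< (suc n) (λ j _ → if-≤ᵇ-shift (j ℕ.* k) f n))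
      (sym (trans (∑-split (suc n) o _) (trans (+-congˡ (∑ (suc n) (λ j → shift (j ℕ.* k) f n)) (∑-zero o (λ j _ → beyond j))) (ℤₚ.+-identityʳ _)))))
    where
    beyond : ∀ j → shift ((suc n ℕ.+ j) ℕ.* k) f n ≡ 0ℤ
    beyond j = shift-< ((suc n ℕ.+ j) ℕ.* k) f n (ℕₚ.<-≤-trans (ℕ.s≤s (ℕₚ.m≤m+n n j)) (ℕₚ.m≤m*n (suc n ℕ.+ j) k))

  divOneMinus-unfold : ∀ {k} → 0 ℕ.< k → ∀ f n → divOneMinus k f n ≡ f n + shift k (divOneMinus k f) n
  divOneMinus-unfold {k} 0<k f n = trans (divOneMinus-∑ 0<k f n (ℕₚ.n<1+n n)) (trans (∑-head n (λ j → shift (j ℕ.* k) f n)) (+-congˡ (f n) (rest (ℕₚ.≤-<-connex k n))))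
    where
    rest : k ℕ.≤ n ⊎ n ℕ.< k → ∑ n (λ j → shift (k ℕ.+ j ℕ.* k) f n) ≡ shift k (divOneMinus k f) n
    rest (inj₂ n<k) = trans (∑-zero n (λ j _ → shift-< (k ℕ.+ j ℕ.* k) f n (ℕₚ.<-≤-trans n<k (ℕₚ.m≤m+n k (j ℕ.* k))))) (sym (shift-< k _ n n<k))
    rest (inj₁ k≤n) with ℕₚ.m≤n⇒∃[o]m+o≡n k≤n
    ... | o , refl = trans (∑-cong-< (k ℕ.+ o) (λ j _ → trans (shift-+ k (j ℕ.* k) f (k ℕ.+ o)) (shift-≥ k (shift (j ℕ.* k) f) o)))
      (trans (sym (divOneMinus-∑ 0<k f o (ℕₚ.+-monoˡ-≤ o 0<k))) (sym (shift-≥ k (divOneMinus k f) o)))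

  divOneMinus-cong : ∀ {k} → 0 ℕ.< k → ∀ {f g} → f ≈ g → divOneMinus k f ≈ divOneMinus k g
  divOneMinus-cong {k} 0<k {f} {g} f≈g n = trans (divOneMinus-∑ 0<k f n ℕₚ.≤-refl)
    (trans (∑-cong-< (suc n) (λ j _ → shift-cong (j ℕ.* k) f≈g n)) (sym (divOneMinus-∑ 0<k g n ℕₚ.≤-refl)))

  1-x^-divOneMinus : ∀ {k} → 0 ℕ.< k → ∀ f → 1-x^ k *ˢ divOneMinus k f ≈ f
  1-x^-divOneMinus {k} 0<k f n = trans (1-x^-*ˢ k (divOneMinus k f) n)
    (trans (cong (λ z → z - shift k (divOneMinus k f) n) (divOneMinus-unfold 0<k f n)) (lem (f n) _))
    where
    lem : ∀ a b → a + b - b ≡ a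
    lem = solve-∀

  1-x^-0 : ∀ {k} → 0 ℕ.< k → (1-x^ k) 0 ≡ 1ℤ
  1-x^-0 {suc k} _ = refl

  divOneMinus-*ˢ : ∀ {k} → 0 ℕ.< k → ∀ f g → divOneMinus k f *ˢ g ≈ divOneMinus k (f *ˢ g)
  divOneMinus-*ˢ {k} 0<k f g n = *ˢ-cancelˡ-mod {suc n} (1-x^ k) _ _ (1-x^-0 0<k)
    (λ m _ → trans (sym (*ˢ-assoc (1-x^ k) (divOneMinus k f) g m))
      (trans (*ˢ-cong (1-x^-divOneMinus 0<k f) (≈-refl {g}) m) (sym (1-x^-divOneMinus 0<k (f *ˢ g) m)))) n ℕₚ.≤-refl

  -- 1/(x^s; x^P)_n
  invPoch : ℕ → ℕ → ℕ → Series
  invPoch P s zero    = one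
  invPoch P s (suc n) = divOneMinus (P ℕ.* n ℕ.+ s) (invPoch P s n)

  private
    0<+ : ∀ a {s} → 0 ℕ.< s → 0 ℕ.< a ℕ.+ s
    0<+ a {s} 0<s = ℕₚ.<-≤-trans 0<s (ℕₚ.m≤n+m s a)

  poch-invPoch : ∀ P {s} → 0 ℕ.< s → ∀ n → poch P s n *ˢ invPoch P s n ≈ one
  poch-invPoch P 0<s zero    = *ˢ-identityˡ one
  poch-invPoch P {s} 0<s (suc n) = ≈-trans (*ˢ-assoc (poch P s n) (1-x^ (P ℕ.* n ℕ.+ s)) _)
    (≈-trans (*ˢ-cong (≈-refl {poch P s n}) (1-x^-divOneMinus (0<+ (P ℕ.* n) 0<s) (invPoch P s n))) (poch-invPoch P 0<s n))

  -- The fold interleaves numerator and denominator factors. Multiplying by `poch p p M`, which has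
  -- constant term 1, cancels the denominators one by one and separates the two products.
  partialProd-≈ : ∀ {p i} → 0 ℕ.< p → ∀ M → partialProd p i M ≈ poch i i M *ˢ invPoch p p M
  partialProd-≈ {p} {i} 0<p M n = trans (fold M suc (λ _ → ℕ.s≤s ℕ.z≤n) n)
    (*ˢ-cancelˡ-mod {suc n} (poch p p M) _ _ (poch-0 p p M 0<p) (λ m _ → eq m) n ℕₚ.≤-refl)
    where
    open SeriesSolver using (solve; _:=_; _:*_)
    step : ℕ → Series → Series
    step m g = mulOneMinus (i ℕ.* m) (divOneMinus (p ℕ.* m) g)
    step-*ˢ : ∀ {m} → 0 ℕ.< m → ∀ g → step m g ≈ (1-x^ (i ℕ.* m) *ˢ divOneMinus (p ℕ.* m) one) *ˢ g
    step-*ˢ {m} 0<m g = ≈-trans (mulOneMinus-*ˢ (i ℕ.* m) _) (≈-trans (*ˢ-cong (≈-refl {1-x^ (i ℕ.* m)})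
        (≈-trans (divOneMinus-cong 0<pm (≈-sym (*ˢ-identityˡ g))) (≈-sym (divOneMinus-*ˢ 0<pm one g)))) (≈-sym (*ˢ-assoc (1-x^ (i ℕ.* m)) (divOneMinus (p ℕ.* m) one) g)))
      where
      0<pm : 0 ℕ.< p ℕ.* m
      0<pm = ℕₚ.*-mono-≤ 0<p 0<m
    factor : ℕ → Series
    factor m = 1-x^ (i ℕ.* m) *ˢ divOneMinus (p ℕ.* m) one
    fold : ∀ M (φ : ℕ → ℕ) → (∀ m → 0 ℕ.< φ m) → List.foldr step one (List.applyUpTo φ M) ≈ ∏ M (λ j → factor (φ j))
    fold zero    φ 0<φ = ≈-refl
    fold (suc M) φ 0<φ = ≈-trans (step-*ˢ (0<φ 0) _)
      (≈-trans (*ˢ-cong (≈-refl {factor (φ 0)}) (fold M (λ j → φ (suc j)) (λ m → 0<φ (suc m)))) (≈-sym (∏-head M (λ j → factor (φ j)))))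
    suc-* : ∀ a j → a ℕ.* suc j ≡ a ℕ.* j ℕ.+ a
    suc-* = ℕSolver.solve-∀
    cancelled : ∀ M → poch p p M *ˢ ∏ M (λ j → factor (suc j)) ≈ poch i i M
    cancelled zero    = *ˢ-identityˡ one
    cancelled (suc M) = begin
      (poch p p M *ˢ 1-x^ (p ℕ.* M ℕ.+ p)) *ˢ (∏ M (λ j → factor (suc j)) *ˢ (1-x^ (i ℕ.* suc M) *ˢ d))
        ≈⟨ solve 5 (λ a b c e f → (a :* b) :* (c :* (e :* f)) := (a :* c) :* (e :* (b :* f))) (λ _ → refl)
             (poch p p M) (1-x^ (p ℕ.* M ℕ.+ p)) (∏ M (λ j → factor (suc j))) (1-x^ (i ℕ.* suc M)) d ⟩
      (poch p p M *ˢ ∏ M (λ j → factor (suc j))) *ˢ (1-x^ (i ℕ.* suc M) *ˢ (1-x^ (p ℕ.* M ℕ.+ p) *ˢ d))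
        ≈⟨ *ˢ-cong (cancelled M) (*ˢ-cong (1-x^-cong (suc-* i M)) (≈-trans (*ˢ-cong (1-x^-cong (sym (suc-* p M))) (≈-refl {d})) (1-x^-divOneMinus (ℕₚ.*-mono-≤ 0<p (ℕ.s≤s (ℕ.z≤n {M}))) one))) ⟩
      poch i i M *ˢ (1-x^ (i ℕ.* M ℕ.+ i) *ˢ one)
        ≈⟨ *ˢ-cong (≈-refl {poch i i M}) (*ˢ-identityʳ _) ⟩
      poch i i M *ˢ 1-x^ (i ℕ.* M ℕ.+ i) ∎
      where
      open SetoidReasoning seriesSetoid
      d = divOneMinus (p ℕ.* suc M) one
    eq : poch p p M *ˢ ∏ M (λ j → factor (suc j)) ≈ poch p p M *ˢ (poch i i M *ˢ invPoch p p M)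
    eq = ≈-trans (cancelled M) (≈-sym (≈-trans (solve 3 (λ a b c → a :* (b :* c) := b :* (a :* c)) (λ _ → refl) (poch p p M) (poch i i M) (invPoch p p M))
      (≈-trans (*ˢ-cong (≈-refl {poch i i M}) (poch-invPoch p 0<p M)) (*ˢ-identityʳ (poch i i M)))))

  -- f(x) = g(x^p)
  Inflates : ℕ → Series → Series → Set
  Inflates p f g = (∀ x → f (p ℕ.* x) ≡ g x) × (∀ y → ¬ (p ℕD.∣ y) → f y ≡ 0ℤ)

  inflates-shift : ∀ {p f g} → 0 ℕ.< p → Inflates p f g → ∀ e → Inflates p (shift (p ℕ.* e) f) (shift e g)
  inflates-shift {p@(suc _)} {f} {g} _ (on , off) e = on′ , off′
    where
    on′ : ∀ x → shift (p ℕ.* e) f (p ℕ.* x) ≡ shift e g x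
    on′ x with ℕₚ.≤-<-connex e x
    ... | inj₂ x<e = trans (shift-< (p ℕ.* e) f (p ℕ.* x) (ℕₚ.*-monoʳ-< p x<e)) (sym (shift-< e g x x<e))
    ... | inj₁ e≤x with ℕₚ.m≤n⇒∃[o]m+o≡n e≤x
    ...   | o , refl = trans (cong (shift (p ℕ.* e) f) (ℕₚ.*-distribˡ-+ p e o)) (trans (shift-≥ (p ℕ.* e) f (p ℕ.* o)) (trans (on o) (sym (shift-≥ e g o))))
    off′ : ∀ y → ¬ (p ℕD.∣ y) → shift (p ℕ.* e) f y ≡ 0ℤ
    off′ y p∤y with ℕₚ.≤-<-connex (p ℕ.* e) y
    ... | inj₂ y<pe = shift-< (p ℕ.* e) f y y<pe
    ... | inj₁ pe≤y with ℕₚ.m≤n⇒∃[o]m+o≡n pe≤y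
    ...   | o , refl = trans (shift-≥ (p ℕ.* e) f o) (off o (λ p∣o → p∤y (ℕD.∣m∣n⇒∣m+n (ℕD.m∣m*n e) p∣o)))

  inflates-divOneMinus : ∀ {p f g m} → 0 ℕ.< p → 0 ℕ.< m → Inflates p f g → Inflates p (divOneMinus (p ℕ.* m) f) (divOneMinus m g)
  inflates-divOneMinus {p@(suc _)} {f} {g} {m} 0<p 0<m fg =
    (λ x → trans (divOneMinus-∑ 0<pm f (p ℕ.* x) ℕₚ.≤-refl)
      (trans (∑-cong-< (suc (p ℕ.* x)) (λ j _ → trans (cong (λ z → shift z f (p ℕ.* x)) (lem j p m)) (proj₁ (inflates-shift 0<p fg (j ℕ.* m)) x)))
        (sym (divOneMinus-∑ 0<m g x (ℕ.s≤s (ℕₚ.m≤n*m x p))))))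
    , λ y p∤y → trans (divOneMinus-∑ 0<pm f y ℕₚ.≤-refl)
        (∑-zero (suc y) (λ j _ → trans (cong (λ z → shift z f y) (lem j p m)) (proj₂ (inflates-shift 0<p fg (j ℕ.* m)) y p∤y)))
    where
    0<pm : 0 ℕ.< p ℕ.* m
    0<pm = ℕₚ.*-mono-≤ 0<p 0<m
    lem : ∀ j p m → j ℕ.* (p ℕ.* m) ≡ p ℕ.* (j ℕ.* m)
    lem = ℕSolver.solve-∀

  inflates-invPoch : ∀ {p} → 0 ℕ.< p → ∀ n → Inflates p (invPoch p p n) (invPoch 1 1 n)
  inflates-invPoch {p@(suc _)} 0<p zero    = (λ { zero → cong one (ℕₚ.*-zeroʳ p) ; (suc x) → refl }) , off
    where
    off : ∀ y → ¬ (p ℕD.∣ y) → one y ≡ 0ℤ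
    off zero    p∤0 = ⊥-elim (p∤0 (p ℕD.∣0))
    off (suc y) _   = refl
  inflates-invPoch {p} 0<p (suc n) = subst (λ e → Inflates p (divOneMinus e (invPoch p p n)) (divOneMinus (1 ℕ.* n ℕ.+ 1) (invPoch 1 1 n)))
    (lem p n) (inflates-divOneMinus 0<p (0<+ (1 ℕ.* n) (ℕ.s≤s ℕ.z≤n)) (inflates-invPoch 0<p n))
    where
    lem : ∀ p n → p ℕ.* (1 ℕ.* n ℕ.+ 1) ≡ p ℕ.* n ℕ.+ p
    lem = ℕSolver.solve-∀

-- Positivity of theta quotients.

module Positivity where
  open PowerSeries
  open FiniteSums
  open GaussianBinomials
  open ThetaSeries
  open QuintupleProduct
  open Quotients
  open import Data.Integer using (_+_; _-_; _*_; -_)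

  -- `Good` is what a cofactor must satisfy for a product with a `Positive` series to remain
  -- `Positive`.
  Nonneg Positive Good : Series → Set
  Nonneg f   = ∀ n → 0ℤ ℤ.≤ f n
  Positive f = ∀ n → 0ℤ ℤ.< f n
  Good f     = Nonneg f × 0ℤ ℤ.< f 0

  positive⇒good : ∀ {f} → Positive f → Good f
  positive⇒good p = (λ n → ℤₚ.<⇒≤ (p n)) , p 0

  *-nonneg : ∀ {a b} → 0ℤ ℤ.≤ a → 0ℤ ℤ.≤ b → 0ℤ ℤ.≤ a * b
  *-nonneg {+ m} {+ n} _ _ = subst (0ℤ ℤ.≤_) (ℤₚ.pos-* m n) (ℤ.+≤+ ℕ.z≤n)

  *-positive : ∀ {a b} → 0ℤ ℤ.< a → 0ℤ ℤ.< b → 0ℤ ℤ.< a * b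
  *-positive {+ suc m} {+ suc n} _ _ = ℤ.+<+ (ℕ.s≤s ℕ.z≤n)
  *-positive {+ zero} (ℤ.+<+ ())
  *-positive {+ suc m} {+ zero} _ (ℤ.+<+ ())

  *ˢ-nonneg : ∀ {f g} → Nonneg f → Nonneg g → Nonneg (f *ˢ g)
  *ˢ-nonneg p q zero    = *-nonneg (p 0) (q 0)
  *ˢ-nonneg p q (suc n) = ℤₚ.+-mono-≤ (*-nonneg (p 0) (q (suc n))) (*ˢ-nonneg (λ m → p (suc m)) q n)

  *ˢ-good : ∀ {f g} → Good f → Good g → Good (f *ˢ g)
  *ˢ-good (p , p₀) (q , q₀) = *ˢ-nonneg p q , *-positive p₀ q₀

  *ˢ-positive : ∀ {f g} → Positive f → Good g → Positive (f *ˢ g)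
  *ˢ-positive p (q , q₀) zero    = *-positive (p 0) q₀
  *ˢ-positive p (q , q₀) (suc n) = ℤₚ.+-mono-≤-< (*-nonneg (ℤₚ.<⇒≤ (p 0)) (q (suc n))) (*ˢ-positive (λ m → p (suc m)) (q , q₀) n)

  shift-nonneg : ∀ e {f} → Nonneg f → Nonneg (shift e f)
  shift-nonneg zero    p n       = p n
  shift-nonneg (suc e) p zero    = ℤₚ.≤-refl
  shift-nonneg (suc e) p (suc n) = shift-nonneg e p n

  ∑-nonneg : ∀ n {f} → (∀ k → 0ℤ ℤ.≤ f k) → 0ℤ ℤ.≤ ∑ n f
  ∑-nonneg zero    p = ℤₚ.≤-refl
  ∑-nonneg (suc n) p = ℤₚ.+-mono-≤ (∑-nonneg n p) (p n)

  divOneMinus-nonneg : ∀ {k} → 0 ℕ.< k → ∀ {f} → Nonneg f → Nonneg (divOneMinus k f)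
  divOneMinus-nonneg {k} 0<k {f} p n = subst (0ℤ ℤ.≤_) (sym (divOneMinus-∑ 0<k f n ℕₚ.≤-refl))
    (∑-nonneg (suc n) (λ j → shift-nonneg (j ℕ.* k) p n))

  divOneMinus-lower : ∀ {k} → 0 ℕ.< k → ∀ {f} → Nonneg f → ∀ n → 0ℤ ℤ.< f n → 0ℤ ℤ.< divOneMinus k f n
  divOneMinus-lower {k} 0<k {f} p n 0<fn = subst (0ℤ ℤ.<_) (sym (divOneMinus-unfold 0<k f n))
    (ℤₚ.+-mono-<-≤ 0<fn (shift-nonneg k (divOneMinus-nonneg 0<k p) n))

  divOneMinus-good : ∀ {k} → 0 ℕ.< k → ∀ {f} → Good f → Good (divOneMinus k f)
  divOneMinus-good 0<k (p , p₀) = divOneMinus-nonneg 0<k p , divOneMinus-lower 0<k p 0 p₀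

  divOneMinus-positive : ∀ {k} → 0 ℕ.< k → ∀ {f} → Positive f → Positive (divOneMinus k f)
  divOneMinus-positive 0<k p n = divOneMinus-lower 0<k (proj₁ (positive⇒good p)) n (p n)

  -- Dividing by `1 - x` forms partial sums of coefficients, each of which contains `f 0`. This is
  -- where strict positivity in every degree comes from.
  divOneMinus-1-positive : ∀ {f} → Good f → Positive (divOneMinus 1 f)
  divOneMinus-1-positive {f} (p , p₀) zero    = divOneMinus-lower ℕₚ.≤-refl p 0 p₀
  divOneMinus-1-positive {f} (p , p₀) (suc n) = subst (0ℤ ℤ.<_) (sym (divOneMinus-unfold ℕₚ.≤-refl f (suc n)))
    (ℤₚ.+-mono-≤-< (p (suc n)) (divOneMinus-1-positive (p , p₀) n))

  one-good : Good one
  one-good = (λ { zero → ℤ.+≤+ ℕ.z≤n ; (suc n) → ℤₚ.≤-refl }) , ℤ.+<+ ℕₚ.≤-refl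

  invPoch-good : ∀ P {s} → 0 ℕ.< s → ∀ n → Good (invPoch P s n)
  invPoch-good P 0<s zero    = one-good
  invPoch-good P {s} 0<s (suc n) = divOneMinus-good (ℕₚ.<-≤-trans 0<s (ℕₚ.m≤n+m s (P ℕ.* n))) (invPoch-good P 0<s n)

  selected : Bool → ℕ → Series
  selected b e = if b then 1-x^ e else one

  -- The reciprocal of the product of the unmarked factors `1-x^ E r`.
  complement : (ℕ → Bool) → (ℕ → ℕ) → ℕ → Series
  complement k E zero    = one
  complement k E (suc n) = if k n then complement k E n else divOneMinus (E n) (complement k E n)

  module _ (k : ℕ → Bool) (E : ℕ → ℕ) (0<E : ∀ r → 0 ℕ.< E r) where

    complement-good : ∀ n → Good (complement k E n)
    complement-good zero    = one-good
    complement-good (suc n) with k n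
    ... | true  = complement-good n
    ... | false = divOneMinus-good (0<E n) (complement-good n)

    complement-positive : E 0 ≡ 1 → k 0 ≡ false → ∀ n → Positive (complement k E (suc n))
    complement-positive E₀ k₀ zero rewrite k₀ | E₀ = divOneMinus-1-positive one-good
    complement-positive E₀ k₀ (suc n) with k (suc n)
    ... | true  = complement-positive E₀ k₀ n
    ... | false = divOneMinus-positive (0<E (suc n)) (complement-positive E₀ k₀ n)

    complement-*-∏ : ∀ n → complement k E n *ˢ ∏ n (λ r → 1-x^ E r) ≈ ∏ n (λ r → selected (k r) (E r))
    complement-*-∏ zero    = *ˢ-identityˡ one
    complement-*-∏ (suc n) with k n
    ... | true  = ≈-trans (≈-sym (*ˢ-assoc (complement k E n) (∏ n (λ r → 1-x^ E r)) (1-x^ E n))) (*ˢ-cong (complement-*-∏ n) ≈-refl)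
    ... | false = ≈-trans (solver (divOneMinus (E n) (complement k E n)) (∏ n (λ r → 1-x^ E r)) (1-x^ E n))
        (≈-trans (*ˢ-cong (1-x^-divOneMinus (0<E n) (complement k E n)) ≈-refl) (≈-trans (complement-*-∏ n) (≈-sym (*ˢ-identityʳ (∏ n (λ r → selected (k r) (E r)))))))
      where
      open SeriesSolver using (solve; _:=_; _:*_)
      solver : ∀ c p x → c *ˢ (p *ˢ x) ≈ (x *ˢ c) *ˢ p
      solver = solve 3 (λ c p x → c :* (p :* x) := (x :* c) :* p) (λ _ → refl)

  ∏-cong-< : ∀ n {F G} → (∀ r → r ℕ.< n → F r ≈ G r) → ∏ n F ≈ ∏ n G
  ∏-cong-< zero    p = ≈-refl
  ∏-cong-< (suc n) p = *ˢ-cong (∏-cong-< n (λ r l → p r (ℕₚ.m≤n⇒m≤1+n l))) (p n ℕₚ.≤-refl)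

  ≡ᵇ-false : ∀ {m n} → m ≢ n → (m ≡ᵇ n) ≡ false
  ≡ᵇ-false {m} {n} m≢n with m ≡ᵇ n in eq
  ... | false = refl
  ... | true  = ⊥-elim (m≢n (ℕₚ.≡ᵇ⇒≡ m n (subst Bool.T (sym eq) tt)))

  ≡ᵇ-refl : ∀ n → (n ≡ᵇ n) ≡ true
  ≡ᵇ-refl zero    = refl
  ≡ᵇ-refl (suc n) = ≡ᵇ-refl n

  -- The condition on `k a` says that `a` is not yet marked. A mark selects its factor only once, so
  -- building up a product by repeated use requires distinct residues.
  ∏-select : ∀ n a (k : ℕ → Bool) (E : ℕ → ℕ) → k a ≡ false → a ℕ.< n →
    ∏ n (λ r → selected ((r ≡ᵇ a) ∨ k r) (E r)) ≈ 1-x^ E a *ˢ ∏ n (λ r → selected (k r) (E r))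
  ∏-select (suc n) a k E ka (ℕ.s≤s a≤n) with ℕₚ.m≤n⇒m<n∨m≡n a≤n
  ... | inj₁ a<n rewrite ≡ᵇ-false (λ n≡a → ℕₚ.<⇒≢ a<n (sym n≡a)) =
    ≈-trans (*ˢ-cong (∏-select n a k E ka a<n) ≈-refl) (*ˢ-assoc (1-x^ E a) (∏ n (λ r → selected (k r) (E r))) (selected (k n) (E n)))
  ... | inj₂ refl rewrite ≡ᵇ-refl n | ka =
    ≈-trans (*ˢ-comm _ (1-x^ E n)) (*ˢ-cong (≈-refl {1-x^ E n})
      (≈-trans (∏-cong-< n (λ r r<n → λ m → cong (λ b → selected (b ∨ k r) (E r) m) (≡ᵇ-false (ℕₚ.<⇒≢ r<n)))) (≈-sym (*ˢ-identityʳ _))))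

  ∏-one : ∀ n → ∏ n (λ _ → one) ≈ one
  ∏-one zero    = ≈-refl
  ∏-one (suc n) = ≈-trans (*ˢ-identityʳ (∏ n (λ _ → one))) (∏-one n)

  ∏-*ˢ : ∀ n (F G : ℕ → Series) → ∏ n (λ r → F r *ˢ G r) ≈ ∏ n F *ˢ ∏ n G
  ∏-*ˢ zero    F G = ≈-sym (*ˢ-identityˡ one)
  ∏-*ˢ (suc n) F G = ≈-trans (*ˢ-cong (∏-*ˢ n F G) (≈-refl {F n *ˢ G n}))
    (solve 4 (λ a b c d → (a :* b) :* (c :* d) := (a :* c) :* (b :* d)) (λ _ → refl) (∏ n F) (∏ n G) (F n) (G n))
    where open SeriesSolver using (solve; _:=_; _:*_)

  -- The exponents 1, …, PJ are cut into J blocks of length P; the residues marked by k are kept in the numerator.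
  module Blocks (P : ℕ) (k : ℕ → Bool) where

    -- The number `Pj + r + 1`, written as it appears in the factors of
    -- `poch 1 (1 * (P * j) + 1) P`. Residues are therefore offset by one: the exponents `Pj + s`
    -- are marked at `ℕ.pred s`.
    exponent : ℕ → ℕ → ℕ
    exponent j r = 1 ℕ.* r ℕ.+ (1 ℕ.* (P ℕ.* j) ℕ.+ 1)

    0<exponent : ∀ j r → 0 ℕ.< exponent j r
    0<exponent j r = ℕₚ.≤-trans (ℕₚ.m≤n+m 1 (1 ℕ.* (P ℕ.* j))) (ℕₚ.m≤n+m _ (1 ℕ.* r))

    unkept : ℕ → Series
    unkept zero    = one
    unkept (suc J) = unkept J *ˢ complement k (exponent J) P

    kept : ℕ → Series
    kept J = ∏ J (λ j → ∏ P (λ r → selected (k r) (exponent j r)))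

    -- Block 0 contains `1 - x`, unmarked by `k 0 ≡ false`, and is `Positive`; from the later blocks
    -- `Good` suffices.
    unkept-positive : 0 ℕ.< P → k 0 ≡ false → ∀ J → Positive (unkept (suc J))
    unkept-positive 0<P k₀ zero n = subst (0ℤ ℤ.<_) (sym (*ˢ-identityˡ _ n)) (block 0<P n)
      where
      block : 0 ℕ.< P → Positive (complement k (exponent 0) P)
      block (ℕ.s≤s {n = q} _) = complement-positive k (exponent 0) (0<exponent 0) (cong (λ z → 1 ℕ.* z ℕ.+ 1) (ℕₚ.*-zeroʳ P)) k₀ q
    unkept-positive 0<P k₀ (suc J) = *ˢ-positive (unkept-positive 0<P k₀ J) (complement-good k (exponent (suc J)) (0<exponent (suc J)) P)

    unkept-*-poch : ∀ J → unkept J *ˢ poch 1 1 (P ℕ.* J) ≈ kept J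
    unkept-*-poch zero rewrite ℕₚ.*-zeroʳ P = *ˢ-identityˡ one
    unkept-*-poch (suc J) = begin
      (unkept J *ˢ c) *ˢ poch 1 1 (P ℕ.* suc J)
        ≡⟨ cong (λ n → (unkept J *ˢ c) *ˢ poch 1 1 n) (trans (ℕₚ.*-suc P J) (ℕₚ.+-comm P _)) ⟩
      (unkept J *ˢ c) *ˢ poch 1 1 (P ℕ.* J ℕ.+ P)
        ≈⟨ *ˢ-cong (≈-refl {unkept J *ˢ c}) (poch-split 1 1 (P ℕ.* J) P) ⟩
      (unkept J *ˢ c) *ˢ (poch 1 1 (P ℕ.* J) *ˢ q)
        ≈⟨ solve 4 (λ a b c d → (a :* b) :* (c :* d) := (a :* c) :* (b :* d)) (λ _ → refl) (unkept J) c (poch 1 1 (P ℕ.* J)) q ⟩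
      (unkept J *ˢ poch 1 1 (P ℕ.* J)) *ˢ (c *ˢ q)
        ≈⟨ *ˢ-cong (unkept-*-poch J) (complement-*-∏ k (exponent J) (0<exponent J) P) ⟩
      kept J *ˢ ∏ P (λ r → selected (k r) (exponent J r)) ∎
      where
      open SetoidReasoning seriesSetoid
      open SeriesSolver using (solve; _:=_; _:*_)
      c = complement k (exponent J) P
      q = poch 1 (1 ℕ.* (P ℕ.* J) ℕ.+ 1) P

    exponent-suc : ∀ j {s} → 0 ℕ.< s → exponent j (ℕ.pred s) ≡ P ℕ.* j ℕ.+ s
    exponent-suc j {suc s} _ = lem (P ℕ.* j) s
      where
      lem : ∀ a s → 1 ℕ.* s ℕ.+ (1 ℕ.* a ℕ.+ 1) ≡ a ℕ.+ suc s
      lem = ℕSolver.solve-∀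

  -- The multiples of `s` sorted by residue modulo `3s`.
  poch-trisect : ∀ s J → let Q = 2 ℕ.* s ℕ.+ s in
    poch Q Q J *ˢ (poch Q s J *ˢ poch Q (2 ℕ.* s) J) ≈ poch s s (J ℕ.* 3)
  poch-trisect s zero    = ≈-trans (*ˢ-identityˡ (one *ˢ one)) (*ˢ-identityˡ one)
  poch-trisect s (suc J) = begin
    (A *ˢ a) *ˢ ((B *ˢ b) *ˢ (C *ˢ c))
      ≈⟨ solve 6 (λ A B C a b c → (A :* a) :* ((B :* b) :* (C :* c)) := (((A :* (B :* C)) :* b) :* c) :* a) (λ _ → refl) A B C a b c ⟩
    (((A *ˢ (B *ˢ C)) *ˢ b) *ˢ c) *ˢ a
      ≈⟨ *ˢ-cong (*ˢ-cong (*ˢ-cong (poch-trisect s J) (1-x^-cong (l₁ s J))) (1-x^-cong (l₂ s J))) (1-x^-cong (l₃ s J)) ⟩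
    poch s s (suc J ℕ.* 3) ∎
    where
    open SetoidReasoning seriesSetoid
    open SeriesSolver using (solve; _:=_; _:*_)
    Q = 2 ℕ.* s ℕ.+ s
    A = poch Q Q J
    B = poch Q s J
    C = poch Q (2 ℕ.* s) J
    a = 1-x^ (Q ℕ.* J ℕ.+ Q)
    b = 1-x^ (Q ℕ.* J ℕ.+ s)
    c = 1-x^ (Q ℕ.* J ℕ.+ 2 ℕ.* s)
    l₁ : ∀ s J → (2 ℕ.* s ℕ.+ s) ℕ.* J ℕ.+ s ≡ s ℕ.* (J ℕ.* 3) ℕ.+ s
    l₁ = ℕSolver.solve-∀
    l₂ : ∀ s J → (2 ℕ.* s ℕ.+ s) ℕ.* J ℕ.+ 2 ℕ.* s ≡ s ℕ.* suc (J ℕ.* 3) ℕ.+ s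
    l₂ = ℕSolver.solve-∀
    l₃ : ∀ s J → (2 ℕ.* s ℕ.+ s) ℕ.* J ℕ.+ (2 ℕ.* s ℕ.+ s) ≡ s ℕ.* suc (suc (J ℕ.* 3)) ℕ.+ s
    l₃ = ℕSolver.solve-∀

  module Pentagonal (s : ℕ) (0<s : 0 ℕ.< s) where
    private
      0<2s : 0 ℕ.< 2 ℕ.* s
      0<2s = ℕₚ.<-≤-trans 0<s (ℕₚ.m≤m+n s _)

      reduce : ∀ J → poch s s (J ℕ.* 3) ≈[ J ] poch s s J
      reduce J m m<J = poch-mod-≤ s J (ℕₚ.m≤m*n J 3) m (ℕₚ.<-≤-trans m<J (ℕₚ.≤-trans (ℕₚ.m≤n*m J s ⦃ ℕ.>-nonZero 0<s ⦄) (ℕₚ.m≤m+n (s ℕ.* J) s)))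

    -- The triple product in base `x^(3s)`, whose three factors recombine by `poch-trisect`. The two
    -- orders of the parameters give the exponents `s k(3k+1)/2` and `s k(3k-1)/2`; the residue of
    -- `p` modulo 3 decides which one is centred at an integer.
    pentagonal⁺ : ∀ J → Θ (jacobi (2 ℕ.* s) s) ≈[ J ] poch s s J
    pentagonal⁺ J m m<J = trans (sym (JacobiTripleProduct.jacobi-triple-product (2 ℕ.* s) s 0<2s 0<s J m m<J))
      (trans (poch-trisect s J m) (reduce J m m<J))

    pentagonal⁻ : ∀ J → Θ (jacobi s (2 ℕ.* s)) ≈[ J ] poch s s J
    pentagonal⁻ J m m<J = trans (sym (JacobiTripleProduct.jacobi-triple-product s (2 ℕ.* s) 0<s 0<2s J m m<J))
      (trans (cong (λ Q → (poch Q Q J *ˢ (poch Q (2 ℕ.* s) J *ˢ poch Q s J)) m) (ℕₚ.+-comm s (2 ℕ.* s)))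
        (trans (*ˢ-cong (≈-refl {poch Q Q J}) (*ˢ-comm (poch Q (2 ℕ.* s) J) (poch Q s J)) m)
          (trans (poch-trisect s J m) (reduce J m m<J))))
      where
      Q = 2 ℕ.* s ℕ.+ s

  poch-1-reduce : ∀ {M n} → M ℕ.≤ n → ∀ f → (f *ˢ poch 1 1 n) *ˢ invPoch 1 1 M ≈[ suc M ] f
  poch-1-reduce {M} {n} M≤n f m m<D = begin
    ((f *ˢ poch 1 1 n) *ˢ I) m   ≡⟨ *ˢ-assoc f (poch 1 1 n) I m ⟩
    (f *ˢ (poch 1 1 n *ˢ I)) m   ≡⟨ *ˢ-cong-mod {f = f} (λ _ _ → refl) (*ˢ-cong-mod {g = I} poch≈ (λ _ _ → refl)) m m<D ⟩
    (f *ˢ (poch 1 1 M *ˢ I)) m   ≡⟨ *ˢ-cong (≈-refl {f}) (poch-invPoch 1 ℕₚ.≤-refl M) m ⟩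
    (f *ˢ one) m                 ≡⟨ *ˢ-identityʳ f m ⟩
    f m                          ∎
    where
    open ≡-Reasoning
    I = invPoch 1 1 M
    poch≈ : poch 1 1 n ≈[ suc M ] poch 1 1 M
    poch≈ m m<D = poch-mod-≤ 1 M M≤n m (ℕₚ.<-≤-trans m<D (ℕₚ.≤-reflexive (lem M)))
      where
      lem : ∀ M → suc M ≡ 1 ℕ.* M ℕ.+ 1
      lem = ℕSolver.solve-∀

  pred-< : ∀ {m n} → 0 ℕ.< m → m ℕ.≤ n → ℕ.pred m ℕ.< n
  pred-< {suc m} _ m≤n = m≤n

  pred-≢ : ∀ {m n} → 0 ℕ.< m → 0 ℕ.< n → m ≢ n → ℕ.pred m ≢ ℕ.pred n
  pred-≢ {suc m} {suc n} _ _ m≢n p = m≢n (cong suc p)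

  0≢pred : ∀ {m} → 1 ℕ.< m → 0 ≢ ℕ.pred m
  0≢pred {suc (suc m)} _ ()
  0≢pred {suc zero} (ℕ.s≤s ())

  -- Marking the residue of the multiples of `P` cancels `(x^P; x^P)` against part of `(x; x)`;
  -- since `P > 1`, the factor `1 - x` stays unmarked.
  poch-quotient-positive : ∀ P → 1 ℕ.< P → ∀ M T → T ≈[ suc M ] poch P P (suc M) →
    ∀ ν → ν ℕ.≤ M → 0ℤ ℤ.< (T *ˢ invPoch 1 1 M) ν
  poch-quotient-positive P 1<P M T T≈ ν ν≤M = subst (0ℤ ℤ.<_) (sym eq) (unkept-positive 0<P k₀ M ν)
    where
    0<P : 0 ℕ.< P
    0<P = ℕₚ.<-trans ℕₚ.≤-refl 1<P
    k : ℕ → Bool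
    k r = (r ≡ᵇ ℕ.pred P) ∨ false
    open Blocks P k
    k₀ : k 0 ≡ false
    k₀ = cong (_∨ false) (≡ᵇ-false (0≢pred 1<P))
    kept≈ : kept (suc M) ≈ poch P P (suc M)
    kept≈ = ∏-cong (suc M) (λ j → ≈-trans (∏-select P (ℕ.pred P) (λ _ → false) (exponent j) refl (pred-< 0<P ℕₚ.≤-refl))
      (≈-trans (*ˢ-cong (≈-refl {1-x^ exponent j (ℕ.pred P)}) (∏-one P)) (≈-trans (*ˢ-identityʳ _) (1-x^-cong (exponent-suc j 0<P)))))
    eq : (T *ˢ invPoch 1 1 M) ν ≡ unkept (suc M) ν
    eq = trans (*ˢ-cong-mod {g = invPoch 1 1 M} (λ m l → trans (T≈ m l) (sym (trans (unkept-*-poch (suc M) m) (kept≈ m)))) (λ _ _ → refl) ν (ℕ.s≤s ν≤M))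
      (poch-1-reduce (ℕₚ.≤-trans (ℕₚ.n≤1+n M) (ℕₚ.m≤n*m (suc M) P ⦃ ℕ.>-nonZero 0<P ⦄)) (unkept (suc M)) ν (ℕ.s≤s ν≤M))

  module QuintupleQuotient (B D : ℕ) (0<B : 0 ℕ.< B) (1<D : 1 ℕ.< D) (2B≢D : B ℕ.+ B ≢ D) where
    private
      0<D : 0 ℕ.< D
      0<D = ℕₚ.<-trans ℕₚ.≤-refl 1<D
    open Identity B D 0<B 0<D
    private
      C = B ℕ.+ D
      0<C : 0 ℕ.< C
      0<C = ℕₚ.<-≤-trans 0<D (ℕₚ.m≤n+m D B)
      1<2B : 1 ℕ.< B ℕ.+ B
      1<2B = ℕₚ.+-mono-≤ 0<B 0<B
      0<2B : 0 ℕ.< B ℕ.+ B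
      0<2B = ℕₚ.<-trans ℕₚ.≤-refl 1<2B
      P≢D : P ≢ D
      P≢D eq = ℕₚ.<⇒≢ (ℕₚ.m<n+m D 0<2B) (sym eq)
      P≢2B : P ≢ B ℕ.+ B
      P≢2B eq = ℕₚ.<⇒≢ (ℕₚ.m<m+n (B ℕ.+ B) 0<D) (sym eq)
      -- Marks for the exponents congruent to `2B`, `D` and 0 modulo `P`. The hypotheses `1<D` and
      -- `2B≢D` ensure that exponent 1 is unmarked and the three marks differ.
      k₁ k₂ k₃ : ℕ → Bool
      k₁ r = (r ≡ᵇ ℕ.pred (B ℕ.+ B)) ∨ false
      k₂ r = (r ≡ᵇ ℕ.pred D) ∨ k₁ r
      k₃ r = (r ≡ᵇ ℕ.pred P) ∨ k₂ r
      open Blocks P k₃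
      k₁-false : ∀ {r} → r ≢ ℕ.pred (B ℕ.+ B) → k₁ r ≡ false
      k₁-false n = cong (_∨ false) (≡ᵇ-false n)
      k₂-false : ∀ {r} → r ≢ ℕ.pred D → r ≢ ℕ.pred (B ℕ.+ B) → k₂ r ≡ false
      k₂-false m n = cong₂ _∨_ (≡ᵇ-false m) (k₁-false n)
      k₃-0 : k₃ 0 ≡ false
      k₃-0 = cong₂ _∨_ (≡ᵇ-false (0≢pred (ℕₚ.<-≤-trans 1<D (ℕₚ.m≤n+m D (B ℕ.+ B))))) (k₂-false (0≢pred 1<D) (0≢pred 1<2B))

      V : ℕ → Series
      V J = poch P P J *ˢ (poch P D J *ˢ poch P (B ℕ.+ B) J)

      kept≈ : ∀ J → kept J ≈ V J
      kept≈ J = ≈-trans (∏-cong J block) (≈-trans (∏-*ˢ J _ _) (*ˢ-cong (≈-refl {poch P P J}) (∏-*ˢ J _ _)))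
        where
        block : ∀ j → ∏ P (λ r → selected (k₃ r) (exponent j r)) ≈
                      1-x^ (P ℕ.* j ℕ.+ P) *ˢ (1-x^ (P ℕ.* j ℕ.+ D) *ˢ 1-x^ (P ℕ.* j ℕ.+ (B ℕ.+ B)))
        block j = ≈-trans (∏-select P (ℕ.pred P) k₂ (exponent j) (k₂-false (pred-≢ 0<P 0<D P≢D) (pred-≢ 0<P 0<2B P≢2B)) (pred-< 0<P ℕₚ.≤-refl))
          (*ˢ-cong (1-x^-cong (exponent-suc j 0<P))
            (≈-trans (∏-select P (ℕ.pred D) k₁ (exponent j) (k₁-false (pred-≢ 0<D 0<2B (λ e → 2B≢D (sym e)))) (pred-< 0<D (ℕₚ.m≤n+m D (B ℕ.+ B))))
              (*ˢ-cong (1-x^-cong (exponent-suc j 0<D))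
                (≈-trans (∏-select P (ℕ.pred (B ℕ.+ B)) (λ _ → false) (exponent j) refl (pred-< 0<2B (ℕₚ.m≤m+n (B ℕ.+ B) D)))
                  (≈-trans (*ˢ-cong (1-x^-cong (exponent-suc j 0<2B)) (∏-one P)) (*ˢ-identityʳ _))))))

      S : Series
      S = Θ e₁ +ˢ Θ e₂

      U : ℕ → Series
      U J = poch P C J *ˢ poch P B J

      U₀ : ∀ J → U J 0 ≡ 1ℤ
      U₀ J = cong₂ _*_ (poch-0 P C J 0<C) (poch-0 P B J 0<B)

      θ₁≈ : ∀ J → poch P P J *ˢ U J ≈[ J ] Θ θ₁
      θ₁≈ J m m<J = trans (cong (λ Q → (poch Q Q J *ˢ (poch Q C J *ˢ poch Q B J)) m) (ℕₚ.+-assoc B B D))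
        (JacobiTripleProduct.jacobi-triple-product B C 0<B 0<C J m m<J)

      -- The product form of the quintuple identity. After multiplication by `poch P P J` each theta
      -- series in `quintuple` is a product up to degree `J`, and one copy of `poch P P J` cancels.
      SU≈V : ∀ J → S *ˢ U J ≈[ J ] V J
      SU≈V J = *ˢ-cancelˡ-mod (poch P P J) (S *ˢ U J) (V J) (poch-0 P P J 0<P) (λ m m<J → begin
        (poch P P J *ˢ (S *ˢ U J)) m     ≡⟨ solve 3 (λ a b c → a :* (b :* c) := b :* (a :* c)) (λ _ → refl) (poch P P J) S (U J) m ⟩
        (S *ˢ (poch P P J *ˢ U J)) m     ≡⟨ *ˢ-cong-mod {f = S} (λ _ _ → refl) (θ₁≈ J) m m<J ⟩
        (S *ˢ Θ θ₁) m                    ≡⟨ quintuple m ⟩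
        (Θ pent *ˢ Θ θ₂) m               ≡⟨ *ˢ-cong-mod (Pentagonal.pentagonal⁺ P 0<P J) (λ n n<J → sym (JacobiTripleProduct.jacobi-triple-product (B ℕ.+ B) D 0<2B 0<D J n n<J)) m m<J ⟩
        (poch P P J *ˢ V J) m            ∎)
        where
        open ≡-Reasoning
        open SeriesSolver using (solve; _:=_; _:*_)

    -- The numerator `V` cancels against `(x; x)` and leaves the positive series `unkept`; the
    -- denominator `U` only contributes its reciprocal `W`, a product of geometric series and hence
    -- `Good`.
    quintuple-quotient-positive : ∀ M ν → ν ℕ.≤ M → 0ℤ ℤ.< ((Θ e₁ +ˢ Θ e₂) *ˢ invPoch 1 1 M) ν
    quintuple-quotient-positive M ν ν≤M = subst (0ℤ ℤ.<_) (sym (eq ν (ℕ.s≤s ν≤M)))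
      (*ˢ-positive (unkept-positive 0<P k₃-0 M) (*ˢ-good (invPoch-good P 0<C J) (invPoch-good P 0<B J)) ν)
      where
      open ≡-Reasoning
      open SeriesSolver using (solve; _:=_; _:*_)
      J = suc M
      I = invPoch 1 1 M
      W = invPoch P C J *ˢ invPoch P B J
      R = unkept J
      UW≈1 : U J *ˢ W ≈ one
      UW≈1 = ≈-trans (solve 4 (λ a b c d → (a :* b) :* (c :* d) := (a :* c) :* (b :* d)) (λ _ → refl) (poch P C J) (poch P B J) (invPoch P C J) (invPoch P B J))
        (≈-trans (*ˢ-cong (poch-invPoch P 0<C J) (poch-invPoch P 0<B J)) (*ˢ-identityˡ one))
      eq : S *ˢ I ≈[ J ] R *ˢ W
      eq = *ˢ-cancelˡ-mod (U J) (S *ˢ I) (R *ˢ W) (U₀ J) (λ m m<J → begin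
        (U J *ˢ (S *ˢ I)) m                   ≡⟨ solve 3 (λ a b c → a :* (b :* c) := (b :* a) :* c) (λ _ → refl) (U J) S I m ⟩
        ((S *ˢ U J) *ˢ I) m                   ≡⟨ *ˢ-cong-mod {g = I} (SU≈V J) (λ _ _ → refl) m m<J ⟩
        (V J *ˢ I) m                          ≡⟨ *ˢ-cong {g = I} (≈-sym (≈-trans (unkept-*-poch J) (kept≈ J))) ≈-refl m ⟩
        ((R *ˢ poch 1 1 (P ℕ.* J)) *ˢ I) m    ≡⟨ poch-1-reduce (ℕₚ.≤-trans (ℕₚ.n≤1+n M) (ℕₚ.m≤n*m J P ⦃ ℕ.>-nonZero 0<P ⦄)) R m m<J ⟩
        R m                                   ≡⟨ sym (*ˢ-identityʳ R m) ⟩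
        (R *ˢ one) m                          ≡⟨ *ˢ-cong (≈-refl {R}) (≈-sym UW≈1) m ⟩
        (R *ˢ (U J *ˢ W)) m                   ≡⟨ solve 3 (λ a b c → a :* (b :* c) := b :* (a :* c)) (λ _ → refl) R (U J) W m ⟩
        (U J *ˢ (R *ˢ W)) m                   ∎)

-- The bound `N` and the values of `L` as pentagonal numbers.

module LeastExponents where
  open PowerSeries
  open import Data.Integer using (_+_; _-_; _*_; -_)
  open Signed using (_∣_; divides; ∣ᵤ⇒∣; ∣⇒∣ᵤ; ∣m∣n⇒∣m+n; ∣m∣n⇒∣m-n; ∣m⇒∣-m; ∣n⇒∣m*n; ∣m⇒∣m*n)

  catMaybes-∈ : ∀ {v : ℤ} xs → just v ∈ xs → v ∈ catMaybes xs
  catMaybes-∈ (just x ∷ xs)  (here refl) = here refl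
  catMaybes-∈ (just x ∷ xs)  (there v∈)  = there (catMaybes-∈ xs v∈)
  catMaybes-∈ (nothing ∷ xs) (there v∈)  = catMaybes-∈ xs v∈

  minimum-∈ : ∀ {v} xs → v ∈ xs → Σ ℤ λ m → minimumℤ xs ≡ just m × m ∈ xs
  minimum-∈ (x ∷ xs) _ with foldr-selective ℤₚ.⊓-sel x xs
  ... | inj₁ eq = _ , refl , here eq
  ... | inj₂ m∈ = _ , refl , there m∈

  maximum-≥ : ∀ {v} xs → v ∈ xs → Σ ℤ λ m → maximumℤ xs ≡ just m × v ℤ.≤ m
  maximum-≥ (x ∷ xs) v∈ = _ , refl , go xs v∈
    where
    go : ∀ {v} ys → v ∈ x ∷ ys → v ℤ.≤ foldr _⊔_ x ys
    go []       (here refl)         = ℤₚ.≤-refl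
    go (y ∷ ys) (here refl)         = ℤₚ.≤-trans (go ys (here refl)) (ℤₚ.i≤j⊔i y _)
    go (y ∷ ys) (there (here refl)) = ℤₚ.i≤i⊔j y _
    go (y ∷ ys) (there (there v∈))  = ℤₚ.≤-trans (go ys (there v∈)) (ℤₚ.i≤j⊔i y _)

  N-lower : ∀ {p i v} → v ∈ minsByResidue p i → v - + p ℤ.≤ N p i
  N-lower {p} {i} v∈ with maximumℤ (minsByResidue p i) | maximum-≥ (minsByResidue p i) v∈
  ... | just m | .m , refl , v≤m = ℤₚ.+-monoˡ-≤ (- (+ p)) v≤m

  private
    -- Congruent numbers differ by a multiple of `p`, so `m < n + p` already forces `m ≤ n`. This
    -- explains the subtraction of `p` in `N`.
    ≤-of-class : ∀ {p n m} → + p ∣ + n - m → m - + p ℤ.< + n → m ℤ.≤ + n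
    ≤-of-class {p} {n} {m} (divides (+ a) eq) _ = ℤₚ.0≤i-j⇒j≤i (subst (0ℤ ℤ.≤_) (trans (ℤₚ.pos-* a p) (sym eq)) (ℤ.+≤+ ℕ.z≤n))
    ≤-of-class {p} {n} {m} (divides -[1+ a ] eq) m-p<n = ⊥-elim (ℤₚ.<⇒≱ m-p<n (ℤₚ.0≤i-j⇒j≤i (subst (0ℤ ℤ.≤_) (sym eq′) (ℤ.+≤+ ℕ.z≤n))))
      where
      open import Data.Empty using (⊥-elim)
      lem₁ : ∀ m p n → m - p - n ≡ - (n - m) - p
      lem₁ = solve-∀
      lem₂ : ∀ a p → - ((- (1ℤ + a)) * p) - p ≡ a * p
      lem₂ = solve-∀
      eq′ : m - + p - + n ≡ + (a ℕ.* p)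
      eq′ = trans (lem₁ m (+ p) (+ n)) (trans (cong (λ z → - z - + p) eq) (trans (lem₂ (+ a) (+ p)) (sym (ℤₚ.pos-* a p))))

  -- The class of `n` is nonempty, so its minimum is one of the values over which `N` takes the
  -- maximum. The index `r′` attaining the minimum may differ from `r`.
  N-witness : ∀ {p i n} → 0 ℕ.< p → N p i ℤ.< + n → ∀ r → r ℕ.< p → + p ∣ + n - + i * L p r →
              Σ ℕ λ r′ → (+ p ∣ + n - + i * L p r′) × (+ i * L p r′ ℤ.≤ + n)
  N-witness {p@(suc _)} {i} {n} _ N<n r r<p d = r′ , d′ , ≤-of-class d′ (ℤₚ.≤-<-trans (subst (λ v → v - + p ℤ.≤ N p i) m≡ (N-lower {p} {i} m∈mins)) N<n)
    where
    s = n ℕDM.% p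
    class? = λ v → v ≡? + s [mod p ]
    n-s : + p ∣ + n - + s
    n-s = divides (+ (n ℕDM./ p)) (trans (cong (λ z → + z - + s) (ℕDM.m≡m%n+[m/n]*n n p))
      (trans (cong (λ z → z - + s) (trans (ℤₚ.pos-+ s _) (+-congˡ (+ s) (ℤₚ.pos-* (n ℕDM./ p) p)))) (lem (+ s) (+ (n ℕDM./ p) * + p))))
      where
      lem : ∀ s a → s + a - s ≡ a
      lem = solve-∀
    lem₁ : ∀ n s v → n - s - (n - v) ≡ v - s
    lem₁ = solve-∀
    lem₂ : ∀ n s v → n - s - (v - s) ≡ n - v
    lem₂ = solve-∀
    r∈ : r ∈ upTo p
    r∈ = ∈-upTo⁺ r<p
    start : + i * L p r ∈ filter class? (iLvals p i)
    start = ∈-filter⁺ class? (∈-map⁺ (λ r → + i * L p r) {x = r} r∈)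
      (∣⇒∣ᵤ (subst (+ p ∣_) (lem₁ (+ n) (+ s) (+ i * L p r)) (∣m∣n⇒∣m-n n-s d)))
    least = minimum-∈ (filter class? (iLvals p i)) start
    m = proj₁ least
    m∈mins : m ∈ minsByResidue p i
    m∈mins = catMaybes-∈ _ (subst (_∈ map (λ s → minimumℤ (filter (λ v → v ≡? + s [mod p ]) (iLvals p i))) (upTo p)) (proj₁ (proj₂ least))
      (∈-map⁺ (λ s → minimumℤ (filter (λ v → v ≡? + s [mod p ]) (iLvals p i))) (∈-upTo⁺ (ℕDM.m%n<n n p))))
    m∈ = ∈-filter⁻ class? {xs = iLvals p i} (proj₂ (proj₂ least))
    preimage = ∈-map⁻ (λ r → + i * L p r) {xs = upTo p} (proj₁ m∈)
    r′ = proj₁ preimage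
    m≡ : m ≡ + i * L p r′
    m≡ = proj₂ (proj₂ preimage)
    d′ : + p ∣ + n - + i * L p r′
    d′ = subst (+ p ∣_) (trans (lem₂ (+ n) (+ s) m) (cong (λ z → + n - z) m≡)) (∣m∣n⇒∣m-n n-s (∣ᵤ⇒∣ (proj₂ m∈)))

  +base : ∀ r → + (6 ℕ.* r ℕ.* r ℕ.+ r) ≡ + 6 * + r * + r + + r
  +base r = trans (ℤₚ.pos-+ (6 ℕ.* r ℕ.* r) r) (cong (λ z → z + + r) (trans (ℤₚ.pos-* (6 ℕ.* r) r) (cong (λ z → z * + r) (ℤₚ.pos-* 6 r))))

  private
    +cpr : ∀ c p r → + (c ℕ.* p ℕ.* r) ≡ + c * + p * + r
    +cpr c p r = trans (ℤₚ.pos-* (c ℕ.* p) r) (cong (λ z → z * + r) (ℤₚ.pos-* c p))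

    +6pp-p : ∀ p → + (6 ℕ.* p ℕ.* p ∸ p) ≡ + 6 * + p * + p - + p
    +6pp-p zero      = refl
    +6pp-p p@(suc _) = trans (sym (ℤₚ.⊖-≥ (ℕₚ.m≤n*m p (6 ℕ.* p)))) (trans (sym (ℤₚ.m-n≡m⊖n (6 ℕ.* p ℕ.* p) p)) (cong (λ z → z - + p) (+cpr 6 p p)))

    third : ∀ {a b} c → a ≡ b ℕ.+ c ℕ.* 3 → (a ∸ b) ℕDM./ 3 ≡ c
    third {b = b} c refl = trans (cong (ℕDM._/ 3) (ℕₚ.m+n∸m≡n b (c ℕ.* 3))) (ℕDM.m*n/n≡m c 3)

  -- What the argument uses about `L`: `i · ℓ` is an exponent of the theta series, at index `k`, and
  -- `ℓ` lies in the class of `6r² + r`.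
  Exponent : (p : ℕ) (η : ℤ) (r : ℕ) (ℓ : ℤ) → Set
  Exponent p η r ℓ = (Σ ℤ λ k → + 2 * ℓ ≡ + 3 * k * k + η * k) × (Σ ℤ λ a → ℓ ≡ + (6 ℕ.* r ℕ.* r ℕ.+ r) + a * + p)

  -- In the centred index `x = k + l`, the three ranges use `x = l - 2r`, then `-(l - 2r + p)`, then
  -- `l - 2r + 2p`. Steps of `p` and the change of sign of `x` both preserve the class modulo `p`.
  L-exponent₁ : ∀ {p l} → p ≡ 6 ℕ.* l ℕ.+ 1 → p ℕDM.% 3 ≡ 1 → ∀ r → Exponent p (- 1ℤ) r (L p r)
  L-exponent₁ {p} {l} p≡ p%3 r rewrite p%3 with 12 ℕ.* r ℕ.+ 1 ≤ᵇ 4 ℕ.* p | 12 ℕ.* r ℕ.+ 1 ≤ᵇ 10 ℕ.* p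
  ... | true  | _ = (- (+ 2 * + r) , trans (cong (+ 2 *_) (+base r)) (lem (+ r))) , 0ℤ , sym (ℤₚ.+-identityʳ _)
    where
    lem : ∀ r → + 2 * (+ 6 * r * r + r) ≡ + 3 * (- (+ 2 * r)) * (- (+ 2 * r)) + (- 1ℤ) * (- (+ 2 * r))
    lem = solve-∀
  ... | false | true  = (+ 2 * + r - + 8 * + l - 1ℤ , trans (cong (+ 2 *_) value) (lem₁ (+ l) (+ r)))
      , - (+ 8 * + r) + + 2 * (+ 8 * + l + 1ℤ) , trans value (trans (lem₂ (+ l) (+ r)) (cong₂ (λ u v → u + (- (+ 8 * + r) + + 2 * (+ 8 * + l + 1ℤ)) * v) (sym (+base r)) (sym q≡)))
    where
    q≡ : + p ≡ + 6 * + l + 1ℤ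
    q≡ = trans (cong +_ p≡) (trans (ℤₚ.pos-+ (6 ℕ.* l) 1) (cong (λ z → z + 1ℤ) (ℤₚ.pos-* 6 l)))
    -- The division by 3 is exact: `8p² - 2p = 2p(4p - 1)` and `4p - 1 = 3(8l + 1)`.
    8pp : ∀ l → let p = 6 ℕ.* l ℕ.+ 1 in 8 ℕ.* p ℕ.* p ≡ 2 ℕ.* p ℕ.+ 2 ℕ.* (p ℕ.* (8 ℕ.* l ℕ.+ 1)) ℕ.* 3
    8pp = ℕSolver.solve-∀
    const≡ : + ((8 ℕ.* p ℕ.* p ∸ 2 ℕ.* p) ℕDM./ 3) ≡ + 2 * ((+ 6 * + l + 1ℤ) * (+ 8 * + l + 1ℤ))
    const≡ = trans (cong +_ (third (2 ℕ.* (p ℕ.* (8 ℕ.* l ℕ.+ 1))) (subst (λ p → 8 ℕ.* p ℕ.* p ≡ 2 ℕ.* p ℕ.+ 2 ℕ.* (p ℕ.* (8 ℕ.* l ℕ.+ 1)) ℕ.* 3) (sym p≡) (8pp l))))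
      (trans (ℤₚ.pos-* 2 (p ℕ.* (8 ℕ.* l ℕ.+ 1))) (cong (+ 2 *_) (trans (ℤₚ.pos-* p (8 ℕ.* l ℕ.+ 1)) (cong₂ _*_ q≡ (trans (ℤₚ.pos-+ (8 ℕ.* l) 1) (cong (λ z → z + 1ℤ) (ℤₚ.pos-* 8 l)))))))
    value : + (6 ℕ.* r ℕ.* r ℕ.+ r) - + (8 ℕ.* p ℕ.* r) + + ((8 ℕ.* p ℕ.* p ∸ 2 ℕ.* p) ℕDM./ 3) ≡
            + 6 * + r * + r + + r - + 8 * (+ 6 * + l + 1ℤ) * + r + + 2 * ((+ 6 * + l + 1ℤ) * (+ 8 * + l + 1ℤ))
    value = cong₂ _+_ (cong₂ _-_ (+base r) (trans (+cpr 8 p r) (cong (λ z → + 8 * z * + r) q≡))) const≡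
    lem₁ : ∀ l r → let k = + 2 * r - + 8 * l - 1ℤ in
      + 2 * (+ 6 * r * r + r - + 8 * (+ 6 * l + 1ℤ) * r + + 2 * ((+ 6 * l + 1ℤ) * (+ 8 * l + 1ℤ))) ≡ + 3 * k * k + (- 1ℤ) * k
    lem₁ = solve-∀
    lem₂ : ∀ l r → + 6 * r * r + r - + 8 * (+ 6 * l + 1ℤ) * r + + 2 * ((+ 6 * l + 1ℤ) * (+ 8 * l + 1ℤ)) ≡
      + 6 * r * r + r + (- (+ 8 * r) + + 2 * (+ 8 * l + 1ℤ)) * (+ 6 * l + 1ℤ)
    lem₂ = solve-∀
  ... | false | false = (+ 2 * + p - + 2 * + r , trans (cong (+ 2 *_) value) (lem₁ (+ p) (+ r)))
      , - (+ 12 * + r) + + 6 * + p - 1ℤ , trans value (trans (lem₂ (+ p) (+ r)) (cong (λ u → u + (- (+ 12 * + r) + + 6 * + p - 1ℤ) * + p) (sym (+base r))))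
    where
    value : + (6 ℕ.* r ℕ.* r ℕ.+ r) - + (12 ℕ.* p ℕ.* r) + + (6 ℕ.* p ℕ.* p ∸ p) ≡ + 6 * + r * + r + + r - + 12 * + p * + r + (+ 6 * + p * + p - + p)
    value = cong₂ _+_ (cong₂ _-_ (+base r) (+cpr 12 p r)) (+6pp-p p)
    lem₁ : ∀ p r → + 2 * (+ 6 * r * r + r - + 12 * p * r + (+ 6 * p * p - p)) ≡ + 3 * (+ 2 * p - + 2 * r) * (+ 2 * p - + 2 * r) + (- 1ℤ) * (+ 2 * p - + 2 * r)
    lem₁ = solve-∀
    lem₂ : ∀ p r → + 6 * r * r + r - + 12 * p * r + (+ 6 * p * p - p) ≡ + 6 * r * r + r + (- (+ 12 * r) + + 6 * p - 1ℤ) * p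
    lem₂ = solve-∀

  -- Here the centred index is `x = k + l + 1`, and the ranges use `x = l + 1 + 2r`, then
  -- `-(l + 1 + 2r - p)`, then `l + 1 + 2r - 2p`.
  L-exponent₂ : ∀ {p l} → p ≡ 6 ℕ.* l ℕ.+ 5 → p ℕDM.% 3 ≡ 2 → ∀ r → Exponent p 1ℤ r (L p r)
  L-exponent₂ {p} {l} p≡ p%3 r rewrite p%3 with 12 ℕ.* r ℕ.+ 1 ≤ᵇ 2 ℕ.* p | 12 ℕ.* r ℕ.+ 1 ≤ᵇ 8 ℕ.* p
  ... | true  | _ = (+ 2 * + r , trans (cong (+ 2 *_) (+base r)) (lem (+ r))) , 0ℤ , sym (ℤₚ.+-identityʳ _)
    where
    lem : ∀ r → + 2 * (+ 6 * r * r + r) ≡ + 3 * (+ 2 * r) * (+ 2 * r) + 1ℤ * (+ 2 * r)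
    lem = solve-∀
  ... | false | true  = (+ 4 * + l + + 3 - + 2 * + r , trans (cong (+ 2 *_) value) (lem₁ (+ l) (+ r)))
      , - (+ 4 * + r) + (+ 4 * + l + + 3) , trans value (trans (lem₂ (+ l) (+ r)) (cong₂ (λ u v → u + (- (+ 4 * + r) + (+ 4 * + l + + 3)) * v) (sym (+base r)) (sym q≡)))
    where
    q≡ : + p ≡ + 6 * + l + + 5
    q≡ = trans (cong +_ p≡) (trans (ℤₚ.pos-+ (6 ℕ.* l) 5) (cong (λ z → z + + 5) (ℤₚ.pos-* 6 l)))
    -- Exact again: `2p² - p = p(2p - 1)` and `2p - 1 = 3(4l + 3)`.
    2pp : ∀ l → let p = 6 ℕ.* l ℕ.+ 5 in 2 ℕ.* p ℕ.* p ≡ p ℕ.+ p ℕ.* (4 ℕ.* l ℕ.+ 3) ℕ.* 3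
    2pp = ℕSolver.solve-∀
    const≡ : + ((2 ℕ.* p ℕ.* p ∸ p) ℕDM./ 3) ≡ (+ 6 * + l + + 5) * (+ 4 * + l + + 3)
    const≡ = trans (cong +_ (third (p ℕ.* (4 ℕ.* l ℕ.+ 3)) (subst (λ p → 2 ℕ.* p ℕ.* p ≡ p ℕ.+ p ℕ.* (4 ℕ.* l ℕ.+ 3) ℕ.* 3) (sym p≡) (2pp l))))
      (trans (ℤₚ.pos-* p (4 ℕ.* l ℕ.+ 3)) (cong₂ _*_ q≡ (trans (ℤₚ.pos-+ (4 ℕ.* l) 3) (cong (λ z → z + + 3) (ℤₚ.pos-* 4 l)))))
    value : + (6 ℕ.* r ℕ.* r ℕ.+ r) - + (4 ℕ.* p ℕ.* r) + + ((2 ℕ.* p ℕ.* p ∸ p) ℕDM./ 3) ≡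
            + 6 * + r * + r + + r - + 4 * (+ 6 * + l + + 5) * + r + (+ 6 * + l + + 5) * (+ 4 * + l + + 3)
    value = cong₂ _+_ (cong₂ _-_ (+base r) (trans (+cpr 4 p r) (cong (λ z → + 4 * z * + r) q≡))) const≡
    lem₁ : ∀ l r → let k = + 4 * l + + 3 - + 2 * r in
      + 2 * (+ 6 * r * r + r - + 4 * (+ 6 * l + + 5) * r + (+ 6 * l + + 5) * (+ 4 * l + + 3)) ≡ + 3 * k * k + 1ℤ * k
    lem₁ = solve-∀
    lem₂ : ∀ l r → + 6 * r * r + r - + 4 * (+ 6 * l + + 5) * r + (+ 6 * l + + 5) * (+ 4 * l + + 3) ≡
      + 6 * r * r + r + (- (+ 4 * r) + (+ 4 * l + + 3)) * (+ 6 * l + + 5)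
    lem₂ = solve-∀
  ... | false | false = (+ 2 * + r - + 2 * + p , trans (cong (+ 2 *_) value) (lem₁ (+ p) (+ r)))
      , - (+ 12 * + r) + + 6 * + p - 1ℤ , trans value (trans (lem₂ (+ p) (+ r)) (cong (λ u → u + (- (+ 12 * + r) + + 6 * + p - 1ℤ) * + p) (sym (+base r))))
    where
    value : + (6 ℕ.* r ℕ.* r ℕ.+ r) - + (12 ℕ.* p ℕ.* r) + + (6 ℕ.* p ℕ.* p ∸ p) ≡ + 6 * + r * + r + + r - + 12 * + p * + r + (+ 6 * + p * + p - + p)
    value = cong₂ _+_ (cong₂ _-_ (+base r) (+cpr 12 p r)) (+6pp-p p)
    lem₁ : ∀ p r → + 2 * (+ 6 * r * r + r - + 12 * p * r + (+ 6 * p * p - p)) ≡ + 3 * (+ 2 * r - + 2 * p) * (+ 2 * r - + 2 * p) + 1ℤ * (+ 2 * r - + 2 * p)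
    lem₁ = solve-∀
    lem₂ : ∀ p r → + 6 * r * r + r - + 12 * p * r + (+ 6 * p * p - p) ≡ + 6 * r * r + r + (- (+ 12 * r) + + 6 * p - 1ℤ) * p
    lem₂ = solve-∀

-- Divisibility, parity and sums with few nonzero terms.

module Arithmetic where
  open PowerSeries
  open FiniteSums
  open Positivity
  open import Data.Integer using (_+_; _-_; _*_; -_)
  open Signed using (_∣_; divides; ∣ᵤ⇒∣; ∣⇒∣ᵤ; ∣m∣n⇒∣m+n; ∣m∣n⇒∣m-n; ∣m⇒∣-m; ∣n⇒∣m*n; ∣m⇒∣m*n)

  ∣-resp : ∀ {k a b} → a ≡ b → k ∣ a → k ∣ b
  ∣-resp refl d = d

  prime-∣-* : ∀ {p} → Prime p → ∀ a b → + p ∣ a * b → (+ p ∣ a) ⊎ (+ p ∣ b)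
  prime-∣-* {p} pr a b d with euclidsLemma ∣ a ∣ ∣ b ∣ pr (subst (p ℕD.∣_) (ℤₚ.abs-* a b) (∣⇒∣ᵤ d))
  ... | inj₁ p∣a = inj₁ (∣ᵤ⇒∣ p∣a)
  ... | inj₂ p∣b = inj₂ (∣ᵤ⇒∣ p∣b)

  large-∤ : ∀ {p} c .⦃ _ : ℕ.NonZero c ⦄ → c ℕ.< p → ¬ (+ p ∣ + c)
  large-∤ c c<p d = ℕₚ.<⇒≱ c<p (ℕD.∣⇒≤ (∣⇒∣ᵤ d))

  prime-∣-cancel : ∀ {p} → Prime p → ∀ a b → ¬ (+ p ∣ a) → + p ∣ a * b → + p ∣ b
  prime-∣-cancel pr a b ¬d d with prime-∣-* pr a b d
  ... | inj₁ p∣a = ⊥-elim (¬d p∣a)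
  ... | inj₂ p∣b = p∣b

  even⊎odd : ∀ m → Σ ℕ λ l → m ≡ l ℕ.+ l ⊎ m ≡ suc (l ℕ.+ l)
  even⊎odd zero = 0 , inj₁ refl
  even⊎odd (suc m) with even⊎odd m
  ... | l , inj₁ refl = l , inj₂ refl
  ... | l , inj₂ refl = suc l , inj₁ (cong suc (sym (ℕₚ.+-suc l l)))

  even≢odd : ∀ m h → m ℕ.+ m ≢ suc (h ℕ.+ h)
  even≢odd zero    h ()
  even≢odd (suc m) zero e with trans (sym (ℕₚ.+-suc m m)) (ℕₚ.suc-injective e)
  ... | ()
  even≢odd (suc m) (suc h) e = even≢odd m h (ℕₚ.suc-injective (trans (sym (ℕₚ.+-suc m m)) (trans (ℕₚ.suc-injective e) (cong suc (ℕₚ.+-suc h h)))))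

  prime-odd : ∀ {p} → Prime p → 3 ℕ.< p → Σ ℕ λ h → p ≡ suc (h ℕ.+ h)
  prime-odd {p} pr 3<p with even⊎odd p
  ... | h , inj₂ p≡ = h , p≡
  ... | h , inj₁ p≡ with prime⇒irreducible pr {2} (ℕD.divides h (trans p≡ (lem h)))
    where
    lem : ∀ h → h ℕ.+ h ≡ h ℕ.* 2
    lem = ℕSolver.solve-∀
  ...   | inj₁ ()
  ...   | inj₂ refl = ⊥-elim (ℕₚ.<⇒≱ 3<p (ℕ.s≤s (ℕ.s≤s ℕ.z≤n)))

  ∑-single : ∀ n a {f} → a ℕ.< n → (∀ r → r ℕ.< n → r ≢ a → f r ≡ 0ℤ) → ∑ n f ≡ f a
  ∑-single (suc n) a {f} (ℕ.s≤s a≤n) z with ℕₚ.m≤n⇒m<n∨m≡n a≤n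
  ... | inj₁ a<n = trans (cong₂ _+_ (∑-single n a a<n (λ r l → z r (ℕₚ.m≤n⇒m≤1+n l))) (z n ℕₚ.≤-refl (λ n≡a → ℕₚ.<⇒≢ a<n (sym n≡a)))) (ℤₚ.+-identityʳ (f a))
  ... | inj₂ refl = trans (cong (λ z → z + f n) (∑-zero n (λ r l → z r (ℕₚ.m≤n⇒m≤1+n l) (ℕₚ.<⇒≢ l)))) (ℤₚ.+-identityˡ (f n))

  ∑-pair : ∀ n a b {f} → a ℕ.< n → b ℕ.< n → a ≢ b → (∀ r → r ℕ.< n → r ≢ a → r ≢ b → f r ≡ 0ℤ) → ∑ n f ≡ f a + f b
  ∑-pair n a b {f} a<n b<n a≢b z = begin
    ∑ n f                     ≡⟨ ∑-cong-< n (λ r _ → split r) ⟩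
    ∑ n (λ r → at r + off r)  ≡⟨ ∑-distrib-+ n at off ⟩
    ∑ n at + ∑ n off          ≡⟨ cong₂ _+_ (∑-single n a a<n (λ r _ r≢a → cong (λ b → if b then f r else 0ℤ) (≡ᵇ-false r≢a)))
                                           (∑-single n b b<n (λ r l r≢b → off-zero r l r≢b)) ⟩
    at a + off b              ≡⟨ cong₂ _+_ (cong (λ c → if c then f a else 0ℤ) (≡ᵇ-refl a)) (cong (λ c → if c then 0ℤ else f b) (≡ᵇ-false (λ b≡a → a≢b (sym b≡a)))) ⟩
    f a + f b                 ∎
    where
    open ≡-Reasoning
    at off : ℕ → ℤ
    at  r = if r ≡ᵇ a then f r else 0ℤ
    off r = if r ≡ᵇ a then 0ℤ else f r
    split : ∀ r → f r ≡ at r + off r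
    split r with r ≡ᵇ a
    ... | true  = sym (ℤₚ.+-identityʳ (f r))
    ... | false = sym (ℤₚ.+-identityˡ (f r))
    off-zero : ∀ r → r ℕ.< n → r ≢ b → off r ≡ 0ℤ
    off-zero r l r≢b with r ℕ.≟ a
    ... | yes refl = cong (λ c → if c then 0ℤ else f r) (≡ᵇ-refl r)
    ... | no r≢a   = trans (cong (λ c → if c then 0ℤ else f r) (≡ᵇ-false r≢a)) (z r l r≢a r≢b)

  private
    ordered : ∀ {p r s} → r ℕ.≤ s → s ℕ.< p → + p ∣ + r - + s → r ≡ s
    ordered {p} {r} {s} r≤s s<p d = trans (sym (ℕₚ.+-identityʳ r)) (trans (cong (r ℕ.+_) (sym (small (s ∸ r) (ℕₚ.≤-<-trans (ℕₚ.m∸n≤m s r) s<p)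
        (subst (p ℕD.∣_) (trans (cong ∣_∣ (ℤₚ.m-n≡m⊖n r s)) (ℤₚ.∣⊖∣-≤ r≤s)) (∣⇒∣ᵤ d))))) (ℕₚ.m+[n∸m]≡n r≤s))
      where
      small : ∀ m → m ℕ.< p → p ℕD.∣ m → m ≡ 0
      small zero    _   _ = refl
      small (suc m) m<p e = ⊥-elim (ℕₚ.<⇒≱ m<p (ℕD.∣⇒≤ e))

  residue-unique : ∀ {p r s} → r ℕ.< p → s ℕ.< p → + p ∣ + r - + s → r ≡ s
  residue-unique {p} {r} {s} r<p s<p d with ℕₚ.≤-total r s
  ... | inj₁ r≤s = ordered r≤s s<p d
  ... | inj₂ s≤r = sym (ordered s≤r r<p (∣-resp (lem (+ r) (+ s)) (∣m⇒∣-m d)))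
    where
    lem : ∀ a b → - (a - b) ≡ b - a
    lem = solve-∀

-- The dissection of the pentagonal series modulo `p`.

-- Both residues of `p` modulo 3 are treated together: `η = -1` and `Λ = (p-1)/6` in one case,
-- `η = 1` and `Λ = (p+1)/6` in the other. The series `pe` has exponents `i k(3k + η)/2`.
module Dissection (p i : ℕ) (prime : Prime p) (3<p : 3 ℕ.< p) (1<i : 1 ℕ.< i) (p∤i : ¬ (p ℕD.∣ i)) (n : ℕ)
  (η Λ : ℤ) (p≡ : + p ≡ + 6 ℤ.* Λ ℤ.- η) (η² : η ℤ.* η ≡ 1ℤ)
  (pe : ℤ → ℕ) (pe-bounded : ThetaSeries.Bounded pe)
  (pe-spec : ∀ k → + 2 ℤ.* + pe k ≡ + i ℤ.* (+ 3 ℤ.* k ℤ.* k ℤ.+ η ℤ.* k))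
  (pentagonal : PowerSeries._≈[_]_ (ThetaSeries.Θ pe) (suc n) (GaussianBinomials.poch i i (suc n))) where
  open PowerSeries
  open GaussianBinomials
  open BilateralSums
  open ThetaSeries
  open QuintupleProduct
  open Quotients
  open Positivity
  open LeastExponents
  open Arithmetic
  open import Data.Integer using (_+_; _-_; _*_; -_)
  open Signed using (_∣_; divides; ∣ᵤ⇒∣; ∣⇒∣ᵤ; ∣m∣n⇒∣m+n; ∣m∣n⇒∣m-n; ∣m⇒∣-m; ∣n⇒∣m*n; ∣m⇒∣m*n)

  private
    q I : ℤ
    q = + p
    I = + i
    0<p : 0 ℕ.< p
    0<p = ℕₚ.≤-trans (ℕ.s≤s ℕ.z≤n) 3<p
    0<i : 0 ℕ.< i
    0<i = ℕₚ.<-trans ℕₚ.≤-refl 1<i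

  -- With x = k + Λ the exponent i(3k² + ηk)/2 becomes i((6x - p)² - 1)/24.
  pe-centered : ∀ x → + 2 * + pe (x - Λ) ≡ I * (+ 3 * x * x - q * x + (q * Λ - + 3 * Λ * Λ))
  pe-centered x = trans (pe-spec (x - Λ)) (trans (lem I x Λ η) (cong (λ z → I * (+ 3 * x * x - z * x + (z * Λ - + 3 * Λ * Λ))) (sym p≡)))
    where
    lem : ∀ I x Λ η → I * (+ 3 * (x - Λ) * (x - Λ) + η * (x - Λ)) ≡
                      I * (+ 3 * x * x - (+ 6 * Λ - η) * x + ((+ 6 * Λ - η) * Λ - + 3 * Λ * Λ))
    lem = solve-∀

  inv : Series
  inv = invPoch p p n

  coeff-hasSum : HasSum (λ k → sgn k * shift (pe k) inv n) (coeff p i n)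
  coeff-hasSum = subst (HasSum _) (sym eq) (Θ-*ˢ-hasSum pe-bounded inv n)
    where
    eq : coeff p i n ≡ (Θ pe *ˢ inv) n
    eq = trans (partialProd-≈ {p} {i} 0<p n n) (*ˢ-cong-mod {g = inv} (λ m l → trans
      (sym (poch-mod-≤ i n (ℕₚ.n≤1+n n) m (ℕₚ.<-≤-trans l (ℕₚ.≤-trans (ℕₚ.≤-reflexive (ℕₚ.+-comm 1 n))
        (ℕₚ.+-mono-≤ (ℕₚ.m≤n*m n i ⦃ ℕ.>-nonZero 0<i ⦄) 0<i)))))
      (sym (pentagonal m l))) (λ _ _ → refl) n ℕₚ.≤-refl)

  shift-inv-∤ : ∀ e → ¬ (q ∣ + n - + e) → shift e inv n ≡ 0ℤ
  shift-inv-∤ e ∤ with ℕₚ.≤-<-connex e n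
  ... | inj₂ n<e = shift-< e inv n n<e
  ... | inj₁ e≤n with ℕₚ.m≤n⇒∃[o]m+o≡n e≤n
  ...   | o , eq = trans (cong (shift e inv) (sym eq)) (trans (shift-≥ e inv o) (proj₂ (inflates-invPoch 0<p n) o
            (λ p∣o → ∤ (∣-resp (trans (lem (+ e) (+ o)) (cong (λ z → z - + e) (trans (sym (ℤₚ.pos-+ e o)) (cong +_ eq)))) (∣ᵤ⇒∣ p∣o)))))
    where
    lem : ∀ e o → o ≡ e + o - e
    lem = solve-∀

  coeff-zero : (∀ k → ¬ (q ∣ + n - + pe k)) → coeff p i n ≡ 0ℤ
  coeff-zero none = hasSum-unique coeff-hasSum
    (hasSum-zero (λ k → trans (cong (sgn k *_) (shift-inv-∤ (pe k) (none k))) (ℤₚ.*-zeroʳ (sgn k))))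

  centred-hasSum : HasSum (λ x → sgn (x - Λ) * shift (pe (x - Λ)) inv n) (coeff p i n)
  centred-hasSum = hasSum-translate (- Λ) coeff-hasSum

  -- Twice the difference of the exponents is `i(x - y)(3(x + y) - p)`, congruent to
  -- `3i(x - y)(x + y)` modulo `p`; the prime `p` divides neither 3 nor `i`.
  same-class : ∀ x y → q ∣ + n - + pe (x - Λ) → q ∣ + n - + pe (y - Λ) → (q ∣ x - y) ⊎ (q ∣ x + y)
  same-class x y dx dy = prime-∣-* prime (x - y) (x + y)
    (prime-∣-cancel prime (+ 3) _ (large-∤ 3 3<p) (prime-∣-cancel prime I _ (λ d → p∤i (∣⇒∣ᵤ d))
      (∣-resp eq (∣m∣n⇒∣m+n (∣n⇒∣m*n (+ 2) (∣m∣n⇒∣m-n dy dx)) (∣m⇒∣m*n (I * (x - y)) (divides 1ℤ (sym (ℤₚ.*-identityˡ q))))))))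
    where
    c = q * Λ - + 3 * Λ * Λ
    lem₁ : ∀ n a b → + 2 * (n - b - (n - a)) ≡ + 2 * a - + 2 * b
    lem₁ = solve-∀
    lem₂ : ∀ I x y q c → I * (+ 3 * x * x - q * x + c) - I * (+ 3 * y * y - q * y + c) + q * (I * (x - y)) ≡ I * (+ 3 * ((x - y) * (x + y)))
    lem₂ = solve-∀
    eq : + 2 * ((+ n - + pe (y - Λ)) - (+ n - + pe (x - Λ))) + q * (I * (x - y)) ≡ I * (+ 3 * ((x - y) * (x + y)))
    eq = trans (cong (λ z → z + q * (I * (x - y))) (trans (lem₁ (+ n) (+ pe (x - Λ)) (+ pe (y - Λ))) (cong₂ _-_ (pe-centered x) (pe-centered y))))
      (lem₂ I x y q c)

  private
    h : ℕ
    h = proj₁ (prime-odd prime 3<p)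

    q≡ : q ≡ 1ℤ + (+ h + + h)
    q≡ = trans (cong +_ (proj₂ (prime-odd prime 3<p))) (+-congˡ 1ℤ (ℤₚ.pos-+ h h))

  sgn-q* : ∀ k j → sgn (k + q * j) ≡ sgn k * sgn j
  sgn-q* k j = trans (cong (λ z → sgn (k + z * j)) q≡) (trans (cong sgn (lem k j (+ h))) (trans (sgn-even (k + j) (+ h * j)) (sgn-+ k j)))
    where
    lem : ∀ k j h → k + (1ℤ + (h + h)) * j ≡ k + j + + 2 * (h * j)
    lem = solve-∀

  sgn-centred : ∀ t j → sgn (t + q * j - Λ) ≡ sgn (t - Λ) * sgn j
  sgn-centred t j = trans (cong sgn (lem t (q * j) Λ)) (sgn-q* (t - Λ) j)
    where
    lem : ∀ t a Λ → t + a - Λ ≡ t - Λ + a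
    lem = solve-∀

  sgn-reflect : ∀ t → sgn (- t - Λ) ≡ sgn (t - Λ)
  sgn-reflect t = trans (cong sgn (lem t Λ)) (sgn-even (t - Λ) (- t))
    where
    lem : ∀ t Λ → - t - Λ ≡ t - Λ + + 2 * (- t)
    lem = solve-∀

  odd-≢ : ∀ m → m ℕ.+ m ≢ p
  odd-≢ m eq = even≢odd m h (trans eq (proj₂ (prime-odd prime 3<p)))

  base : ℕ → ℕ
  base b = pe (+ b - Λ)

  coeffs : Series
  coeffs = invPoch 1 1 n

  -- A summand at an exponent in the class of n, after x^p has been replaced by x.
  deflate : ∀ u e ν → u ℕ.+ p ℕ.* ν ≡ n → shift (u ℕ.+ p ℕ.* e) inv n ≡ shift e coeffs ν
  deflate u e ν eq = trans (cong (shift (u ℕ.+ p ℕ.* e) inv) (sym eq)) (trans (shift-+ u (p ℕ.* e) inv (u ℕ.+ p ℕ.* ν))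
    (trans (shift-≥ u (shift (p ℕ.* e) inv) (p ℕ.* ν)) (proj₁ (inflates-shift 0<p (inflates-invPoch 0<p n) e) ν)))

  private
    raise : ∀ x y e → + 2 * + pe (y - Λ) ≡ + 2 * + pe (x - Λ) + q * (+ 2 * + e) → pe (y - Λ) ≡ pe (x - Λ) ℕ.+ p ℕ.* e
    raise x y e eq = halve (pe (y - Λ)) (pe (x - Λ) ℕ.+ p ℕ.* e) (trans eq (sym (trans (cong (+ 2 *_)
      (trans (ℤₚ.pos-+ (pe (x - Λ)) (p ℕ.* e)) (+-congˡ (+ pe (x - Λ)) (ℤₚ.pos-* p e)))) (lem (+ pe (x - Λ)) q (+ e)))))
      where
      lem : ∀ u q e → + 2 * (u + q * e) ≡ + 2 * u + q * (+ 2 * e)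
      lem = solve-∀

  module Central where
    P : ℕ
    P = i ℕ.* p

    e₀ : ℤ → ℕ
    e₀ = jacobi P (2 ℕ.* P)

    0<P : 0 ℕ.< P
    0<P = ℕₚ.*-mono-≤ 0<i 0<p

    pe-e₀ : ∀ j → pe (+ 0 + q * j - Λ) ≡ base 0 ℕ.+ p ℕ.* e₀ j
    pe-e₀ j = raise (+ 0) (+ 0 + q * j) (e₀ j) (trans (pe-centered (+ 0 + q * j)) (trans (lem I q j (q * Λ - + 3 * Λ * Λ))
      (cong₂ (λ a b → a + q * b) (sym (pe-centered (+ 0))) (sym (trans (jacobi-spec P (2 ℕ.* P) j)
        (cong₂ (λ a b → (a + b) * (j * j - j) + + 2 * a * j) (ℤₚ.pos-* i p) (trans (ℤₚ.pos-* 2 P) (cong (+ 2 *_) (ℤₚ.pos-* i p)))))))))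
      where
      lem : ∀ I q j c → I * (+ 3 * (+ 0 + q * j) * (+ 0 + q * j) - q * (+ 0 + q * j) + c) ≡
        I * (+ 3 * + 0 * + 0 - q * + 0 + c) + q * ((I * q + + 2 * (I * q)) * (j * j - j) + + 2 * (I * q) * j)
      lem = solve-∀

  -- The parameters of the quintuple identity, chosen so that `2B + D = ip`. Since `i > 1`, also
  -- `D > 1`, and the numerator factors leave `1 - x` alone.
  module Lateral (b : ℕ) (0<b : 0 ℕ.< b) (2b<p : b ℕ.+ b ℕ.< p) where
    B D : ℕ
    B = i ℕ.* b
    D = i ℕ.* (p ∸ (b ℕ.+ b))

    0<B : 0 ℕ.< B
    0<B = ℕₚ.*-mono-≤ 0<i 0<b

    1<D : 1 ℕ.< D
    1<D = ℕₚ.*-mono-≤ 1<i (ℕₚ.m<n⇒0<n∸m 2b<p)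

    0<D : 0 ℕ.< D
    0<D = ℕₚ.<-trans ℕₚ.≤-refl 1<D

    open Identity B D 0<B 0<D public using (e₁; e₂; e₁-spec; e₂-spec; e₁-bounded; e₂-bounded)

    private
      β = + b
      B≡ : + B ≡ I * β
      B≡ = ℤₚ.pos-* i b
      D≡ : + D ≡ I * (q - (β + β))
      D≡ = trans (ℤₚ.pos-* i (p ∸ (b ℕ.+ b))) (cong (I *_) (trans (sym (ℤₚ.⊖-≥ (ℕₚ.<⇒≤ 2b<p)))
        (trans (sym (ℤₚ.m-n≡m⊖n p (b ℕ.+ b))) (cong (λ z → q - z) (ℤₚ.pos-+ b b)))))

    pe-e₁ : ∀ j → pe (β + q * j - Λ) ≡ base b ℕ.+ p ℕ.* e₁ j
    pe-e₁ j = raise β (β + q * j) (e₁ j) (trans (pe-centered (β + q * j)) (trans (lem I q β j (q * Λ - + 3 * Λ * Λ))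
      (cong₂ (λ u v → u + q * v) (sym (pe-centered β)) (sym (trans (e₁-spec j)
        (cong₂ (λ u v → (u + u + v) * (+ 3 * j * j - j) + + 6 * u * j) B≡ D≡))))))
      where
      lem : ∀ I q β j c → I * (+ 3 * (β + q * j) * (β + q * j) - q * (β + q * j) + c) ≡
        I * (+ 3 * β * β - q * β + c) + q * ((I * β + I * β + I * (q - (β + β))) * (+ 3 * j * j - j) + + 6 * (I * β) * j)
      lem = solve-∀

    pe-e₂ : ∀ j → pe (- β + q * j - Λ) ≡ base b ℕ.+ p ℕ.* e₂ j
    pe-e₂ j = raise β (- β + q * j) (e₂ j) (trans (pe-centered (- β + q * j)) (trans (lem I q β j (q * Λ - + 3 * Λ * Λ))
      (cong₂ (λ u v → u + q * v) (sym (pe-centered β)) (sym (trans (e₂-spec j)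
        (cong₂ (λ u v → (u + u + v) * (+ 3 * j * j - j) - + 6 * u * j + + 2 * u) B≡ D≡))))))
      where
      lem : ∀ I q β j c → I * (+ 3 * (- β + q * j) * (- β + q * j) - q * (- β + q * j) + c) ≡
        I * (+ 3 * β * β - q * β + c) + q * ((I * β + I * β + I * (q - (β + β))) * (+ 3 * j * j - j) - + 6 * (I * β) * j + + 2 * (I * β))
      lem = solve-∀

    -- Equality would mean `4b = p`, against the oddness of `p`.
    2B≢D : B ℕ.+ B ≢ D
    2B≢D eq = odd-≢ (b ℕ.+ b) (trans (cong ((b ℕ.+ b) ℕ.+_) 2b≡) (ℕₚ.m+[n∸m]≡n (ℕₚ.<⇒≤ 2b<p)))
      where
      2b≡ : b ℕ.+ b ≡ p ∸ (b ℕ.+ b)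
      2b≡ = ℕₚ.*-cancelˡ-≡ (b ℕ.+ b) (p ∸ (b ℕ.+ b)) i ⦃ ℕ.>-nonZero 0<i ⦄ (trans (ℕₚ.*-distribˡ-+ i b b) eq)

  -- The quotients `(pe (x - Λ) - base b) / p` are the values of `e₀`, `e₁` and `e₂`, which are
  -- natural numbers; hence `base b` is the least exponent of its class.
  base-minimal : ∀ b → b ℕ.+ b ℕ.< p → ∀ x → (q ∣ x - + b) ⊎ (q ∣ x + + b) → Σ ℕ λ e → pe (x - Λ) ≡ base b ℕ.+ p ℕ.* e
  base-minimal zero 2b<p x d = from (either d)
    where
    lem₁ : ∀ x → x + - (+ 0) ≡ x
    lem₁ = solve-∀
    either : (q ∣ x - + 0) ⊎ (q ∣ x + + 0) → q ∣ x
    either (inj₁ d) = ∣-resp (lem₁ x) d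
    either (inj₂ d) = ∣-resp (ℤₚ.+-identityʳ x) d
    from : q ∣ x → Σ ℕ λ e → pe (x - Λ) ≡ base 0 ℕ.+ p ℕ.* e
    from (divides j eq) = Central.e₀ j , trans (cong (λ z → pe (z - Λ)) (trans eq (trans (ℤₚ.*-comm j q) (sym (ℤₚ.+-identityˡ (q * j)))))) (Central.pe-e₀ j)
  base-minimal b@(suc _) 2b<p x (inj₁ (divides j eq)) = e₁ j , trans (cong (λ z → pe (z - Λ)) (trans (lem x (+ b)) (trans (+-congˡ (+ b) eq) (+-congˡ (+ b) (ℤₚ.*-comm j q))))) (pe-e₁ j)
    where
    open Lateral b (ℕ.s≤s ℕ.z≤n) 2b<p
    lem : ∀ x b → x ≡ b + (x - b)
    lem = solve-∀
  base-minimal b@(suc _) 2b<p x (inj₂ (divides j eq)) = e₂ j , trans (cong (λ z → pe (z - Λ)) (trans (lem x (+ b)) (trans (+-congˡ (- (+ b)) eq) (+-congˡ (- (+ b)) (ℤₚ.*-comm j q))))) (pe-e₂ j)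
    where
    open Lateral b (ℕ.s≤s ℕ.z≤n) 2b<p
    lem : ∀ x b → x ≡ - b + (x + b)
    lem = solve-∀

  module _ (b : ℕ) (2b<p : b ℕ.+ b ℕ.< p) (ν : ℕ) (n≡ : base b ℕ.+ p ℕ.* ν ≡ n) where
    private
      s : ℤ
      s = sgn (+ b - Λ)

      H : ℤ → ℤ
      H x = sgn (x - Λ) * shift (pe (x - Λ)) inv n

      residues = hasSum-residues p 0<p centred-hasSum
      w = proj₁ residues

      b-class : q ∣ + n - + pe (+ b - Λ)
      b-class = divides (+ ν) (trans (cong (λ z → + z - + base b) (sym n≡)) (trans (cong (λ z → z - + base b)
        (trans (ℤₚ.pos-+ (base b) (p ℕ.* ν)) (+-congˡ (+ base b) (ℤₚ.pos-* p ν)))) (lem (+ base b) q (+ ν))))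
        where
        lem : ∀ u q ν → u + q * ν - u ≡ ν * q
        lem = solve-∀

      ν≤n : ν ℕ.≤ n
      ν≤n = ℕₚ.≤-trans (ℕₚ.m≤n*m ν p ⦃ ℕ.>-nonZero 0<p ⦄) (ℕₚ.≤-trans (ℕₚ.m≤n+m (p ℕ.* ν) (base b)) (ℕₚ.≤-reflexive n≡))

      term-value : ∀ t (e : ℤ → ℕ) → sgn (t - Λ) ≡ s → (∀ j → pe (t + q * j - Λ) ≡ base b ℕ.+ p ℕ.* e j) →
                   ∀ j → H (t + q * j) ≡ s * (sgn j * shift (e j) coeffs ν)
      term-value t e st pe≡ j = trans (cong₂ _*_ (trans (sgn-centred t j) (cong (_* sgn j) st))
        (trans (cong (λ z → shift z inv n) (pe≡ j)) (deflate (base b) (e j) ν n≡))) (ℤₚ.*-assoc s (sgn j) _)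

      column-value : ∀ t (e : ℤ → ℕ) → Bounded e → sgn (t - Λ) ≡ s → (∀ j → pe (t + q * j - Λ) ≡ base b ℕ.+ p ℕ.* e j) →
                     ∀ {v} → HasSum (λ j → H (t + q * j)) v → v ≡ s * (Θ e *ˢ coeffs) ν
      column-value t e be st pe≡ sum = hasSum-unique (hasSum-cong (term-value t e st pe≡) sum)
        (hasSum-scale s (Θ-*ˢ-hasSum be coeffs ν))

      off-class : ∀ r → r ℕ.< p → ¬ (q ∣ + r - + b) → ¬ (q ∣ + r + + b) → w r ≡ 0ℤ
      off-class r r<p ∤₁ ∤₂ = hasSum-unique (proj₁ (proj₂ residues) r r<p) (hasSum-zero (λ j →
        trans (cong (sgn (+ r + q * j - Λ) *_) (shift-inv-∤ (pe (+ r + q * j - Λ)) (λ d → contra j (same-class (+ r + q * j) (+ b) d b-class))))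
          (ℤₚ.*-zeroʳ (sgn (+ r + q * j - Λ)))))
        where
        drop : ∀ j c → q ∣ + r + q * j + c → q ∣ + r + c
        drop j c d = ∣-resp (lem (+ r) (q * j) c) (∣m∣n⇒∣m-n d (∣m⇒∣m*n j (divides 1ℤ (sym (ℤₚ.*-identityˡ q)))))
          where
          lem : ∀ r a c → r + a + c - a ≡ r + c
          lem = solve-∀
        contra : ∀ j → (q ∣ + r + q * j - + b) ⊎ (q ∣ + r + q * j + + b) → ⊥
        contra j (inj₁ d) = ∤₁ (drop j (- (+ b)) d)
        contra j (inj₂ d) = ∤₂ (drop j (+ b) d)

    -- Of the residues of `x` modulo `p` only `b` and `p - b` contribute, and they coincide with 0
    -- as the single one when `b = 0`. The signs at `b` and `-b` agree because their indices differ
    -- by an even number, so the two columns add up to the quintuple series.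
    coeff-sign : Σ ℤ λ v → (0ℤ ℤ.< v) × coeff p i n ≡ sgn (+ b - Λ) * v
    coeff-sign with b ℕ.≟ 0
    ... | yes refl = (Θ e₀ *ˢ coeffs) ν
      , poch-quotient-positive P (ℕₚ.*-mono-≤ 1<i 0<p) n (Θ e₀) (Pentagonal.pentagonal⁻ P 0<P (suc n)) ν ν≤n
      , trans (proj₂ (proj₂ residues)) (trans (∑-single p 0 0<p (λ r r<p r≢0 → off-class r r<p
            (λ d → r≢0 (residue-unique r<p 0<p d)) (λ d → r≢0 (residue-unique r<p 0<p d))))
          (column-value (+ 0) e₀ (jacobi-bounded 0<P (ℕₚ.<-≤-trans 0<P (ℕₚ.m≤m+n P _))) refl pe-e₀ (proj₁ (proj₂ residues) 0 0<p)))
      where open Central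
    ... | no b≢0 = ((Θ e₁ +ˢ Θ e₂) *ˢ coeffs) ν
      , QuintupleQuotient.quintuple-quotient-positive B D 0<B 1<D 2B≢D n ν ν≤n
      , trans (proj₂ (proj₂ residues)) (trans (∑-pair p b c b<p c<p b≢c (λ r r<p r≢b r≢c → off-class r r<p
            (λ d → r≢b (residue-unique r<p b<p d)) (λ d → r≢c (residue-unique r<p c<p (∣-resp (c-residue r) (∣m∣n⇒∣m-n d (divides 1ℤ (sym (ℤₚ.*-identityˡ q)))))))))
          (trans (cong₂ _+_ (column-value (+ b) e₁ e₁-bounded refl pe-e₁ (proj₁ (proj₂ residues) b b<p))
                            (column-value (- (+ b)) e₂ e₂-bounded (sgn-reflect (+ b)) pe-e₂
                               -- The column of residue `p - b` is moved by one step, to run over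
                               -- `-b + pj` as in `pe-e₂`.
                               (hasSum-cong (λ j → cong H (c-translate j)) (hasSum-translate (- 1ℤ) (proj₁ (proj₂ residues) c c<p)))))
            (trans (sym (ℤₚ.*-distribˡ-+ s _ _)) (cong (s *_) (sym (*ˢ-distribʳ coeffs (Θ e₁) (Θ e₂) ν))))))
      where
      0<b : 0 ℕ.< b
      0<b = ℕₚ.n≢0⇒n>0 b≢0
      open Lateral b 0<b 2b<p
      c = p ∸ b
      b<p : b ℕ.< p
      b<p = ℕₚ.≤-<-trans (ℕₚ.m≤m+n b b) 2b<p
      c<p : c ℕ.< p
      c<p = ℕₚ.∸-monoʳ-< 0<b (ℕₚ.<⇒≤ b<p)
      b≢c : b ≢ c
      b≢c eq = odd-≢ b (trans (cong (b ℕ.+_) eq) (ℕₚ.m+[n∸m]≡n (ℕₚ.<⇒≤ b<p)))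
      c≡ : + c ≡ q - + b
      c≡ = trans (sym (ℤₚ.⊖-≥ (ℕₚ.<⇒≤ b<p))) (sym (ℤₚ.m-n≡m⊖n p b))
      c-residue : ∀ r → + r + + b - q ≡ + r - + c
      c-residue r = trans (lem (+ r) (+ b) q) (cong (λ z → + r - z) (sym c≡))
        where
        lem : ∀ r b q → r + b - q ≡ r - (q - b)
        lem = solve-∀
      c-translate : ∀ j → + c + q * (j + - 1ℤ) ≡ - (+ b) + q * j
      c-translate j = trans (cong (λ z → z + q * (j + - 1ℤ)) c≡) (lem q (+ b) j)
        where
        lem : ∀ q b j → q - b + q * (j + - 1ℤ) ≡ - b + q * j
        lem = solve-∀

  pe-even : ∀ r → + 2 * + pe (+ 2 * (η * + r)) ≡ + 2 * (I * + (6 ℕ.* r ℕ.* r ℕ.+ r))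
  pe-even r = trans (pe-spec (+ 2 * (η * + r))) (trans (lem₁ I η (+ r)) (trans (cong (λ z → I * (+ 12 * z * + r * + r + + 2 * z * + r)) η²)
    (trans (lem₂ I (+ r)) (cong (λ z → + 2 * (I * z)) (sym (+base r))))))
    where
    lem₁ : ∀ I η r → I * (+ 3 * (+ 2 * (η * r)) * (+ 2 * (η * r)) + η * (+ 2 * (η * r))) ≡ I * (+ 12 * (η * η) * r * r + + 2 * (η * η) * r)
    lem₁ = solve-∀
    lem₂ : ∀ I r → I * (+ 12 * 1ℤ * r * r + + 2 * 1ℤ * r) ≡ + 2 * (I * (+ 6 * r * r + r))
    lem₂ = solve-∀

  -- As `6r² + r` is the pentagonal exponent at index `2ηr`, the required `r` is `ηk/2` modulo `p`;
  -- the inverse of 2 is `(p+1)/2 = h + 1`.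
  residue-of : ∀ k → Σ ℕ λ r → r ℕ.< p × q ∣ + pe k - I * + (6 ℕ.* r ℕ.* r ℕ.+ r)
  residue-of k = r , ℤDM.n%ℕd<d a p , prime-∣-cancel prime (+ 2) _ (large-∤ 2 (ℕₚ.<-trans ℕₚ.≤-refl 3<p))
    (∣-resp eq (∣n⇒∣m*n I (∣m⇒∣m*n (+ 3 * (k′ + + 2 * + r) + 1ℤ) k′≡2r)))
    where
    instance
      p≢0 : ℕ.NonZero p
      p≢0 = ℕ.>-nonZero 0<p
    k′ a : ℤ
    k′ = η * k
    a  = k′ * (1ℤ + + h)
    r = a ℤDM.%ℕ p
    t = a ℤDM./ℕ p
    k′≡2r : q ∣ k′ - + 2 * + r
    k′≡2r = divides (+ 2 * t - k′) (trans (lem₁ k′ (+ r) t q) (trans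
        (cong₂ (λ u v → k′ * (1ℤ + u) - + 2 * v + (+ 2 * t - k′) * q) q≡ (sym (ℤDM.a≡a%ℕn+[a/ℕn]*n a p)))
        (lem₂ k′ (+ h) ((+ 2 * t - k′) * q))))
      where
      lem₁ : ∀ k r t q → k - + 2 * r ≡ k * (1ℤ + q) - + 2 * (r + t * q) + (+ 2 * t - k) * q
      lem₁ = solve-∀
      lem₂ : ∀ k h b → k * (1ℤ + (1ℤ + (h + h))) - + 2 * (k * (1ℤ + h)) + b ≡ b
      lem₂ = solve-∀
    eq : I * ((k′ - + 2 * + r) * (+ 3 * (k′ + + 2 * + r) + 1ℤ)) ≡ + 2 * (+ pe k - I * + (6 ℕ.* r ℕ.* r ℕ.+ r))
    eq = trans (lem₁ I η k (+ r)) (trans (cong₂ (λ u v → I * (+ 3 * u * k * k + η * k) - + 2 * (I * v)) η² (sym (+base r)))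
      (trans (cong (λ z → z - + 2 * (I * + (6 ℕ.* r ℕ.* r ℕ.+ r))) (trans (lem₂ I η k) (sym (pe-spec k)))) (lem₃ (+ pe k) _)))
      where
      lem₁ : ∀ I η k r → I * ((η * k - + 2 * r) * (+ 3 * (η * k + + 2 * r) + 1ℤ)) ≡ I * (+ 3 * (η * η) * k * k + η * k) - + 2 * (I * (+ 6 * r * r + r))
      lem₁ = solve-∀
      lem₂ : ∀ I η k → I * (+ 3 * 1ℤ * k * k + η * k) ≡ I * (+ 3 * k * k + η * k)
      lem₂ = solve-∀
      lem₃ : ∀ a b → + 2 * a - + 2 * b ≡ + 2 * (a - b)
      lem₃ = solve-∀

  vanishing : (∀ r → r ℕ.< p → ¬ (q ∣ + n - + (i ℕ.* (6 ℕ.* r ℕ.* r ℕ.+ r)))) → coeff p i n ≡ 0ℤ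
  vanishing none = coeff-zero (λ k d → let (r , r<p , d′) = residue-of k in
    none r r<p (∣-resp (trans (lem (+ n) (+ pe k) (I * + (6 ℕ.* r ℕ.* r ℕ.+ r))) (cong (λ z → + n - z) (sym (ℤₚ.pos-* i _)))) (∣m∣n⇒∣m+n d d′)))
    where
    lem : ∀ n a b → n - a + (a - b) ≡ n - b
    lem = solve-∀

  -- One exponent of the class that is at most `n` is enough, `base b` being the least of them; the
  -- difference to `n` is then a natural number divisible by `p`.
  pe-reached : ∀ b → b ℕ.+ b ℕ.< p → q ∣ + n - + base b → (x : ℤ) → + pe (x - Λ) ℤ.≤ + n → q ∣ + n - + pe (x - Λ) →
    Σ ℕ λ ν → base b ℕ.+ p ℕ.* ν ≡ n
  pe-reached b 2b<p db x x≤n dx = ν , trans (cong (base b ℕ.+_) (trans (ℕₚ.*-comm p ν) (sym (ℕD._∣_.equality p∣o)))) o≡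
    where
    minimal = base-minimal b 2b<p x (same-class x (+ b) dx db)
    gap = ℕₚ.m≤n⇒∃[o]m+o≡n (ℕₚ.≤-trans (ℕₚ.≤-trans (ℕₚ.m≤m+n (base b) (p ℕ.* proj₁ minimal)) (ℕₚ.≤-reflexive (sym (proj₂ minimal)))) (ℤₚ.drop‿+≤+ x≤n))
    o = proj₁ gap
    o≡ : base b ℕ.+ o ≡ n
    o≡ = proj₂ gap
    lem : ∀ b o → b + o - b ≡ o
    lem = solve-∀
    p∣o : p ℕD.∣ o
    p∣o = ∣⇒∣ᵤ (∣-resp (trans (cong (λ z → z - + base b) (trans (cong +_ (sym o≡)) (ℤₚ.pos-+ (base b) o))) (lem (+ base b) (+ o))) db)
    ν = ℕD._∣_.quotient p∣o

  -- Here `x₀ = Λ + 2ηr` is the centred index of `r` and `t` its representative nearest to 0. Since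
  -- `x₀ - Λ` is even, `1 = sgn (t - Λ) · sgn j`, so the sign found by `coeff-sign` at `b = ∣ t ∣`
  -- is `sgn j`.
  signed : (∀ r → Exponent p η r (L p r)) → N p i ℤ.< + n → ∀ r j t → r ℕ.< p → q ∣ + n - + (i ℕ.* (6 ℕ.* r ℕ.* r ℕ.+ r)) →
    Λ + + 2 * (η * + r) ≡ t + q * j → ∣ t ∣ ℕ.+ ∣ t ∣ ℕ.< p → Σ ℤ λ v → (0ℤ ℤ.< v) × coeff p i n ≡ sgn j * v
  signed L-exp N<n r j t r<p d x₀≡ 2t<p = proj₁ result , proj₁ (proj₂ result)
    , trans (proj₂ (proj₂ result)) (cong (_* proj₁ result) sign)
    where
    b = ∣ t ∣
    x₀ = Λ + + 2 * (η * + r)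
    pe-x₀ : + pe (x₀ - Λ) ≡ I * + (6 ℕ.* r ℕ.* r ℕ.+ r)
    pe-x₀ = ℤₚ.*-cancelˡ-≡ (+ 2) _ _ (trans (cong (λ z → + 2 * + pe z) (lem Λ (+ 2 * (η * + r)))) (pe-even r))
      where
      lem : ∀ a b → a + b - a ≡ b
      lem = solve-∀
    d₀ : q ∣ + n - + pe (x₀ - Λ)
    d₀ = ∣-resp (cong (λ z → + n - z) (trans (ℤₚ.pos-* i _) (sym pe-x₀))) d
    x₀-t : q ∣ x₀ - t
    x₀-t = divides j (trans (cong (λ z → z - t) x₀≡) (lem t q j))
      where
      lem : ∀ t q j → t + q * j - t ≡ j * q
      lem = solve-∀
    t≡±b = ℤₚ.+∣i∣≡i⊎+∣i∣≡-i t
    x₀∓b : (q ∣ x₀ - + b) ⊎ (q ∣ x₀ + + b)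
    x₀∓b = Sum.map (λ eq → ∣-resp (cong (λ z → x₀ - z) (sym eq)) x₀-t) (λ eq → ∣-resp (cong (λ z → x₀ + z) (sym eq)) x₀-t) t≡±b
    sgn-t : sgn (t - Λ) ≡ sgn (+ b - Λ)
    sgn-t = Sum.[ (λ eq → cong (λ z → sgn (z - Λ)) (sym eq))
                , (λ eq → trans (sym (sgn-reflect t)) (cong (λ z → sgn (z - Λ)) (sym eq))) ]′ t≡±b
    minimal = base-minimal b 2t<p x₀ x₀∓b
    e = proj₁ minimal
    eq = proj₂ minimal
    db : q ∣ + n - + base b
    db = ∣-resp (trans (cong (λ z → + n - z + q * + e) (trans (cong +_ eq) (trans (ℤₚ.pos-+ (base b) (p ℕ.* e)) (+-congˡ (+ base b) (ℤₚ.pos-* p e)))))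
        (lem (+ n) (+ base b) q (+ e))) (∣m∣n⇒∣m+n d₀ (∣m⇒∣m*n (+ e) (divides 1ℤ (sym (ℤₚ.*-identityˡ q)))))
      where
      lem : ∀ n b q e → n - (b + q * e) + q * e ≡ n - b
      lem = solve-∀
    iL : q ∣ + n - I * L p r
    iL = ∣-resp (trans (cong (λ z → + n - z - I * proj₁ (proj₂ (L-exp r)) * q) (ℤₚ.pos-* i _))
        (trans (lem (+ n) I (+ (6 ℕ.* r ℕ.* r ℕ.+ r)) (proj₁ (proj₂ (L-exp r))) q) (cong (λ z → + n - I * z) (sym (proj₂ (proj₂ (L-exp r)))))))
      (∣m∣n⇒∣m-n d (∣n⇒∣m*n (I * proj₁ (proj₂ (L-exp r))) (divides 1ℤ (sym (ℤₚ.*-identityˡ q)))))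
      where
      lem : ∀ n I e a q → n - I * e - I * a * q ≡ n - I * (e + a * q)
      lem = solve-∀
    witness = N-witness {p} {i} {n} 0<p N<n r r<p iL
    r′ = proj₁ witness
    k′ = proj₁ (proj₁ (L-exp r′))
    pe-k′ : I * L p r′ ≡ + pe ((k′ + Λ) - Λ)
    pe-k′ = ℤₚ.*-cancelˡ-≡ (+ 2) _ _ (trans (lem₁ I (L p r′)) (trans (cong (I *_) (proj₂ (proj₁ (L-exp r′)))) (trans (sym (pe-spec k′))
        (cong (λ z → + 2 * + pe z) (lem₂ k′ Λ)))))
      where
      lem₁ : ∀ a b → + 2 * (a * b) ≡ a * (+ 2 * b)
      lem₁ = solve-∀
      lem₂ : ∀ k a → k ≡ k + a - a
      lem₂ = solve-∀
    reached = pe-reached b 2t<p db (k′ + Λ) (subst (ℤ._≤ + n) pe-k′ (proj₂ (proj₂ witness)))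
      (∣-resp (cong (λ z → + n - z) pe-k′) (proj₁ (proj₂ witness)))
    result = coeff-sign b 2t<p (proj₁ reached) (proj₂ reached)
    sgn-x₀ : sgn (+ b - Λ) * sgn j ≡ 1ℤ
    sgn-x₀ = trans (cong (_* sgn j) (sym sgn-t)) (trans (sym (sgn-centred t j)) (trans (cong (λ z → sgn (z - Λ)) (sym x₀≡))
      (trans (cong sgn (lem Λ (η * + r))) (sgn-even 0ℤ (η * + r)))))
      where
      lem : ∀ a b → a + + 2 * b - a ≡ 0ℤ + + 2 * b
      lem = solve-∀
    sign : sgn (+ b - Λ) ≡ sgn j
    sign = trans (sym (ℤₚ.*-identityʳ _)) (trans (cong (sgn (+ b - Λ) *_) (sym (alternating-sq ∣ j ∣)))
      (trans (sym (ℤₚ.*-assoc (sgn (+ b - Λ)) (sgn j) (sgn j))) (trans (cong (_* sgn j) sgn-x₀) (ℤₚ.*-identityˡ (sgn j)))))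

  private
    bound : ∀ m a → 6 ℕ.* m ℕ.+ a ≡ 3 ℕ.* p → m ℕ.+ m ℕ.< p
    bound m a eq = ℕₚ.≤∧≢⇒< (ℕₚ.*-cancelˡ-≤ 3 (ℕₚ.≤-trans (ℕₚ.≤-reflexive (lem m)) (ℕₚ.≤-trans (ℕₚ.m≤m+n (6 ℕ.* m) a) (ℕₚ.≤-reflexive eq)))) (odd-≢ m)
      where
      lem : ∀ m → 3 ℕ.* (m ℕ.+ m) ≡ 6 ℕ.* m
      lem = ℕSolver.solve-∀

  -- The witnesses `a` and `c` say that `6t` lies between `-3p` and `3p`. Strictness comes from
  -- parity, since `2 ∣ t ∣` cannot equal the odd number `p`.
  near : ∀ t (a c : ℕ) → + 3 * q - + 6 * t ≡ + a → + 3 * q + + 6 * t ≡ + c → ∣ t ∣ ℕ.+ ∣ t ∣ ℕ.< p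
  near (+ m) a c lower _ = bound m a (ℤₚ.+-injective (trans (cong₂ _+_ (ℤₚ.pos-* 6 m) (sym lower)) (trans (lem (+ m) q) (sym (ℤₚ.pos-* 3 p)))))
    where
    lem : ∀ m q → + 6 * m + (+ 3 * q - + 6 * m) ≡ + 3 * q
    lem = solve-∀
  near -[1+ m ] a c _ upper = bound (suc m) c (ℤₚ.+-injective (trans (cong₂ _+_ (ℤₚ.pos-* 6 (suc m)) (sym upper)) (trans (lem (+ suc m) q) (sym (ℤₚ.pos-* 3 p)))))
    where
    lem : ∀ m q → + 6 * m + (+ 3 * q + + 6 * (- m)) ≡ + 3 * q
    lem = solve-∀

-- The ranges of `r` and the resulting signs.

module SignPattern (p i : ℕ) (prime : Prime p) (3<p : 3 ℕ.< p) (1<i : 1 ℕ.< i) (p∤i : ¬ (p ℕD.∣ i))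
  (n : ℕ) (N<n : N p i ℤ.< + n) where
  open PowerSeries
  open ThetaSeries
  open Positivity
  open LeastExponents
  open BilateralSums
  open Arithmetic
  open import Data.Integer using (_+_; _-_; _*_; -_)
  open Signed using (_∣_; divides; ∣ᵤ⇒∣; ∣⇒∣ᵤ; ∣m∣n⇒∣m+n; ∣m∣n⇒∣m-n; ∣m⇒∣-m; ∣n⇒∣m*n; ∣m⇒∣m*n)

  private
    q I : ℤ
    q = + p
    I = + i
    0<i : 0 ℕ.< i
    0<i = ℕₚ.<-trans ℕₚ.≤-refl 1<i
    0<2i : 0 ℕ.< 2 ℕ.* i
    0<2i = ℕₚ.<-≤-trans 0<i (ℕₚ.m≤m+n i _)

  Class : ℕ → Set
  Class r = q ℤD.∣ (+ n - + (i ℕ.* (6 ℕ.* r ℕ.* r ℕ.+ r)))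

  Pattern : (Outer Inner : ℕ → Set) → Set
  Pattern Outer Inner =
    ((r : ℕ) → r ℕ.< p → Class r → Outer r → + 0 ℤ.< coeff p i n) ×
    ((r : ℕ) → r ℕ.< p → Class r → Inner r → coeff p i n ℤ.< + 0) ×
    (((r : ℕ) → r ℕ.< p → ¬ Class r) → coeff p i n ≡ + 0)

  private
    X : ℕ → ℕ
    X r = 12 ℕ.* r ℕ.+ 1

    +X : ∀ r → + X r ≡ + 12 * + r + 1ℤ
    +X r = trans (ℤₚ.pos-+ (12 ℕ.* r) 1) (cong (λ z → z + 1ℤ) (ℤₚ.pos-* 12 r))

    below : ∀ c r → X r ℕ.≤ c ℕ.* p → Σ ℕ λ o → + c * q - + 12 * + r - 1ℤ ≡ + o
    below c r le with ℕₚ.m≤n⇒∃[o]m+o≡n le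
    ... | o , eq = o , trans (cong (λ z → z - + 12 * + r - 1ℤ) (trans (sym (ℤₚ.pos-* c p)) (trans (cong +_ (sym eq)) (trans (ℤₚ.pos-+ (X r) o) (cong (λ z → z + + o) (+X r))))))
        (lem (+ 12 * + r) (+ o))
      where
      lem : ∀ a o → a + 1ℤ + o - a - 1ℤ ≡ o
      lem = solve-∀

    above : ∀ c r → c ℕ.* p ℕ.< X r → Σ ℕ λ o → + 12 * + r + 1ℤ - + c * q ≡ + o
    above c r lt with ℕₚ.m≤n⇒∃[o]m+o≡n (ℕₚ.<⇒≤ lt)
    ... | o , eq = o , trans (cong₂ _-_ (trans (sym (+X r)) (trans (cong +_ (sym eq)) (ℤₚ.pos-+ (c ℕ.* p) o))) (sym (ℤₚ.pos-* c p))) (lem (+ (c ℕ.* p)) (+ o))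
      where
      lem : ∀ a o → a + o - a ≡ o
      lem = solve-∀

    total : ∀ c r → Σ ℕ λ o → + c * q + + 12 * + r + 1ℤ ≡ + o
    total c r = c ℕ.* p ℕ.+ 12 ℕ.* r ℕ.+ 1 , sym (trans (ℤₚ.pos-+ (c ℕ.* p ℕ.+ 12 ℕ.* r) 1)
      (cong (λ z → z + 1ℤ) (trans (ℤₚ.pos-+ (c ℕ.* p) (12 ℕ.* r)) (cong₂ _+_ (ℤₚ.pos-* c p) (ℤₚ.pos-* 12 r)))))

    r<p⇒X≤ : ∀ c {r} → 12 ℕ.≤ c → r ℕ.< p → X r ℕ.≤ c ℕ.* p
    r<p⇒X≤ c {r} 12≤c r<p = ℕₚ.≤-trans (ℕₚ.+-monoʳ-≤ (12 ℕ.* r) (ℕ.s≤s (ℕ.z≤n {11}))) (ℕₚ.≤-trans (ℕₚ.≤-reflexive (lem r)) (ℕₚ.*-mono-≤ 12≤c r<p))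
      where
      lem : ∀ r → 12 ℕ.* r ℕ.+ 12 ≡ 12 ℕ.* suc r
      lem = ℕSolver.solve-∀

    -- The relation between `p` and `Λ` is carried as an explicit summand `z` equal to 0, so that
    -- the remaining equation is a polynomial identity for the ring solver.
    combine : ∀ {a b z c} → a ≡ b + z → z ≡ 0ℤ → b ≡ c → a ≡ c
    combine {b = b} p refl r = trans p (trans (ℤₚ.+-identityʳ b) r)

    positive : ∀ {c v} → 0ℤ ℤ.< v → c ≡ 1ℤ * v → 0ℤ ℤ.< c
    positive {v = v} 0<v eq = subst (0ℤ ℤ.<_) (sym (trans eq (ℤₚ.*-identityˡ v))) 0<v

    negative : ∀ {c v} → 0ℤ ℤ.< v → c ≡ - 1ℤ * v → c ℤ.< 0ℤ
    negative {v = v} 0<v eq = subst (ℤ._< 0ℤ) (sym (trans eq (ℤₚ.-1*i≡-i v))) (ℤₚ.neg-mono-< 0<v)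

  pattern₁ : ∀ l → p ≡ 6 ℕ.* l ℕ.+ 1 → p ℕDM.% 3 ≡ 1 →
    Pattern (λ r → X r ℕ.≤ 4 ℕ.* p ⊎ 10 ℕ.* p ℕ.< X r) (λ r → 4 ℕ.* p ℕ.< X r × X r ℕ.≤ 10 ℕ.* p)
  pattern₁ l p≡ p%3 = outer , inner , λ none → vanishing (λ r r<p d → none r r<p (∣⇒∣ᵤ d))
    where
    Λ = + l
    q≡ : q ≡ + 6 * Λ - - 1ℤ
    q≡ = trans (cong +_ p≡) (trans (ℤₚ.pos-+ (6 ℕ.* l) 1) (cong (λ z → z + 1ℤ) (ℤₚ.pos-* 6 l)))
    z≡ : + 6 * Λ + 1ℤ - q ≡ 0ℤ
    z≡ = trans (cong (λ z → + 6 * Λ + 1ℤ - z) q≡) (lem Λ)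
      where
      lem : ∀ Λ → + 6 * Λ + 1ℤ - (+ 6 * Λ - - 1ℤ) ≡ 0ℤ
      lem = solve-∀
    spec : ∀ k → + 2 * + jacobi i (2 ℕ.* i) k ≡ I * (+ 3 * k * k + - 1ℤ * k)
    spec k = trans (jacobi-spec i (2 ℕ.* i) k) (trans (cong (λ z → (I + z) * (k * k - k) + + 2 * I * k) (ℤₚ.pos-* 2 i)) (lem I k))
      where
      lem : ∀ I k → (I + + 2 * I) * (k * k - k) + + 2 * I * k ≡ I * (+ 3 * k * k + - 1ℤ * k)
      lem = solve-∀
    open Dissection p i prime 3<p 1<i p∤i n (- 1ℤ) Λ q≡ refl (jacobi i (2 ℕ.* i)) (jacobi-bounded 0<i 0<2i) spec
      (Pentagonal.pentagonal⁻ i 0<i (suc n))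
    -- The two hypotheses are `3p ∓ 6t ≥ 0` for `t = Λ - 2r - pj`, with `6Λ = p - 1` inserted. For
    -- `j = 0, -1, -2` they cut out the three ranges of `r`, with cuts where `12r + 1` passes `4p`
    -- and `10p`.
    sign-of : ∀ r j → r ℕ.< p → Class r →
      (Σ ℕ λ a → + 2 * q + + 12 * + r + 1ℤ + + 6 * (q * j) ≡ + a) → (Σ ℕ λ c → + 4 * q - + 12 * + r - 1ℤ - + 6 * (q * j) ≡ + c) →
      Σ ℤ λ v → (0ℤ ℤ.< v) × coeff p i n ≡ sgn j * v
    sign-of r j r<p d (a , lo) (c , hi) = signed (L-exponent₁ {l = l} p≡ p%3) N<n r j (Λ - + 2 * + r - q * j) r<p (∣ᵤ⇒∣ d) (lem Λ (+ r) (q * j))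
      (near (Λ - + 2 * + r - q * j) a c (combine (lem₁ q Λ (+ r) (q * j)) (cong -_ z≡) lo) (combine (lem₂ q Λ (+ r) (q * j)) z≡ hi))
      where
      lem : ∀ Λ r a → Λ + + 2 * (- 1ℤ * r) ≡ Λ - + 2 * r - a + a
      lem = solve-∀
      lem₁ : ∀ q Λ r a → + 3 * q - + 6 * (Λ - + 2 * r - a) ≡ + 2 * q + + 12 * r + 1ℤ + + 6 * a + - (+ 6 * Λ + 1ℤ - q)
      lem₁ = solve-∀
      lem₂ : ∀ q Λ r a → + 3 * q + + 6 * (Λ - + 2 * r - a) ≡ + 4 * q - + 12 * r - 1ℤ - + 6 * a + (+ 6 * Λ + 1ℤ - q)
      lem₂ = solve-∀
    outer : (r : ℕ) → r ℕ.< p → Class r → X r ℕ.≤ 4 ℕ.* p ⊎ 10 ℕ.* p ℕ.< X r → + 0 ℤ.< coeff p i n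
    outer r r<p d (inj₁ le) = let (_ , 0<v , eq) = sign-of r 0ℤ r<p d (proj₁ (total 2 r) , trans (lem₁ q (+ r)) (proj₂ (total 2 r))) (proj₁ (below 4 r le) , trans (lem₂ q (+ r)) (proj₂ (below 4 r le)))
      in positive 0<v eq
      where
      lem₁ : ∀ q r → + 2 * q + + 12 * r + 1ℤ + + 6 * (q * 0ℤ) ≡ + 2 * q + + 12 * r + 1ℤ
      lem₁ = solve-∀
      lem₂ : ∀ q r → + 4 * q - + 12 * r - 1ℤ - + 6 * (q * 0ℤ) ≡ + 4 * q - + 12 * r - 1ℤ
      lem₂ = solve-∀
    -- For `j = -2` the upper limit is `16p`, which `12r + 1` cannot reach because `r < p`.
    outer r r<p d (inj₂ lt) = let (_ , 0<v , eq) = sign-of r (- + 2) r<p d (proj₁ (above 10 r lt) , trans (lem₁ q (+ r)) (proj₂ (above 10 r lt)))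
                                    (proj₁ (below 16 r (r<p⇒X≤ 16 (ℕₚ.m≤m+n 12 4) r<p)) , trans (lem₂ q (+ r)) (proj₂ (below 16 r (r<p⇒X≤ 16 (ℕₚ.m≤m+n 12 4) r<p))))
      in positive 0<v eq
      where
      lem₁ : ∀ q r → + 2 * q + + 12 * r + 1ℤ + + 6 * (q * (- + 2)) ≡ + 12 * r + 1ℤ - + 10 * q
      lem₁ = solve-∀
      lem₂ : ∀ q r → + 4 * q - + 12 * r - 1ℤ - + 6 * (q * (- + 2)) ≡ + 16 * q - + 12 * r - 1ℤ
      lem₂ = solve-∀
    inner : (r : ℕ) → r ℕ.< p → Class r → 4 ℕ.* p ℕ.< X r × X r ℕ.≤ 10 ℕ.* p → coeff p i n ℤ.< + 0
    inner r r<p d (lt , le) = let (_ , 0<v , eq) = sign-of r (- 1ℤ) r<p d (proj₁ (above 4 r lt) , trans (lem₁ q (+ r)) (proj₂ (above 4 r lt)))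
                                    (proj₁ (below 10 r le) , trans (lem₂ q (+ r)) (proj₂ (below 10 r le)))
      in negative 0<v eq
      where
      lem₁ : ∀ q r → + 2 * q + + 12 * r + 1ℤ + + 6 * (q * (- 1ℤ)) ≡ + 12 * r + 1ℤ - + 4 * q
      lem₁ = solve-∀
      lem₂ : ∀ q r → + 4 * q - + 12 * r - 1ℤ - + 6 * (q * (- 1ℤ)) ≡ + 10 * q - + 12 * r - 1ℤ
      lem₂ = solve-∀

  pattern₂ : ∀ l → p ≡ 6 ℕ.* l ℕ.+ 5 → p ℕDM.% 3 ≡ 2 →
    Pattern (λ r → X r ℕ.≤ 2 ℕ.* p ⊎ 8 ℕ.* p ℕ.< X r) (λ r → 2 ℕ.* p ℕ.< X r × X r ℕ.≤ 8 ℕ.* p)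
  pattern₂ l p≡ p%3 = outer , inner , λ none → vanishing (λ r r<p d → none r r<p (∣⇒∣ᵤ d))
    where
    Λ = + suc l
    q≡ : q ≡ + 6 * Λ - 1ℤ
    q≡ = trans (cong +_ p≡) (trans (ℤₚ.pos-+ (6 ℕ.* l) 5) (trans (cong (λ z → z + + 5) (ℤₚ.pos-* 6 l)) (lem (+ l))))
      where
      lem : ∀ l → + 6 * l + + 5 ≡ + 6 * (1ℤ + l) - 1ℤ
      lem = solve-∀
    z≡ : + 6 * Λ - 1ℤ - q ≡ 0ℤ
    z≡ = ℤₚ.i≡j⇒i-j≡0 (sym q≡)
    spec : ∀ k → + 2 * + jacobi (2 ℕ.* i) i k ≡ I * (+ 3 * k * k + 1ℤ * k)
    spec k = trans (jacobi-spec (2 ℕ.* i) i k) (trans (cong (λ z → (z + I) * (k * k - k) + + 2 * z * k) (ℤₚ.pos-* 2 i)) (lem I k))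
      where
      lem : ∀ I k → (+ 2 * I + I) * (k * k - k) + + 2 * (+ 2 * I) * k ≡ I * (+ 3 * k * k + 1ℤ * k)
      lem = solve-∀
    open Dissection p i prime 3<p 1<i p∤i n 1ℤ Λ q≡ refl (jacobi (2 ℕ.* i) i) (jacobi-bounded 0<2i 0<i) spec
      (Pentagonal.pentagonal⁺ i 0<i (suc n))
    sign-of : ∀ r j → r ℕ.< p → Class r →
      (Σ ℕ λ a → + 2 * q - + 12 * + r - 1ℤ + + 6 * (q * j) ≡ + a) → (Σ ℕ λ c → + 4 * q + + 12 * + r + 1ℤ - + 6 * (q * j) ≡ + c) →
      Σ ℤ λ v → (0ℤ ℤ.< v) × coeff p i n ≡ sgn j * v
    -- Now `t = Λ + 2r - pj` and `6Λ = p + 1`; `r` enters with the other sign, so the ranges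
    -- correspond to `j = 0, 1, 2`, with cuts at `2p` and `8p`.
    sign-of r j r<p d (a , lo) (c , hi) = signed (L-exponent₂ {l = l} p≡ p%3) N<n r j (Λ + + 2 * + r - q * j) r<p (∣ᵤ⇒∣ d) (lem Λ (+ r) (q * j))
      (near (Λ + + 2 * + r - q * j) a c (combine (lem₁ q Λ (+ r) (q * j)) (cong -_ z≡) lo) (combine (lem₂ q Λ (+ r) (q * j)) z≡ hi))
      where
      lem : ∀ Λ r a → Λ + + 2 * (1ℤ * r) ≡ Λ + + 2 * r - a + a
      lem = solve-∀
      lem₁ : ∀ q Λ r a → + 3 * q - + 6 * (Λ + + 2 * r - a) ≡ + 2 * q - + 12 * r - 1ℤ + + 6 * a + - (+ 6 * Λ - 1ℤ - q)
      lem₁ = solve-∀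
      lem₂ : ∀ q Λ r a → + 3 * q + + 6 * (Λ + + 2 * r - a) ≡ + 4 * q + + 12 * r + 1ℤ - + 6 * a + (+ 6 * Λ - 1ℤ - q)
      lem₂ = solve-∀
    outer : (r : ℕ) → r ℕ.< p → Class r → X r ℕ.≤ 2 ℕ.* p ⊎ 8 ℕ.* p ℕ.< X r → + 0 ℤ.< coeff p i n
    outer r r<p d (inj₁ le) = let (_ , 0<v , eq) = sign-of r 0ℤ r<p d (proj₁ (below 2 r le) , trans (lem₁ q (+ r)) (proj₂ (below 2 r le))) (proj₁ (total 4 r) , trans (lem₂ q (+ r)) (proj₂ (total 4 r)))
      in positive 0<v eq
      where
      lem₁ : ∀ q r → + 2 * q - + 12 * r - 1ℤ + + 6 * (q * 0ℤ) ≡ + 2 * q - + 12 * r - 1ℤ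
      lem₁ = solve-∀
      lem₂ : ∀ q r → + 4 * q + + 12 * r + 1ℤ - + 6 * (q * 0ℤ) ≡ + 4 * q + + 12 * r + 1ℤ
      lem₂ = solve-∀
    outer r r<p d (inj₂ lt) = let (_ , 0<v , eq) = sign-of r (+ 2) r<p d
                                    (proj₁ (below 14 r (r<p⇒X≤ 14 (ℕₚ.m≤m+n 12 2) r<p)) , trans (lem₁ q (+ r)) (proj₂ (below 14 r (r<p⇒X≤ 14 (ℕₚ.m≤m+n 12 2) r<p))))
                                    (proj₁ (above 8 r lt) , trans (lem₂ q (+ r)) (proj₂ (above 8 r lt)))
      in positive 0<v eq
      where
      lem₁ : ∀ q r → + 2 * q - + 12 * r - 1ℤ + + 6 * (q * + 2) ≡ + 14 * q - + 12 * r - 1ℤ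
      lem₁ = solve-∀
      lem₂ : ∀ q r → + 4 * q + + 12 * r + 1ℤ - + 6 * (q * + 2) ≡ + 12 * r + 1ℤ - + 8 * q
      lem₂ = solve-∀
    inner : (r : ℕ) → r ℕ.< p → Class r → 2 ℕ.* p ℕ.< X r × X r ℕ.≤ 8 ℕ.* p → coeff p i n ℤ.< + 0
    inner r r<p d (lt , le) = let (_ , 0<v , eq) = sign-of r 1ℤ r<p d (proj₁ (below 8 r le) , trans (lem₁ q (+ r)) (proj₂ (below 8 r le)))
                                    (proj₁ (above 2 r lt) , trans (lem₂ q (+ r)) (proj₂ (above 2 r lt)))
      in negative 0<v eq
      where
      lem₁ : ∀ q r → + 2 * q - + 12 * r - 1ℤ + + 6 * (q * 1ℤ) ≡ + 8 * q - + 12 * r - 1ℤ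
      lem₁ = solve-∀
      lem₂ : ∀ q r → + 4 * q + + 12 * r + 1ℤ - + 6 * (q * 1ℤ) ≡ + 12 * r + 1ℤ - + 2 * q
      lem₂ = solve-∀

-- Residues of the prime modulo 6.

module ResiduesModSix where
  open Arithmetic
  open import Data.Integer using (_+_; _-_; _*_; -_)
  open Signed using (_∣_; divides; ∣ᵤ⇒∣; ∣⇒∣ᵤ; ∣m∣n⇒∣m+n; ∣m∣n⇒∣m-n; ∣m⇒∣-m; ∣n⇒∣m*n; ∣m⇒∣m*n)

  -- With the residue modulo 3 given, the oddness of `p` fixes the parity of the quotient of `p` by
  -- 3.
  6l+1 : ∀ {p} → Prime p → 3 ℕ.< p → p ℕDM.% 3 ≡ 1 → Σ ℕ λ l → p ≡ 6 ℕ.* l ℕ.+ 1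
  6l+1 {p} pr 3<p p%3 with even⊎odd (p ℕDM./ 3) | prime-odd pr 3<p | trans (ℕDM.m≡m%n+[m/n]*n p 3) (cong (ℕ._+ p ℕDM./ 3 ℕ.* 3) p%3)
  ... | l , inj₁ eq | _     | p≡ = l , trans p≡ (trans (cong (λ z → 1 ℕ.+ z ℕ.* 3) eq) (lem l))
    where
    lem : ∀ l → 1 ℕ.+ (l ℕ.+ l) ℕ.* 3 ≡ 6 ℕ.* l ℕ.+ 1
    lem = ℕSolver.solve-∀
  ... | l , inj₂ eq | h , e | p≡ = ⊥-elim (even≢odd (3 ℕ.* l ℕ.+ 2) h (trans (lem l) (trans (sym (trans p≡ (cong (λ z → 1 ℕ.+ z ℕ.* 3) eq))) e)))
    where
    lem : ∀ l → 3 ℕ.* l ℕ.+ 2 ℕ.+ (3 ℕ.* l ℕ.+ 2) ≡ 1 ℕ.+ suc (l ℕ.+ l) ℕ.* 3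
    lem = ℕSolver.solve-∀

  6l+5 : ∀ {p} → Prime p → 3 ℕ.< p → p ℕDM.% 3 ≡ 2 → Σ ℕ λ l → p ≡ 6 ℕ.* l ℕ.+ 5
  6l+5 {p} pr 3<p p%3 with even⊎odd (p ℕDM./ 3) | prime-odd pr 3<p | trans (ℕDM.m≡m%n+[m/n]*n p 3) (cong (ℕ._+ p ℕDM./ 3 ℕ.* 3) p%3)
  ... | l , inj₂ eq | _     | p≡ = l , trans p≡ (trans (cong (λ z → 2 ℕ.+ z ℕ.* 3) eq) (lem l))
    where
    lem : ∀ l → 2 ℕ.+ suc (l ℕ.+ l) ℕ.* 3 ≡ 6 ℕ.* l ℕ.+ 5
    lem = ℕSolver.solve-∀
  ... | l , inj₁ eq | h , e | p≡ = ⊥-elim (even≢odd (3 ℕ.* l ℕ.+ 1) h (trans (lem l) (trans (sym (trans p≡ (cong (λ z → 2 ℕ.+ z ℕ.* 3) eq))) e)))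
    where
    lem : ∀ l → 3 ℕ.* l ℕ.+ 1 ℕ.+ (3 ℕ.* l ℕ.+ 1) ≡ 2 ℕ.+ (l ℕ.+ l) ℕ.* 3
    lem = ℕSolver.solve-∀

open import Data.Nat using (_<_; _≤_; _+_; _*_)
open import Data.Nat.DivMod using (_%_)
open import Data.Nat.Divisibility using (_∣_)

theorem1p1 : (p i : ℕ) → Prime p → 3 < p → 1 < i → ¬ (p ∣ i) →
    (n : ℕ) → N p i ℤ.< + n →
    (p % 3 ≡ 1 →
    ((r : ℕ) → r < p → (+ p) ℤD.∣ (+ n ℤ.- + (i * (6 * r * r + r))) →
    (12 * r + 1 ≤ 4 * p ⊎ 10 * p < 12 * r + 1) → + 0 ℤ.< coeff p i n)
    × ((r : ℕ) → r < p → (+ p) ℤD.∣ (+ n ℤ.- + (i * (6 * r * r + r))) →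
    (4 * p < 12 * r + 1 × 12 * r + 1 ≤ 10 * p) → coeff p i n ℤ.< + 0)
    × (((r : ℕ) → r < p → ¬ ((+ p) ℤD.∣ (+ n ℤ.- + (i * (6 * r * r + r))))) →
    coeff p i n ≡ + 0))
    × (p % 3 ≡ 2 →
    ((r : ℕ) → r < p → (+ p) ℤD.∣ (+ n ℤ.- + (i * (6 * r * r + r))) →
    (12 * r + 1 ≤ 2 * p ⊎ 8 * p < 12 * r + 1) → + 0 ℤ.< coeff p i n)
    × ((r : ℕ) → r < p → (+ p) ℤD.∣ (+ n ℤ.- + (i * (6 * r * r + r))) →
    (2 * p < 12 * r + 1 × 12 * r + 1 ≤ 8 * p) → coeff p i n ℤ.< + 0)
    × (((r : ℕ) → r < p → ¬ ((+ p) ℤD.∣ (+ n ℤ.- + (i * (6 * r * r + r))))) →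
    coeff p i n ≡ + 0))
theorem1p1 p i p-prime 3<p 1<i p∤i n N<n =
    (λ p%3 → let (l , p≡) = ResiduesModSix.6l+1 p-prime 3<p p%3 in pattern₁ l p≡ p%3)
  , (λ p%3 → let (l , p≡) = ResiduesModSix.6l+5 p-prime 3<p p%3 in pattern₂ l p≡ p%3)
  where open SignPattern p i p-prime 3<p 1<i p∤i n N<n
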